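{- Let $d \geq 2$ and let $P \subset \mathbb{R}^d$ be a $d$-dimensional lattice polytope with $f^*$-vector $(f^*_0, f^*_1, \dots, f^*_d)$. Then (a) $f^*_0<f^*_1<\cdots<f^*_{\lfloor d/2\rfloor-1}\leq f^*_{\lfloor d/2\rfloor}$; (b) $f^*_{\lfloor 3d/4\rfloor} > f^*_{\lfloor 3d/4\rfloor + 1} > \cdots > f^*_d$; (c) $f^*_k \leq f^*_{d-1-k}$ for all integers $k$ with $0 \leq k \leq \frac{d-3}{2}$.
   Context: A lattice polytope is the convex hull of finitely many points of $\mathbb{Z}^d$. For a $d$-dimensional lattice polytope $P\subset\mathbb{R}^d$ and a positive integer $n$, let $\operatorname{ehr}_P(n)=|nP\cap\mathbb{Z}^d|$; this is a polynomial in $n$ of degree $d$. The $f^*$-vector $(f^*_0,\dots,f^*_d)$ of $P$ is defined by $\operatorname{ehr}_P(n)=\sum_{k=0}^d f^*_k\binom{n-1}{k}$ for all positive integers $n$. -}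

module Defs where

open import Data.Nat as ℕ using (ℕ; zero; suc)
open import Data.Nat.Combinatorics using (_C_)
open import Data.Integer as ℤ using (ℤ; +_)
open import Data.Rational as ℚ using (ℚ; 0ℚ; 1ℚ)
open import Data.Fin using (Fin; zero; suc)
open import Data.Vec using (Vec; lookup)
open import Data.List using (List; length)
open import Data.List.Membership.Propositional using (_∈_)
open import Data.List.Relation.Unary.Unique.Propositional using (Unique)
open import Data.Product using (Σ; ∃; _×_)
open import Relation.Binary.PropositionalEquality using (_≡_)
open import Function.Bundles using (_⇔_)

Point : ℕ → Set
Point d = Vec ℤ d

ℤ→ℚ : ℤ → ℚ
ℤ→ℚ z = z ℚ./ 1

Σℚ : (m : ℕ) → (Fin m → ℚ) → ℚ
Σℚ zero    f = 0ℚ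
Σℚ (suc m) f = f zero ℚ.+ Σℚ m (λ i → f (suc i))

Σℤ : (m : ℕ) → (Fin m → ℤ) → ℤ
Σℤ zero    f = + 0
Σℤ (suc m) f = f zero ℤ.+ Σℤ m (λ i → f (suc i))

-- x lies in the dilate n·conv(vs) : x = n · Σ λᵢ vᵢ with λᵢ ≥ 0, Σ λᵢ = 1.
-- (Coefficients are rational: for rational points/vertices this is equivalent
-- to the real convex hull.)
InDilate : {d m : ℕ} → ℕ → (Fin m → Point d) → Point d → Set
InDilate {d} {m} n vs x =
  Σ (Fin m → ℚ) λ λs →
    (∀ i → 0ℚ ℚ.≤ λs i) ×
    (Σℚ m λs ≡ 1ℚ) ×
    (∀ (j : Fin d) →
      ℤ→ℚ (lookup x j) ≡ ℤ→ℚ (+ n) ℚ.* Σℚ m (λ i → λs i ℚ.* ℤ→ℚ (lookup (vs i) j)))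

HasCard : {d : ℕ} → (Point d → Set) → ℕ → Set
HasCard {d} S c =
  Σ (List (Point d)) λ xs → Unique xs × (length xs ≡ c) × (∀ x → (x ∈ xs) ⇔ S x)

FullDim : {d m : ℕ} → (Fin m → Point d) → Set
FullDim {d} {m} vs =
  Σ (Fin m) λ i₀ → Σ (Fin d → Fin m) λ is →
    ∀ (c : Fin d → ℚ) →
      (∀ (j : Fin d) →
        Σℚ d (λ k → c k ℚ.* ℤ→ℚ (lookup (vs (is k)) j ℤ.- lookup (vs i₀) j)) ≡ 0ℚ) →
      ∀ k → c k ≡ 0ℚ

-- f : ℕ → ℤ is the f*-vector of conv(vs) (entries f 0 … f d):
-- ehr(n) = Σ_{k=0}^{d} f k · C(n-1,k) for all n ≥ 1.
IsFStar : {d m : ℕ} → (Fin m → Point d) → (ℕ → ℤ) → Set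
IsFStar {d} {m} vs f =
  ∀ (n' : ℕ) (c : ℕ) → HasCard (InDilate (suc n') vs) c →
    + c ≡ Σℤ (suc d) (λ k → f (Data.Fin.toℕ k) ℤ.* + (n' C Data.Fin.toℕ k))

{-# OPTIONS --safe #-}

-- With h* the numerator of the Ehrhart series, f* k = Σⱼ h* j · C(d + 1 - j, d - k). Part (c) and part (a)
-- compare these binomial coefficients for fixed j and need only h* ≥ 0 and h* 0 ≥ 1. In part (b) some coefficients of
-- f* k - f* (k + 1) are negative, and Hibi's inequalities Σ_{j ≤ i} h* (d + 1 - j) ≤ Σ_{j ≤ i} h* j compensate them.
--
-- Lexicographic linear programming triangulates the cone over the polytope (the pulling triangulation), and a small
-- generic vector p in the cone splits its lattice points x among half-open simplicial cones, according to the
-- cell in which x + p lies. Multiplying the counting series of a simplicial cone by 1 - t^ℓ for every generator of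
-- height ℓ leaves the count of its box points, so h* counts box points.
--
-- For Hibi's inequalities pull first an interior lattice vector g of height d + 1. The box points then have generating
-- function A(t) = (1 + t + ⋯ + t^d) h*(t), both for p = ε (g + q) and for p = ε (g - q) with q generic and small.
-- In every cell x ↦ (sum of the generators) - x injects the box points of height k > d for the second choice into the
-- box points of height 2 d + 1 - k for the first. Hence A (2 d + 1 - i) ≤ A i for i ≤ d,
-- and these coefficients are the two sides of Hibi's inequality.

module Submission where

open import Defs
open import Data.Bool using (Bool; true; false)
open import Data.Bool.Properties using () renaming (_≟_ to _≟ᵇ_)
open import Data.Empty using (⊥; ⊥-elim)
open import Data.Fin as Fin using (Fin; zero; suc; toℕ)
import Data.Fin.Properties as Fin
open import Data.Integer as ℤ using (ℤ) renaming (+_ to ⊕_; -[1+_] to ⊖[1+_])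
import Data.Integer.Properties as ℤ
open import Data.List as List using (List; []; _∷_; length; _++_)
import Data.List.Properties as List
open import Data.List.Membership.Propositional using (_∈_; find; lose)
open import Data.List.Membership.Propositional.Properties using (∈-++⁺ˡ; ∈-++⁺ʳ; ∈-++⁻; ∈-map⁺; ∈-map⁻; ∈-filter⁺; ∈-filter⁻; ∈-upTo⁺; ∈-cartesianProductWith⁺; ∈-concatMap⁺; ∈-lookup; ∈-allFin)
open import Data.List.Relation.Unary.All as All using (All; []; _∷_)
import Data.List.Relation.Unary.AllPairs as AllPairs
open import Data.List.Relation.Unary.Any as Any using (here; there; any?)
import Data.List.Relation.Unary.Any.Properties as Any
open import Data.List.Relation.Unary.Unique.Propositional using (Unique)
import Data.List.Relation.Unary.Unique.Propositional.Properties as Unique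
open import Data.Nat as ℕ using (ℕ; zero; suc; z≤n; s≤s)
open import Data.Nat.Combinatorics using (_C_; nCk+nC[k+1]≡[n+1]C[k+1]; nCk≡nC[n∸k]; k>n⇒nCk≡0; nCn≡1)
import Data.Nat.DivMod as ℕ
import Data.Nat.Properties as ℕ
import Data.Nat.Tactic.RingSolver as ℕ-Solver
open import Data.Product using (Σ; ∃; _×_; _,_; proj₁; proj₂)
import Data.Rational.Unnormalised as ℚᵘ
import Data.Rational.Unnormalised.Properties as ℚᵘ
open import Data.Sum using (_⊎_; inj₁; inj₂)
open import Data.Unit using (⊤; tt)
open import Data.Vec as Vec using (Vec; lookup; _[_]≔_)
import Data.Vec.Properties as Vec
open import Function using (_∘_; id)
open import Function.Bundles using (_⇔_; mk⇔; module Equivalence)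
open import Level using (0ℓ)
open import Relation.Binary.Definitions using (tri<; tri≈; tri>)
open import Relation.Binary.PropositionalEquality hiding ([_])
open import Relation.Nullary using (¬_; ¬?; Dec; yes; no; does; contradiction)
open import Relation.Nullary.Decidable using (dec⇒maybe; decidable-stable) renaming (_×-dec_ to infixr 4 _×-dec_; _→-dec_ to infixr 3 _→-dec_)
open import Relation.Unary using (Decidable)
open import Tactic.RingSolver.Core.AlmostCommutativeRing using (AlmostCommutativeRing; fromCommutativeRing)

-- The cells of a triangulation overlap in faces, so points on faces must be assigned. Coordinates
-- of lattice points with respect to the finitely many bases have bounded denominators; a small
-- enough `p` therefore never carries a nonzero coordinate to or past zero and only settles the ties
-- at zero. Because `p` lies in the cone, the half-open cells still cover exactly the lattice points
-- of the cone. Reflection in a cell swaps the conditions `0 < u` and `u ≤ 1` and would call for `p`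
-- and `- p`, but `- p` is outside the cone. The vectors `ε (g + q)` and `ε (g - q)` both lie inside
-- and are opposite in every coordinate except that of `g`. The height of `g` settles that one: a
-- box point of height `k > d` with `g`-coordinate 0 would reflect to a point of height at least
-- `d + 1`, whereas `2 d + 1 - k ≤ d`. For part (b) put `r = d - k - 1`. Negative coefficients in
-- `f* k - f* (k + 1)` occur only at `h* j` with `j > d - 2 r`, so Hibi's inequality for `i = 2 r`
-- is the fitting one. Its right side uses `j ≤ 2 r`, where the coefficients are large enough when
-- `4 r < d`, that is, when `k ≥ ⌊3 d / 4⌋`.

module Sequences where

  open import Data.Integer renaming (+_ to ⊕_) hiding (suc; pred)
  open import Data.Integer.Properties
  open import Data.Integer.Tactic.RingSolver using (solve-∀)
  open import Data.Fin.Subset using () renaming (∣_∣ to ∣_∣ˢ)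

  -- Finite sums and power series operators on integer sequences.

  ∑ : ℕ → (ℕ → ℤ) → ℤ
  ∑ zero f = ⊕ 0
  ∑ (suc n) f = f 0 + ∑ n (f ∘ suc)

  Σℤ≡∑ : ∀ n f → Σℤ n (λ k → f (toℕ k)) ≡ ∑ n f
  Σℤ≡∑ zero f = refl
  Σℤ≡∑ (suc n) f = cong (f 0 +_) (Σℤ≡∑ n (f ∘ suc))

  ∑-cong : ∀ n {f g} → (∀ k → k ℕ.< n → f k ≡ g k) → ∑ n f ≡ ∑ n g
  ∑-cong zero e = refl
  ∑-cong (suc n) e = cong₂ _+_ (e 0 (s≤s z≤n)) (∑-cong n (λ k p → e (suc k) (s≤s p)))

  ∑-zero : ∀ n {f} → (∀ k → k ℕ.< n → f k ≡ ⊕ 0) → ∑ n f ≡ ⊕ 0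
  ∑-zero zero e = refl
  ∑-zero (suc n) e = cong₂ _+_ (e 0 (s≤s z≤n)) (∑-zero n (λ k p → e (suc k) (s≤s p)))

  ∑-sub : ∀ n f g → ∑ n (λ k → f k - g k) ≡ ∑ n f - ∑ n g
  ∑-sub zero f g = refl
  ∑-sub (suc n) f g = trans (cong (f 0 - g 0 +_) (∑-sub n (f ∘ suc) (g ∘ suc))) (lem (f 0) (g 0) (∑ n (f ∘ suc)) (∑ n (g ∘ suc)))
    where lem : ∀ a b c d → a - b + (c - d) ≡ a + c - (b + d)
          lem = solve-∀

  ∑-last : ∀ n f → ∑ (suc n) f ≡ ∑ n f + f n
  ∑-last zero f = +-comm (f 0) (⊕ 0)
  ∑-last (suc n) f = trans (cong (f 0 +_) (∑-last n (f ∘ suc))) (sym (+-assoc (f 0) _ _))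

  ∑-mono : ∀ n {f g} → (∀ k → k ℕ.< n → f k ≤ g k) → ∑ n f ≤ ∑ n g
  ∑-mono zero p = ≤-refl
  ∑-mono (suc n) p = +-mono-≤ (p 0 (s≤s z≤n)) (∑-mono n (λ k q → p (suc k) (s≤s q)))

  ∑-*ˡ : ∀ n c f → ∑ n (λ k → c * f k) ≡ c * ∑ n f
  ∑-*ˡ zero c f = sym (*-zeroʳ c)
  ∑-*ˡ (suc n) c f = trans (cong (c * f 0 +_) (∑-*ˡ n c (f ∘ suc))) (sym (*-distribˡ-+ c _ _))

  -- shift ℓ and ∇ ℓ are multiplication of the generating function by t^ℓ and 1 - t^ℓ.

  shift : ℕ → (ℕ → ℤ) → ℕ → ℤ
  shift zero s n = s n
  shift (suc ℓ) s zero = ⊕ 0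
  shift (suc ℓ) s (suc n) = shift ℓ s n

  ∇ : ℕ → (ℕ → ℤ) → ℕ → ℤ
  ∇ ℓ s n = s n - shift ℓ s n

  ∇^ : ℕ → (ℕ → ℤ) → ℕ → ℤ
  ∇^ zero s = s
  ∇^ (suc k) s = ∇^ k (∇ 1 s)

  shift-+ : ∀ ℓ s n → shift ℓ s (ℓ ℕ.+ n) ≡ s n
  shift-+ zero s n = refl
  shift-+ (suc ℓ) s n = shift-+ ℓ s n

  shift-< : ∀ ℓ s n → n ℕ.< ℓ → shift ℓ s n ≡ ⊕ 0
  shift-< (suc ℓ) s zero p = refl
  shift-< (suc ℓ) s (suc n) (s≤s p) = shift-< ℓ s n p

  shift-cong : ∀ ℓ {s t} → (∀ n → s n ≡ t n) → ∀ n → shift ℓ s n ≡ shift ℓ t n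
  shift-cong zero e n = e n
  shift-cong (suc ℓ) e zero = refl
  shift-cong (suc ℓ) e (suc n) = shift-cong ℓ e n

  shift-add : ∀ ℓ s t n → shift ℓ (λ n → s n + t n) n ≡ shift ℓ s n + shift ℓ t n
  shift-add zero s t n = refl
  shift-add (suc ℓ) s t zero = refl
  shift-add (suc ℓ) s t (suc n) = shift-add ℓ s t n

  shift-zero : ∀ ℓ n → shift ℓ (λ _ → ⊕ 0) n ≡ ⊕ 0
  shift-zero zero n = refl
  shift-zero (suc ℓ) zero = refl
  shift-zero (suc ℓ) (suc n) = shift-zero ℓ n

  shift-shift : ∀ k ℓ s n → shift k (shift ℓ s) n ≡ shift ℓ (shift k s) n
  shift-shift zero ℓ s n = refl
  shift-shift (suc k) ℓ s n = trans (push k ℓ s n) (shift-cong ℓ (unpush k s) n)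
    where
    S : (ℕ → ℤ) → ℕ → ℤ
    S s zero = ⊕ 0
    S s (suc n) = s n
    unpush : ∀ k s n → S (shift k s) n ≡ shift (suc k) s n
    unpush k s zero = refl
    unpush k s (suc n) = refl
    S-shift : ∀ ℓ s n → S (shift ℓ s) n ≡ shift ℓ (S s) n
    S-shift zero s n = refl
    S-shift (suc ℓ) s zero = refl
    S-shift (suc ℓ) s (suc zero) = head ℓ s
      where head : ∀ ℓ s → ⊕ 0 ≡ shift ℓ (S s) 0
            head zero s = refl
            head (suc ℓ) s = refl
    S-shift (suc ℓ) s (suc (suc n)) = S-shift ℓ s (suc n)
    push : ∀ k ℓ s n → shift (suc k) (shift ℓ s) n ≡ shift ℓ (S (shift k s)) n
    push k ℓ s zero = sym (head ℓ)
      where head : ∀ ℓ → shift ℓ (S (shift k s)) 0 ≡ ⊕ 0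
            head zero = refl
            head (suc ℓ) = refl
    push k ℓ s (suc n) = trans (shift-shift k ℓ s n) (S-shift ℓ (shift k s) (suc n))

  ∇-cong : ∀ ℓ {s t} → (∀ n → s n ≡ t n) → ∀ n → ∇ ℓ s n ≡ ∇ ℓ t n
  ∇-cong ℓ e n = cong₂ _-_ (e n) (shift-cong ℓ e n)

  ∇-add : ∀ ℓ s t n → ∇ ℓ (λ n → s n + t n) n ≡ ∇ ℓ s n + ∇ ℓ t n
  ∇-add ℓ s t n = trans (cong (λ a → s n + t n - a) (shift-add ℓ s t n)) (lem (s n) (t n) (shift ℓ s n) (shift ℓ t n))
    where lem : ∀ a b c d → a + b - (c + d) ≡ a - c + (b - d)
          lem = solve-∀

  ∇-zero : ∀ ℓ n → ∇ ℓ (λ _ → ⊕ 0) n ≡ ⊕ 0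
  ∇-zero ℓ n = cong (λ a → ⊕ 0 - a) (shift-zero ℓ n)

  ∇^-cong : ∀ k {s t} → (∀ n → s n ≡ t n) → ∀ n → ∇^ k s n ≡ ∇^ k t n
  ∇^-cong zero e = e
  ∇^-cong (suc k) {s} {t} e = ∇^-cong k (∇-cong 1 {s} {t} e)

  ∇^-outer : ∀ k s n → ∇^ (suc k) s n ≡ ∇ 1 (∇^ k s) n
  ∇^-outer zero s n = refl
  ∇^-outer (suc k) s n = ∇^-outer k (∇ 1 s) n

  -- `1 - t` is invertible as a power series, so two sequences may be compared after one more
  -- application of `∇ 1`.
  ∇-injective : ∀ {s t} → (∀ n → ∇ 1 s n ≡ ∇ 1 t n) → ∀ n → s n ≡ t n
  ∇-injective {s} {t} e zero = trans (sym (+-identityʳ (s 0))) (trans (e 0) (+-identityʳ (t 0)))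
  ∇-injective {s} {t} e (suc n) = trans (lem (s (suc n)) (s n)) (trans (cong₂ _+_ (e (suc n)) (∇-injective {s} {t} e n)) (sym (lem (t (suc n)) (t n))))
    where lem : ∀ a b → a ≡ a - b + b
          lem = solve-∀

  -- Multiplication by the product of `1 - t^(ℓ i)` over the members `i` of `S` in the list, that
  -- is, by the denominator of the counting series of a simplicial cone with these generators.
  reduce : ∀ {M} → (Fin M → Bool) → (Fin M → ℕ) → List (Fin M) → (ℕ → ℤ) → ℕ → ℤ
  reduce S ℓ [] s = s
  reduce S ℓ (i ∷ is) s with S i
  ... | true = ∇ (ℓ i) (reduce S ℓ is s)
  ... | false = reduce S ℓ is s

  trues : ∀ {M} → (Fin M → Bool) → List (Fin M) → ℕ
  trues S [] = 0
  trues S (i ∷ is) with S i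
  ... | true = suc (trues S is)
  ... | false = trues S is

  reduce-one : ∀ {M} (S : Fin M → Bool) ℓ is → All (λ i → ℓ i ≡ 1) is → ∀ s n → reduce S ℓ is s n ≡ ∇^ (trues S is) s n
  reduce-one S ℓ [] [] s n = refl
  reduce-one S ℓ (i ∷ is) (e ∷ es) s n with S i
  ... | false = reduce-one S ℓ is es s n
  ... | true = trans (cong (λ k → ∇ k (reduce S ℓ is s) n) e) (trans (∇-cong 1 (reduce-one S ℓ is es s) n) (sym (∇^-outer (trues S is) s n)))

  trues-suc : ∀ {M} (S : Fin (suc M) → Bool) is → trues S (List.map suc is) ≡ trues (S ∘ suc) is
  trues-suc S [] = refl
  trues-suc S (i ∷ is) with S (suc i)
  ... | true = cong suc (trues-suc S is)
  ... | false = trues-suc S is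

  allFin-suc : ∀ n → List.allFin (suc n) ≡ zero ∷ List.map suc (List.allFin n)
  allFin-suc n = cong (zero ∷_) (sym (List.map-tabulate (λ i → i) suc))

  trues-allFin : ∀ {M} (S : Vec Bool M) → trues (lookup S) (List.allFin M) ≡ ∣ S ∣ˢ
  trues-allFin Vec.[] = refl
  trues-allFin {suc M} (b Vec.∷ S) = trans (cong (trues (lookup (b Vec.∷ S))) (allFin-suc M)) (head b)
    where
    tail : ∀ b → trues (lookup (b Vec.∷ S)) (List.map suc (List.allFin M)) ≡ ∣ S ∣ˢ
    tail b = trans (trues-suc (lookup (b Vec.∷ S)) (List.allFin M)) (trues-allFin S)
    head : ∀ b → trues (lookup (b Vec.∷ S)) (zero ∷ List.map suc (List.allFin M)) ≡ ∣ b Vec.∷ S ∣ˢ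
    head true = cong suc (tail true)
    head false = tail false

  reduce-add : ∀ {M} (S : Fin M → Bool) ℓ is s t n → reduce S ℓ is (λ n → s n + t n) n ≡ reduce S ℓ is s n + reduce S ℓ is t n
  reduce-add S ℓ [] s t n = refl
  reduce-add S ℓ (i ∷ is) s t n with S i
  ... | false = reduce-add S ℓ is s t n
  ... | true = trans (∇-cong (ℓ i) (reduce-add S ℓ is s t) n) (∇-add (ℓ i) (reduce S ℓ is s) (reduce S ℓ is t) n)

  ∇^-add : ∀ k s t n → ∇^ k (λ n → s n + t n) n ≡ ∇^ k s n + ∇^ k t n
  ∇^-add zero s t n = refl
  ∇^-add (suc k) s t n = trans (∇^-cong k (∇-add 1 s t) n) (∇^-add k (∇ 1 s) (∇ 1 t) n)

  ∇^-zero : ∀ k n → ∇^ k (λ _ → ⊕ 0) n ≡ ⊕ 0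
  ∇^-zero zero n = refl
  ∇^-zero (suc k) n = trans (∇^-cong k (∇-zero 1) n) (∇^-zero k n)

  cumulative : ∀ s n → s n ≡ ∑ (suc n) (∇ 1 s)
  cumulative s zero = lem (s 0)
    where lem : ∀ a → a ≡ a - ⊕ 0 + ⊕ 0
          lem = solve-∀
  cumulative s (suc n) = trans (lem (s (suc n)) (s n)) (trans (cong (_+ ∇ 1 s (suc n)) (cumulative s n)) (sym (∑-last (suc n) (∇ 1 s))))
    where lem : ∀ a b → a ≡ b + (a - b)
          lem = solve-∀

  eventually-constant : ∀ s d → (∀ j → d ℕ.< j → ∇ 1 s j ≡ ⊕ 0) → ∀ k → s (d ℕ.+ k) ≡ s d
  eventually-constant s d z zero = cong s (ℕ.+-identityʳ d)
  eventually-constant s d z (suc k) = trans (cong s (ℕ.+-suc d k)) (trans (lem (s (suc (d ℕ.+ k))) (s (d ℕ.+ k))) (trans (cong₂ _+_ (z (suc (d ℕ.+ k)) (s≤s (ℕ.m≤m+n d k))) (eventually-constant s d z k)) (+-identityˡ (s d))))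
    where lem : ∀ a b → a ≡ a - b + b
          lem = solve-∀

  -- For `s` the partial sums of h*, `∇ (suc d) s` has the series `(1 + t + ⋯ + t^d) h*(t)`. At an
  -- index `i ≤ d` the subtracted shift is still zero and leaves the initial sum `s i`; at
  -- `2 d + 1 - i` the sequence `s` is already constant and the shift leaves a tail sum.
  tail-sum-bound : ∀ s d i → i ℕ.≤ d → (∀ j → d ℕ.< j → ∇ 1 s j ≡ ⊕ 0) →
    ∇ (suc d) s (suc d ℕ.+ (d ℕ.∸ i)) ≤ ∇ (suc d) s i → s d - s (d ℕ.∸ i) ≤ s i
  tail-sum-bound s d i i≤d z p = subst₂ _≤_ left right p
    where
    left : ∇ (suc d) s (suc d ℕ.+ (d ℕ.∸ i)) ≡ s d - s (d ℕ.∸ i)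
    left = cong₂ _-_ (trans (cong s (sym (ℕ.+-suc d (d ℕ.∸ i)))) (eventually-constant s d z (suc (d ℕ.∸ i)))) (shift-+ (suc d) s (d ℕ.∸ i))
    right : ∇ (suc d) s i ≡ s i
    right = trans (cong (λ t → s i - t) (shift-< (suc d) s i (s≤s i≤d))) (+-identityʳ (s i))

  -- Binomial expansion of sequences, and forward differences.

  binomial : ℕ → ℕ → ℤ
  binomial n k = ⊕ (n C k)

  pascal : ∀ n k → binomial (suc n) (suc k) ≡ binomial n k + binomial n (suc k)
  pascal n k = cong ⊕_ (sym (nCk+nC[k+1]≡[n+1]C[k+1] n k))

  binomial-0 : ∀ n → binomial n 0 ≡ ⊕ 1
  binomial-0 zero = refl
  binomial-0 (suc n) = refl

  ∇-binomial : ∀ e n → ∇ 1 (λ n → binomial (n ℕ.+ suc e) (suc e)) n ≡ binomial (n ℕ.+ e) e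
  ∇-binomial e zero = trans (cong (λ a → ⊕ a - ⊕ 0) (trans (nCn≡1 (suc e)) (sym (nCn≡1 e)))) (+-identityʳ (binomial e e))
  ∇-binomial e (suc n) = trans (cong (_- binomial (n ℕ.+ suc e) (suc e)) (pascal (n ℕ.+ suc e) e))
    (trans (lem (binomial (n ℕ.+ suc e) e) (binomial (n ℕ.+ suc e) (suc e))) (cong (λ m → binomial m e) (ℕ.+-suc n e)))
    where lem : ∀ a b → a + b - b ≡ a
          lem = solve-∀

  -- The coefficient at `n` in the product of the polynomial with coefficients `h 0, …, h (m - 1)`
  -- and the power series of `b`.
  combination : (ℕ → ℤ) → ℕ → (ℕ → ℤ) → ℕ → ℤ
  combination h m b n = ∑ m (λ j → h j * shift j b n)

  ∇-combination : ∀ h m b n → ∇ 1 (combination h m b) n ≡ combination h m (∇ 1 b) n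
  ∇-combination h m b n = sym (trans (∑-cong m (λ j _ → trans (cong (h j *_) (shift-∇ j b n)) (lem (h j) (shift j b n) (shift 1 (shift j b) n))))
    (trans (∑-sub m (λ j → h j * shift j b n) (λ j → h j * shift 1 (shift j b) n)) (cong (λ t → combination h m b n - t) (sums n))))
    where
    lem : ∀ a b c → a * (b - c) ≡ a * b - a * c
    lem = solve-∀
    shift-sub : ∀ ℓ s t n → shift ℓ (λ n → s n - t n) n ≡ shift ℓ s n - shift ℓ t n
    shift-sub zero s t n = refl
    shift-sub (suc ℓ) s t zero = refl
    shift-sub (suc ℓ) s t (suc n) = shift-sub ℓ s t n
    shift-∇ : ∀ j b n → shift j (∇ 1 b) n ≡ shift j b n - shift 1 (shift j b) n
    shift-∇ j b n = trans (shift-sub j b (shift 1 b) n) (cong (λ t → shift j b n - t) (shift-shift j 1 b n))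
    sums : ∀ n → ∑ m (λ j → h j * shift 1 (shift j b) n) ≡ shift 1 (combination h m b) n
    sums zero = ∑-zero m (λ j _ → *-zeroʳ (h j))
    sums (suc n) = refl

  combination-unit : ∀ h m → (∀ j → m ℕ.≤ j → h j ≡ ⊕ 0) → ∀ n → combination h m (∇ 1 (λ _ → ⊕ 1)) n ≡ h n
  combination-unit h zero z n = sym (z n z≤n)
  combination-unit h (suc m) z zero = trans (cong₂ _+_ (*-identityʳ (h 0)) (∑-zero m (λ j _ → *-zeroʳ (h (suc j))))) (+-identityʳ (h 0))
  combination-unit h (suc m) z (suc n) = trans (cong₂ _+_ (*-zeroʳ (h 0)) (combination-unit (h ∘ suc) m (λ j p → z (suc j) (s≤s p)) n)) (+-identityˡ (h (suc n)))

  -- The binomials `C (n + e) e` are the coefficients of `1 / (1 - t)^(e + 1)`. Each induction step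
  -- multiplies both sides by `1 - t`, and the base case ends with the unit series
  -- `∇ 1 (λ _ → ⊕ 1)`.
  expand : ∀ h m → (∀ j → m ℕ.≤ j → h j ≡ ⊕ 0) → ∀ e s → (∀ n → ∇^ (suc e) s n ≡ h n) → ∀ n → s n ≡ combination h m (λ n → binomial (n ℕ.+ e) e) n
  expand h m z zero s p = ∇-injective λ n → trans (p n) (sym (trans (∇-combination h m _ n) (trans (∑-cong m (λ j _ → cong (h j *_) (shift-cong j (∇-cong 1 (λ n → binomial-0 (n ℕ.+ 0))) n))) (combination-unit h m z n))))
  expand h m z (suc e) s p = ∇-injective λ n → trans (expand h m z e (∇ 1 s) p n) (sym (trans (∇-combination h m _ n) (∑-cong m (λ j _ → cong (h j *_) (shift-cong j (∇-binomial e) n)))))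

  -- The shift truncates to zero below index `j`. At positive indices this agrees with the binomial
  -- formula, because there the upper entry has dropped below `d`.
  shift-binomial : ∀ d j n → j ℕ.≤ d → shift j (λ n → binomial (n ℕ.+ d) d) (suc n) ≡ binomial (n ℕ.+ (suc d ℕ.∸ j)) d
  shift-binomial d j n j≤d with j ℕ.≤? suc n
  ... | yes j≤1+n = trans (cong (shift j _) (sym (ℕ.m+[n∸m]≡n j≤1+n))) (trans (shift-+ j _ (suc n ℕ.∸ j)) (cong (λ m → binomial m d) eq))
    where
    open ≡-Reasoning
    eq : suc n ℕ.∸ j ℕ.+ d ≡ n ℕ.+ (suc d ℕ.∸ j)
    eq = begin
      suc n ℕ.∸ j ℕ.+ d ≡⟨ ℕ.+-∸-comm d j≤1+n ⟨
      suc n ℕ.+ d ℕ.∸ j ≡⟨ cong (ℕ._∸ j) (ℕ.+-suc n d) ⟨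
      n ℕ.+ suc d ℕ.∸ j ≡⟨ ℕ.+-∸-assoc n (ℕ.m≤n⇒m≤1+n j≤d) ⟩
      n ℕ.+ (suc d ℕ.∸ j) ∎
  ... | no j≰1+n = trans (shift-< j _ (suc n) (ℕ.≰⇒> j≰1+n)) (cong ⊕_ (sym (k>n⇒nCk≡0 small)))
    where
    small : n ℕ.+ (suc d ℕ.∸ j) ℕ.< d
    small = ℕ.+-cancelʳ-≤ j _ _ (subst (ℕ._≤ d ℕ.+ j) (sym (trans (ℕ.+-assoc (suc n) (suc d ℕ.∸ j) j) (trans (cong (suc n ℕ.+_) (ℕ.m∸n+n≡m (ℕ.m≤n⇒m≤1+n j≤d))) (trans (ℕ.+-suc (suc n) d) (ℕ.+-comm (suc (suc n)) d))))) (ℕ.+-monoʳ-≤ d (ℕ.≰⇒> j≰1+n)))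

  Δ : (ℕ → ℤ) → ℕ → ℤ
  Δ s n = s (suc n) - s n

  Δ^ : ℕ → (ℕ → ℤ) → ℕ → ℤ
  Δ^ zero s = s
  Δ^ (suc k) s = Δ^ k (Δ s)

  Δ^-cong : ∀ k {s t} → (∀ n → s n ≡ t n) → ∀ n → Δ^ k s n ≡ Δ^ k t n
  Δ^-cong zero e = e
  Δ^-cong (suc k) e = Δ^-cong k (λ n → cong₂ _-_ (e (suc n)) (e n))

  -- Newton interpolation: one difference turns `C n (i + 1)` into `C n i` and removes the constant
  -- term, so the k-th difference brings `f k` to the front, where evaluation at 0 isolates it.
  Δ^-newton : ∀ d (f : ℕ → ℤ) k → k ℕ.≤ d → Δ^ k (λ n → ∑ (suc d) (λ i → f i * binomial n i)) 0 ≡ f k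
  Δ^-newton d f zero p = trans (cong₂ _+_ (*-identityʳ (f 0)) (∑-zero d (λ i _ → trans (cong (λ c → f (suc i) * ⊕ c) (k>n⇒nCk≡0 {0} {suc i} (s≤s z≤n))) (*-zeroʳ (f (suc i)))))) (+-identityʳ (f 0))
  Δ^-newton (suc d) f (suc k) (s≤s p) = trans (Δ^-cong k step 0) (Δ^-newton d (f ∘ suc) k p)
    where
    step : ∀ n → Δ (λ n → ∑ (suc (suc d)) (λ i → f i * binomial n i)) n ≡ ∑ (suc d) (λ i → f (suc i) * binomial n i)
    step n = trans (cong₂ (λ a b → f 0 * a + ∑ (suc d) (λ i → f (suc i) * binomial (suc n) (suc i)) - (f 0 * b + ∑ (suc d) (λ i → f (suc i) * binomial n (suc i)))) (binomial-0 (suc n)) (binomial-0 n))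
      (trans (lem (f 0) (∑ (suc d) (λ i → f (suc i) * binomial (suc n) (suc i))) (∑ (suc d) (λ i → f (suc i) * binomial n (suc i))))
      (trans (sym (∑-sub (suc d) (λ i → f (suc i) * binomial (suc n) (suc i)) (λ i → f (suc i) * binomial n (suc i))))
        (∑-cong (suc d) (λ i _ → trans (cong (λ t → f (suc i) * t - f (suc i) * binomial n (suc i)) (pascal n i)) (lem2 (f (suc i)) (binomial n i) (binomial n (suc i)))))))
      where
      lem : ∀ a b c → a * ⊕ 1 + b - (a * ⊕ 1 + c) ≡ b - c
      lem = solve-∀
      lem2 : ∀ a b c → a * (b + c) - a * c ≡ a * b
      lem2 = solve-∀

  -- By Pascal's rule each difference in `n` lowers the lower entry by one and leaves the offset
  -- `a j` alone.
  Δ^-shifted : ∀ m (h : ℕ → ℤ) (a : ℕ → ℕ) k b → Δ^ k (λ n → ∑ m (λ j → h j * binomial (n ℕ.+ a j) (k ℕ.+ b))) 0 ≡ ∑ m (λ j → h j * binomial (a j) b)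
  Δ^-shifted m h a zero b = refl
  Δ^-shifted m h a (suc k) b = trans (Δ^-cong k step 0) (Δ^-shifted m h a k b)
    where
    step : ∀ n → Δ (λ n → ∑ m (λ j → h j * binomial (n ℕ.+ a j) (suc k ℕ.+ b))) n ≡ ∑ m (λ j → h j * binomial (n ℕ.+ a j) (k ℕ.+ b))
    step n = trans (sym (∑-sub m _ _)) (∑-cong m (λ j _ → trans (cong (λ t → h j * t - h j * binomial (n ℕ.+ a j) (suc k ℕ.+ b)) (pascal (n ℕ.+ a j) (k ℕ.+ b))) (lem (h j) (binomial (n ℕ.+ a j) (k ℕ.+ b)) (binomial (n ℕ.+ a j) (suc k ℕ.+ b)))))
      where
      lem : ∀ a b c → a * (b + c) - a * c ≡ a * b
      lem = solve-∀

  -- Compare the k-th forward differences at 0 of n ↦ E (1 + n).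
  fstar-from-hstar : ∀ d (E h f : ℕ → ℤ) → (∀ j → suc d ℕ.≤ j → h j ≡ ⊕ 0) → (∀ n → ∇^ (suc d) E n ≡ h n) →
    (∀ n → E (suc n) ≡ ∑ (suc d) (λ k → f k * binomial n k)) →
    ∀ k → k ℕ.≤ d → f k ≡ ∑ (suc d) (λ j → h j * binomial (suc d ℕ.∸ j) (d ℕ.∸ k))
  fstar-from-hstar d E h f z hE fE k k≤d = begin
    f k ≡⟨ Δ^-newton d f k k≤d ⟨
    Δ^ k (λ n → ∑ (suc d) (λ i → f i * binomial n i)) 0 ≡⟨ Δ^-cong k (λ n → trans (sym (fE n)) (trans (expand h (suc d) z d E hE (suc n)) (∑-cong (suc d) (λ j p → cong (h j *_) (shift-binomial d j n (ℕ.≤-pred p)))))) 0 ⟩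
    Δ^ k (λ n → ∑ (suc d) (λ j → h j * binomial (n ℕ.+ (suc d ℕ.∸ j)) d)) 0 ≡⟨ cong (λ e → Δ^ k (λ n → ∑ (suc d) (λ j → h j * binomial (n ℕ.+ (suc d ℕ.∸ j)) e)) 0) (ℕ.m+[n∸m]≡n k≤d) ⟨
    Δ^ k (λ n → ∑ (suc d) (λ j → h j * binomial (n ℕ.+ (suc d ℕ.∸ j)) (k ℕ.+ (d ℕ.∸ k)))) 0 ≡⟨ Δ^-shifted (suc d) h (λ j → suc d ℕ.∸ j) k (d ℕ.∸ k) ⟩
    ∑ (suc d) (λ j → h j * binomial (suc d ℕ.∸ j) (d ℕ.∸ k)) ∎
    where open ≡-Reasoning

-- Monotonicity of binomial coefficients along rows and of their neighbour differences along
-- columns.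

module Binomials where

  open import Data.Integer renaming (+_ to ⊕_) hiding (suc; pred)
  open import Data.Integer.Properties
  open import Data.Integer.Tactic.RingSolver using (solve-∀)
  open Sequences

  C-suc : ∀ n k → suc n C suc k ≡ n C k ℕ.+ n C suc k
  C-suc n k = sym (nCk+nC[k+1]≡[n+1]C[k+1] n k)

  C-zero : ∀ n → n C 0 ≡ 1
  C-zero zero = refl
  C-zero (suc n) = refl

  C-pos : ∀ {n k} → k ℕ.≤ n → 1 ℕ.≤ n C k
  C-pos {n} {zero} _ = ℕ.≤-reflexive (sym (C-zero n))
  C-pos {suc n} {suc k} (s≤s p) = ℕ.≤-trans (C-pos p) (ℕ.≤-trans (ℕ.m≤m+n (n C k) (n C suc k)) (ℕ.≤-reflexive (sym (C-suc n k))))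

  C-sym : ∀ a b {n} → a ℕ.+ b ≡ n → n C a ≡ n C b
  C-sym a b refl = trans (nCk≡nC[n∸k] (ℕ.m≤m+n a b)) (cong ((a ℕ.+ b) C_) (ℕ.m+n∸m≡n a b))

  -- Pascal's rule splits both sides into two entries of the previous row. In the tight case the
  -- induction hypothesis fails for the second pair, but then symmetry of the row shows that both
  -- sides consist of the same two entries.
  C-up : ∀ n {a b} → a ℕ.≤ b → a ℕ.+ b ℕ.≤ n → n C a ℕ.≤ n C b
  C-up n {zero} {b} _ q = subst (ℕ._≤ n C b) (sym (C-zero n)) (C-pos q)
  C-up (suc n) {suc a} {suc b} (s≤s p) (s≤s q) = subst₂ ℕ._≤_ (sym (C-suc n a)) (sym (C-suc n b)) (split (ℕ.m≤n⇒m<n∨m≡n q))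
    where
    shuffle : suc (a ℕ.+ b) ≡ a ℕ.+ suc b
    shuffle = sym (ℕ.+-suc a b)
    split : a ℕ.+ suc b ℕ.< n ⊎ a ℕ.+ suc b ≡ n → n C a ℕ.+ n C suc a ℕ.≤ n C b ℕ.+ n C suc b
    split (inj₁ lt) = ℕ.+-mono-≤ (C-up n p (ℕ.≤-trans (ℕ.+-monoʳ-≤ a (ℕ.n≤1+n b)) (ℕ.<⇒≤ lt))) (C-up n (s≤s p) lt)
    split (inj₂ e) = ℕ.≤-reflexive (trans (cong₂ ℕ._+_ (C-sym a (suc b) e) (C-sym (suc a) b (trans shuffle e))) (ℕ.+-comm (n C suc b) (n C b)))

  C-up-strict : ∀ n {a b} → a ℕ.< b → a ℕ.+ b ℕ.< n → n C a ℕ.< n C b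
  C-up-strict (suc n) {zero} {suc b} _ (s≤s q) = subst (2 ℕ.≤_) (sym (C-suc n b)) (ℕ.+-mono-≤ (C-pos (ℕ.≤-trans (ℕ.n≤1+n b) q)) (C-pos q))
  C-up-strict (suc n) {suc a} {suc b} (s≤s p) (s≤s q) = subst₂ ℕ._<_ (sym (C-suc n a)) (sym (C-suc n b))
    (ℕ.+-mono-<-≤ (C-up-strict n p (ℕ.≤-trans (s≤s (ℕ.+-monoʳ-≤ a (ℕ.n≤1+n b))) q)) (C-up n (ℕ.<⇒≤ (s≤s p)) q))

  reflect-sum : ∀ {n x y} → x ℕ.≤ n → y ℕ.≤ n → (n ℕ.∸ x) ℕ.+ (n ℕ.∸ y) ℕ.+ (x ℕ.+ y) ≡ n ℕ.+ n
  reflect-sum {n} {x} {y} p q = trans (lem (n ℕ.∸ x) (n ℕ.∸ y) x y) (cong₂ ℕ._+_ (ℕ.m∸n+n≡m p) (ℕ.m∸n+n≡m q))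
    where lem : ∀ a b x y → a ℕ.+ b ℕ.+ (x ℕ.+ y) ≡ a ℕ.+ x ℕ.+ (b ℕ.+ y)
          lem = ℕ-Solver.solve-∀

  C-down : ∀ n {x y} → y ℕ.≤ x → n ℕ.≤ x ℕ.+ y → n C x ℕ.≤ n C y
  C-down n {x} {y} y≤x h with x ℕ.≤? n
  ... | no x≰n = subst (ℕ._≤ n C y) (sym (k>n⇒nCk≡0 (ℕ.≰⇒> x≰n))) z≤n
  ... | yes x≤n = subst₂ ℕ._≤_ (sym (nCk≡nC[n∸k] x≤n)) (sym (nCk≡nC[n∸k] y≤n))
      (C-up n (ℕ.∸-monoʳ-≤ n y≤x) (ℕ.+-cancelʳ-≤ n _ _ (ℕ.≤-trans (ℕ.+-monoʳ-≤ ((n ℕ.∸ x) ℕ.+ (n ℕ.∸ y)) h) (ℕ.≤-reflexive (reflect-sum x≤n y≤n)))))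
    where y≤n = ℕ.≤-trans y≤x x≤n

  C-down-strict : ∀ n {x y} → x ℕ.≤ n → y ℕ.< x → n ℕ.< x ℕ.+ y → n C x ℕ.< n C y
  C-down-strict n {x} {y} x≤n y<x h = subst₂ ℕ._<_ (sym (nCk≡nC[n∸k] x≤n)) (sym (nCk≡nC[n∸k] y≤n))
      (C-up-strict n (ℕ.∸-monoʳ-< y<x x≤n) (ℕ.+-cancelʳ-< n _ _ (ℕ.<-≤-trans (ℕ.+-monoʳ-< ((n ℕ.∸ x) ℕ.+ (n ℕ.∸ y)) h) (ℕ.≤-reflexive (reflect-sum x≤n y≤n)))))
    where y≤n = ℕ.≤-trans (ℕ.<⇒≤ y<x) x≤n

  ∑-pos-strict : ∀ n {f g : ℕ → ℤ} → (∀ k → k ℕ.≤ n → f k ≤ g k) → f 0 < g 0 → ∑ (suc n) f < ∑ (suc n) g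
  ∑-pos-strict n p q = +-mono-<-≤ q (∑-mono n (λ k k<n → p (suc k) k<n))

  ∑-segment : ∀ a b (f g : ℕ → ℤ) → (∀ j → a ℕ.≤ j → j ℕ.< a ℕ.+ b → f j ≤ g j) → ∑ (a ℕ.+ b) f - ∑ a f ≤ ∑ (a ℕ.+ b) g - ∑ a g
  ∑-segment a zero f g p = ≤-reflexive (trans (trivial f) (sym (trivial g)))
    where trivial : ∀ f → ∑ (a ℕ.+ 0) f - ∑ a f ≡ ⊕ 0
          trivial f = trans (cong (λ m → ∑ m f - ∑ a f) (ℕ.+-identityʳ a)) (+-inverseʳ (∑ a f))
  ∑-segment a (suc b) f g p = subst₂ _≤_ (split f) (split g) (+-mono-≤ (∑-segment a b f g (λ j a≤j j<ab → p j a≤j (ℕ.<-≤-trans j<ab (ℕ.+-monoʳ-≤ a (ℕ.n≤1+n b)))))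
      (p (a ℕ.+ b) (ℕ.m≤m+n a b) (ℕ.≤-reflexive (sym (ℕ.+-suc a b)))))
    where
    lem : ∀ x y z → x - y + z ≡ x + z - y
    lem = solve-∀
    split : ∀ f → ∑ (a ℕ.+ b) f - ∑ a f + f (a ℕ.+ b) ≡ ∑ (a ℕ.+ suc b) f - ∑ a f
    split f = trans (lem (∑ (a ℕ.+ b) f) (∑ a f) (f (a ℕ.+ b))) (cong (_- ∑ a f) (trans (sym (∑-last (a ℕ.+ b) f)) (cong (λ m → ∑ m f) (sym (ℕ.+-suc a b)))))

  -- c N is the coefficient of h* (d + 1 - N) in f* k - f* (k + 1), where k = d - (r + 1).
  module Coefficient (r : ℕ) where

    c : ℕ → ℤ
    c N = binomial N (suc r) - binomial N r

    -- The entry to the left of `N C k`, read as 0 at the border, so that Pascal's rule also holds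
    -- for `k = 0`.
    below : ℕ → ℕ → ℕ
    below N zero = 0
    below N (suc k) = N C k

    C-step : ∀ N k → suc N C k ≡ below N k ℕ.+ N C k
    C-step N zero = trans (C-zero (suc N)) (sym (C-zero N))
    C-step N (suc k) = C-suc N k

    -- The increment of `c` is itself a difference of neighbours, one place further left. Its sign
    -- changes at the middle of the row, and this governs the shape of `c`.
    c-step : ∀ N → c (suc N) ≡ c N + (binomial N r - ⊕ below N r)
    c-step N = trans (cong₂ (λ a b → ⊕ a - ⊕ b) (C-suc N r) (C-step N r)) (lem (binomial N r) (binomial N (suc r)) (⊕ below N r))
      where lem : ∀ a b e → a + b - (e + a) ≡ b - a + (a - e)
            lem = solve-∀

    c-mid : c (suc (r ℕ.+ r)) ≡ ⊕ 0
    c-mid = trans (cong (λ t → ⊕ t - binomial (suc (r ℕ.+ r)) r) (C-sym (suc r) r refl)) (+-inverseʳ (binomial (suc (r ℕ.+ r)) r))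

    below-≥ : ∀ N → suc N ℕ.≤ r ℕ.+ r → N C r ℕ.≤ below N r
    below-≥ N p = go r p
      where go : ∀ r → suc N ℕ.≤ r ℕ.+ r → N C r ℕ.≤ below N r
            go (suc s) (s≤s q) = C-down N (ℕ.n≤1+n s) (ℕ.≤-trans q (ℕ.≤-reflexive (ℕ.+-suc s s)))

    below-< : ∀ N k → k ℕ.+ k ℕ.≤ N → suc (below N k) ℕ.≤ N C k
    below-< N zero _ = ℕ.≤-reflexive (sym (C-zero N))
    below-< N (suc s) q = C-up-strict N ℕ.≤-refl q

    -- As long as `N < 2 r` the increments are at most zero, so among the arguments up to `2 r` the
    -- minimum of `c` is at `2 r`.
    c-low : ∀ k N → k ℕ.+ N ≡ r ℕ.+ r → c (r ℕ.+ r) ≤ c N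
    c-low zero N e = ≤-reflexive (cong c (sym e))
    c-low (suc k) N e = ≤-trans (c-low k (suc N) (trans (ℕ.+-suc k N) e))
      (subst (_≤ c N) (sym (c-step N)) (subst (c N + (binomial N r - ⊕ below N r) ≤_) (+-identityʳ (c N)) (+-monoʳ-≤ (c N) (i≤j⇒i-j≤0 (+≤+ (below-≥ N (ℕ.≤-trans (ℕ.m≤n+m (suc N) k) (ℕ.≤-reflexive (trans (ℕ.+-suc k N) e)))))))))

    -- `c` vanishes at `2 r + 1`, hence the step leading there undoes `c (2 r)` exactly.
    first-step : - c (r ℕ.+ r) ≡ binomial (r ℕ.+ r) r - ⊕ below (r ℕ.+ r) r
    first-step = trans (lem (c (r ℕ.+ r)) (binomial (r ℕ.+ r) r - ⊕ below (r ℕ.+ r) r)) (trans (cong (λ t → binomial (r ℕ.+ r) r - ⊕ below (r ℕ.+ r) r - t) (trans (sym (c-step (r ℕ.+ r))) c-mid)) (+-identityʳ _))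
      where lem : ∀ x y → - x ≡ y - (x + y)
            lem = solve-∀

    -- By Pascal's rule the growth of the increment is `C(N, r - 1) - C(N, r - 2)`, which is
    -- nonnegative while `2 r - 3 ≤ N`.
    gap-grows : ∀ N → r ℕ.+ r ℕ.≤ suc (suc (suc N)) → binomial N r - ⊕ below N r ≤ binomial (suc N) r - ⊕ below (suc N) r
    gap-grows N p = go r p
      where
      go : ∀ r → r ℕ.+ r ℕ.≤ suc (suc (suc N)) → binomial N r - ⊕ below N r ≤ binomial (suc N) r - ⊕ below (suc N) r
      go zero _ = ≤-reflexive (cong (λ t → ⊕ t - ⊕ 0) (trans (C-zero N) (sym (C-zero (suc N)))))
      go (suc s) q = subst (binomial N (suc s) - binomial N s ≤_) (sym eq) (subst (_≤ binomial N (suc s) - binomial N s + (binomial N s - ⊕ below N s)) (+-identityʳ (binomial N (suc s) - binomial N s)) (+-monoʳ-≤ (binomial N (suc s) - binomial N s) (i≤j⇒0≤j-i (+≤+ (weak s q)))))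
        where
        lem : ∀ a b e → a + b - (e + a) ≡ b - a + (a - e)
        lem = solve-∀
        eq : binomial (suc N) (suc s) - binomial (suc N) s ≡ binomial N (suc s) - binomial N s + (binomial N s - ⊕ below N s)
        eq = trans (cong₂ (λ a b → ⊕ a - ⊕ b) (C-suc N s) (C-step N s)) (lem (binomial N s) (binomial N (suc s)) (⊕ below N s))
        weak : ∀ s → suc s ℕ.+ suc s ℕ.≤ suc (suc (suc N)) → below N s ℕ.≤ N C s
        weak zero _ = z≤n
        weak (suc t) (s≤s q) = C-up N (ℕ.n≤1+n t) (drop q)
          where
          drop : suc t ℕ.+ suc (suc t) ℕ.≤ suc (suc N) → t ℕ.+ suc t ℕ.≤ N
          drop (s≤s q) = ℕ.≤-pred (ℕ.≤-trans (ℕ.≤-reflexive (sym (ℕ.+-suc t (suc t)))) q)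

    -- The step from `2 r + 1` to `2 r + 2` is at least the step before it, which equals
    -- `- c (2 r)`, and it starts from the value 0. Every later step adds at least 1; this surplus
    -- is what eventually makes part (b) strict.
    c-high : ∀ k → - c (r ℕ.+ r) + ⊕ k ≤ c (k ℕ.+ suc (suc (r ℕ.+ r)))
    c-high zero = subst₂ _≤_ (sym (trans (+-identityʳ (- c (r ℕ.+ r))) first-step)) (sym (trans (c-step (suc (r ℕ.+ r))) (trans (cong (_+ (binomial (suc (r ℕ.+ r)) r - ⊕ below (suc (r ℕ.+ r)) r)) c-mid) (+-identityˡ _))))
      (gap-grows (r ℕ.+ r) (ℕ.m≤n+m (r ℕ.+ r) 3))
    c-high (suc k) = subst₂ _≤_ (lem (- c (r ℕ.+ r)) (⊕ k)) (sym (c-step N)) (+-mono-≤ (c-high k) gap≥1)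
      where
      N = k ℕ.+ suc (suc (r ℕ.+ r))
      lem : ∀ x k → x + k + ⊕ 1 ≡ x + (⊕ 1 + k)
      lem = solve-∀
      gap≥1 : ⊕ 1 ≤ binomial N r - ⊕ below N r
      gap≥1 = subst (_≤ binomial N r - ⊕ below N r) (lem2 (⊕ below N r)) (+-monoˡ-≤ (- ⊕ below N r) (+≤+ (below-< N r (ℕ.≤-trans (ℕ.m≤n+m (r ℕ.+ r) 2) (ℕ.m≤n+m (2 ℕ.+ (r ℕ.+ r)) k)))))
        where lem2 : ∀ x → ⊕ 1 + x - x ≡ ⊕ 1
              lem2 = solve-∀

-- From inequalities for h* to inequalities for f*.

module FStarInequalities where

  open import Data.Integer renaming (+_ to ⊕_) hiding (suc; pred)
  open import Data.Integer.Properties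
  open import Data.Integer.Tactic.RingSolver using (solve-∀)
  open Sequences
  open Binomials

  -- In `hibi` the left side is the tail `h (d + 1 - i) + ⋯ + h d`, written as a difference of
  -- partial sums; the summand with index `d + 1` is zero for an h*-vector and does not appear.
  record HStar (d : ℕ) (h : ℕ → ℤ) : Set where
    field
      nonneg : ∀ j → ⊕ 0 ≤ h j
      constant-pos : ⊕ 1 ≤ h 0
      hibi : ∀ i → i ℕ.≤ d → ∑ (suc d) h - ∑ (suc (d ℕ.∸ i)) h ≤ ∑ (suc i) h

  mul-mono : ∀ {h a b} → ⊕ 0 ≤ h → a ≤ b → h * a ≤ h * b
  mul-mono {h} p q = *-monoˡ-≤-nonNeg h {{nonNegative p}} q

  mul-mono-strict : ∀ {h a b} → ⊕ 1 ≤ h → a < b → h * a < h * b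
  mul-mono-strict {h} p q = *-monoˡ-<-pos h {{positive (suc[i]≤j⇒i<j p)}} q

  module Inequalities (d : ℕ) (h f : ℕ → ℤ) (H : HStar d h)
    (fh : ∀ k → k ℕ.≤ d → f k ≡ ∑ (suc d) (λ j → h j * binomial (suc d ℕ.∸ j) (d ℕ.∸ k))) where
    open HStar H

    -- The weights `h j` are nonnegative, so it suffices to compare binomials with a common upper
    -- entry `N = d + 1 - j`.
    monotone : ∀ {k l} → k ℕ.≤ d → l ℕ.≤ d → (∀ N → N ℕ.≤ suc d → N C (d ℕ.∸ k) ℕ.≤ N C (d ℕ.∸ l)) → f k ≤ f l
    monotone {k} {l} k≤d l≤d p = subst₂ _≤_ (sym (fh k k≤d)) (sym (fh l l≤d)) (∑-mono (suc d) (λ j _ → mul-mono (nonneg j) (+≤+ (p (suc d ℕ.∸ j) (ℕ.m∸n≤m (suc d) j)))))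

    monotone-strict : ∀ {k l} → k ℕ.≤ d → l ℕ.≤ d → (∀ N → N ℕ.≤ suc d → N C (d ℕ.∸ k) ℕ.≤ N C (d ℕ.∸ l)) →
      suc d C (d ℕ.∸ k) ℕ.< suc d C (d ℕ.∸ l) → f k < f l
    monotone-strict {k} {l} k≤d l≤d p q = subst₂ _<_ (sym (fh k k≤d)) (sym (fh l l≤d))
      (∑-pos-strict d (λ j _ → mul-mono (nonneg j) (+≤+ (p (suc d ℕ.∸ j) (ℕ.m∸n≤m (suc d) j)))) (mul-mono-strict constant-pos (+<+ q)))

    complement-sum : ∀ {k} → suc k ℕ.≤ d → (d ℕ.∸ k) ℕ.+ (d ℕ.∸ suc k) ℕ.+ suc (k ℕ.+ k) ≡ d ℕ.+ d
    complement-sum {k} p = trans (lem (d ℕ.∸ k) (d ℕ.∸ suc k) k) (cong₂ ℕ._+_ (ℕ.m∸n+n≡m (ℕ.<⇒≤ p)) (ℕ.m∸n+n≡m p))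
      where lem : ∀ a b k → a ℕ.+ b ℕ.+ suc (k ℕ.+ k) ≡ a ℕ.+ k ℕ.+ (b ℕ.+ suc k)
            lem = ℕ-Solver.solve-∀

    -- Turns a bound on `k` into the hypothesis of `C-down` for the neighbouring lower entries
    -- `d - k` and `d - k - 1`, uniformly for upper entries up to `d + 1`. The slack `e` is 0 for
    -- weak and 1 for strict comparison.
    complement-≥ : ∀ {k} e → suc k ℕ.≤ d → suc (suc (k ℕ.+ k)) ℕ.+ e ℕ.≤ d → suc d ℕ.+ e ℕ.≤ (d ℕ.∸ k) ℕ.+ (d ℕ.∸ suc k)
    complement-≥ {k} e p q = ℕ.+-cancelʳ-≤ (suc (k ℕ.+ k)) _ _ (ℕ.≤-trans (ℕ.≤-reflexive (lem d e k)) (ℕ.≤-trans (ℕ.+-monoʳ-≤ d q) (ℕ.≤-reflexive (sym (complement-sum p)))))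
      where lem : ∀ d e k → suc d ℕ.+ e ℕ.+ suc (k ℕ.+ k) ≡ d ℕ.+ (suc (suc (k ℕ.+ k)) ℕ.+ e)
            lem = ℕ-Solver.solve-∀

    increase : ∀ k → suc (suc (k ℕ.+ k)) ℕ.≤ d → f k ≤ f (suc k)
    increase k q = monotone (ℕ.<⇒≤ k<d) k<d (λ N N≤ → C-down N (ℕ.∸-monoʳ-≤ d (ℕ.n≤1+n k)) (ℕ.≤-trans N≤ (ℕ.≤-trans (ℕ.≤-reflexive (sym (ℕ.+-identityʳ (suc d)))) (complement-≥ 0 k<d (ℕ.≤-trans (ℕ.≤-reflexive (ℕ.+-identityʳ _)) q)))))
      where k<d : suc k ℕ.≤ d
            k<d = ℕ.≤-trans (s≤s (ℕ.m≤m+n k k)) (ℕ.<⇒≤ q)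

    increase-strict : ∀ k → suc (suc (suc (k ℕ.+ k))) ℕ.≤ d → f k < f (suc k)
    increase-strict k q = monotone-strict (ℕ.<⇒≤ k<d) k<d (λ N N≤ → C-down N (ℕ.∸-monoʳ-≤ d (ℕ.n≤1+n k)) (ℕ.≤-trans N≤ (ℕ.<⇒≤ big)))
        (C-down-strict (suc d) (ℕ.≤-trans (ℕ.m∸n≤m d k) (ℕ.n≤1+n d)) (ℕ.∸-monoʳ-< ℕ.≤-refl k<d) big)
      where
      k<d : suc k ℕ.≤ d
      k<d = ℕ.≤-trans (s≤s (ℕ.m≤m+n k k)) (ℕ.<⇒≤ (ℕ.<⇒≤ q))
      big : suc d ℕ.< (d ℕ.∸ k) ℕ.+ (d ℕ.∸ suc k)
      big = ℕ.≤-trans (ℕ.≤-reflexive (ℕ.+-comm 1 (suc d))) (complement-≥ 1 k<d (ℕ.≤-trans (ℕ.≤-reflexive (ℕ.+-comm (suc (suc (k ℕ.+ k))) 1)) q))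

    -- The lower entries belonging to `k` and `d - 1 - k` are `d - k` and `k + 1`. They add up to
    -- `d + 1`, the largest upper entry that occurs, so `C-down` applies to every summand.
    reflected : ∀ k → suc (suc (suc (k ℕ.+ k))) ℕ.≤ d → f k ≤ f (d ℕ.∸ 1 ℕ.∸ k)
    reflected k q = monotone k≤d l≤d (λ N N≤ → subst (λ y → N C (d ℕ.∸ k) ℕ.≤ N C y) (sym y-eq) (C-down N y≤x (ℕ.≤-trans N≤ (ℕ.≤-reflexive sum))))
      where
      l = d ℕ.∸ 1 ℕ.∸ k
      k<d : suc k ℕ.≤ d
      k<d = ℕ.≤-trans (s≤s (ℕ.m≤m+n k k)) (ℕ.<⇒≤ (ℕ.<⇒≤ q))
      k≤d : k ℕ.≤ d
      k≤d = ℕ.<⇒≤ k<d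
      l≤d : l ℕ.≤ d
      l≤d = ℕ.≤-trans (ℕ.m∸n≤m (d ℕ.∸ 1) k) (ℕ.m∸n≤m d 1)
      y-eq : d ℕ.∸ l ≡ suc k
      y-eq = trans (cong (d ℕ.∸_) (ℕ.∸-+-assoc d 1 k)) (ℕ.m∸[m∸n]≡n k<d)
      y≤x : suc k ℕ.≤ d ℕ.∸ k
      y≤x = ℕ.m+n≤o⇒m≤o∸n (suc k) (ℕ.≤-trans (ℕ.n≤1+n _) (ℕ.<⇒≤ q))
      sum : suc d ≡ (d ℕ.∸ k) ℕ.+ suc k
      sum = trans (cong suc (sym (ℕ.m∸n+n≡m k≤d))) (sym (ℕ.+-suc (d ℕ.∸ k) k))

    -- The sum for `f k - f (k + 1)` is cut into three ranges of `j`. For `j ≤ 2 r` the coefficients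
    -- are at least `M`, in the middle they are nonnegative, and for the last `2 r` indices they are
    -- at least `- M`. Hibi's inequality pays for the third range with the first, and `4 r < d`
    -- keeps the first range inside the region of large coefficients.
    decrease : 2 ℕ.≤ d → ∀ r k → k ℕ.+ suc r ≡ d → suc (4 ℕ.* r) ℕ.≤ d → f (suc k) < f k
    decrease 2≤d r k e 4r<d = gap⇒< (subst (⊕ 1 ≤_) (sym difference) total)
      where
      open Coefficient r
      M = - c (r ℕ.+ r)
      g : ℕ → ℤ
      g j = h j * c (suc d ℕ.∸ j)
      gap⇒< : ∀ {a b} → ⊕ 1 ≤ a - b → b < a
      gap⇒< {a} {b} p = suc[i]≤j⇒i<j (subst (⊕ 1 + b ≤_) (lem a b) (+-monoˡ-≤ b p))
        where lem : ∀ a b → a - b + b ≡ a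
              lem = solve-∀
      k≤d : k ℕ.≤ d
      k≤d = ℕ.≤-trans (ℕ.m≤m+n k (suc r)) (ℕ.≤-reflexive e)
      k<d : suc k ℕ.≤ d
      k<d = ℕ.≤-trans (ℕ.≤-trans (s≤s (ℕ.m≤m+n k r)) (ℕ.≤-reflexive (sym (ℕ.+-suc k r)))) (ℕ.≤-reflexive e)
      d∸k : d ℕ.∸ k ≡ suc r
      d∸k = trans (cong (ℕ._∸ k) (sym e)) (ℕ.m+n∸m≡n k (suc r))
      d∸sk : d ℕ.∸ suc k ≡ r
      d∸sk = trans (cong (ℕ._∸ suc k) (sym (trans (sym (ℕ.+-suc k r)) e))) (ℕ.m+n∸m≡n (suc k) r)
      difference : f k - f (suc k) ≡ ∑ (suc d) g
      difference = trans (cong₂ _-_ (trans (fh k k≤d) (cong (λ r → ∑ (suc d) (λ j → h j * binomial (suc d ℕ.∸ j) r)) d∸k)) (trans (fh (suc k) k<d) (cong (λ r → ∑ (suc d) (λ j → h j * binomial (suc d ℕ.∸ j) r)) d∸sk)))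
        (trans (sym (∑-sub (suc d) (λ j → h j * binomial (suc d ℕ.∸ j) (suc r)) (λ j → h j * binomial (suc d ℕ.∸ j) r))) (∑-cong (suc d) (λ j _ → lem (h j) (binomial (suc d ℕ.∸ j) (suc r)) (binomial (suc d ℕ.∸ j) r))))
        where lem : ∀ a b c → a * b - a * c ≡ a * (b - c)
              lem = solve-∀
      m = r ℕ.+ r
      2m<d : suc (m ℕ.+ m) ℕ.≤ d
      2m<d = ℕ.≤-trans (ℕ.≤-reflexive (cong suc (lem r))) 4r<d
        where lem : ∀ r → r ℕ.+ r ℕ.+ (r ℕ.+ r) ≡ 4 ℕ.* r
              lem = ℕ-Solver.solve-∀
      m≤d : m ℕ.≤ d
      m≤d = ℕ.≤-trans (ℕ.m≤m+n m m) (ℕ.<⇒≤ 2m<d)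
      high : ∀ N → suc (suc m) ℕ.≤ N → M ≤ c N
      high N p = ≤-trans (≤-trans (≤-reflexive (sym (+-identityʳ M))) (+-monoʳ-≤ M (+≤+ z≤n))) (subst (λ N → M + ⊕ (N' p) ≤ c N) (ℕ.m∸n+n≡m p) (c-high (N' p)))
        where N' : suc (suc m) ℕ.≤ N → ℕ
              N' _ = N ℕ.∸ suc (suc m)
      low : ∀ N → N ℕ.≤ m → - M ≤ c N
      low N p = subst (_≤ c N) (sym (neg-involutive (c m))) (c-low (m ℕ.∸ N) N (ℕ.m∸n+n≡m p))
      M≥0 : ⊕ 0 ≤ M
      M≥0 = neg-mono-≤ {c m} {⊕ 0} (subst (c m ≤_) (+-inverseʳ (binomial m r)) (+-monoˡ-≤ (- binomial m r) (+≤+ (C-down m (ℕ.n≤1+n r) (ℕ.n≤1+n m)))))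
      -- One unit more than `M` at `j = 0`; together with `h 0 ≥ 1` it makes the final inequality
      -- strict.
      top-strict : M + ⊕ 1 ≤ c (suc d)
      top-strict = subst (λ N → M + ⊕ 1 ≤ c N) (ℕ.m∸n+n≡m bound) (≤-trans (+-monoʳ-≤ M (+≤+ (s≤s z≤n))) (subst (λ N → M + ⊕ suc (suc d ℕ.∸ (3 ℕ.+ m)) ≤ c N) (sym (ℕ.+-suc (suc d ℕ.∸ (3 ℕ.+ m)) (suc (suc m)))) (c-high (suc (suc d ℕ.∸ (3 ℕ.+ m))))))
        where
        bound : 3 ℕ.+ m ℕ.≤ suc d
        bound = s≤s (go r 2m<d)
          where
          go : ∀ r → suc (r ℕ.+ r ℕ.+ (r ℕ.+ r)) ℕ.≤ d → 2 ℕ.+ (r ℕ.+ r) ℕ.≤ d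
          -- For `r = 0` the bound `4 r < d` only gives `1 ≤ d`, one short of the required `2 ≤ d`.
          go zero _ = 2≤d
          go (suc s) p = ℕ.≤-trans (s≤s (ℕ.+-monoˡ-≤ (suc s ℕ.+ suc s) (ℕ.≤-trans (s≤s z≤n) (ℕ.m≤m+n (suc s) (suc s))))) p
      first : M * ∑ (suc m) h + ⊕ 1 ≤ ∑ (suc m) g
      first = subst (_≤ ∑ (suc m) g) eq (+-mono-≤ head (∑-mono m (λ j j<m → mul-mono (nonneg (suc j)) (high (d ℕ.∸ j) (far (suc j) j<m)))))
        where
        far : ∀ j → j ℕ.≤ m → suc (suc m) ℕ.≤ suc d ℕ.∸ j
        far j j≤m = ℕ.≤-trans (ℕ.m+n≤o⇒m≤o∸n (suc (suc m)) (s≤s 2m<d)) (ℕ.∸-monoʳ-≤ (suc d) j≤m)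
        head : h 0 * M + ⊕ 1 ≤ h 0 * c (suc d)
        head = ≤-trans (+-monoʳ-≤ (h 0 * M) (≤-trans constant-pos (≤-reflexive (sym (*-identityʳ (h 0)))))) (≤-trans (≤-reflexive (sym (*-distribˡ-+ (h 0) M (⊕ 1)))) (mul-mono (nonneg 0) top-strict))
        lem : ∀ a M s → a * M + ⊕ 1 + M * s ≡ M * (a + s) + ⊕ 1
        lem = solve-∀
        eq : h 0 * M + ⊕ 1 + ∑ m (λ j → h (suc j) * M) ≡ M * ∑ (suc m) h + ⊕ 1
        eq = trans (cong (h 0 * M + ⊕ 1 +_) (trans (∑-cong m (λ j _ → *-comm (h (suc j)) M)) (∑-*ˡ m M (h ∘ suc)))) (lem (h 0) M (∑ m (h ∘ suc)))
      b = d ℕ.∸ m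
      sm≤sb : suc m ℕ.≤ suc b
      sm≤sb = s≤s (ℕ.m+n≤o⇒m≤o∸n m (ℕ.<⇒≤ 2m<d))
      second : ⊕ 0 ≤ ∑ (suc b) g - ∑ (suc m) g
      second = subst (λ n → ⊕ 0 ≤ ∑ n g - ∑ (suc m) g) (ℕ.m+[n∸m]≡n sm≤sb) (subst (_≤ ∑ (suc m ℕ.+ (b ℕ.∸ m)) g - ∑ (suc m) g) (trans (cong₂ _-_ (zeros (suc m ℕ.+ (b ℕ.∸ m))) (zeros (suc m))) refl)
          (∑-segment (suc m) (b ℕ.∸ m) (λ _ → ⊕ 0) g (λ j _ j< → subst (_≤ g j) (*-zeroʳ (h j)) (mul-mono (nonneg j) (middle j (ℕ.≤-pred (ℕ.≤-trans j< (ℕ.≤-reflexive (ℕ.m+[n∸m]≡n sm≤sb)))))))))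
        where
        zeros : ∀ n → ∑ n (λ _ → ⊕ 0) ≡ ⊕ 0
        zeros n = ∑-zero n (λ _ _ → refl)
        middle : ∀ j → j ℕ.≤ b → ⊕ 0 ≤ c (suc d ℕ.∸ j)
        middle j j≤b with ℕ.m≤n⇒m<n∨m≡n j≤b
        ... | inj₂ refl = ≤-reflexive (sym (trans (cong c (trans (ℕ.+-∸-assoc 1 (ℕ.m∸n≤m d m)) (cong suc (ℕ.m∸[m∸n]≡n m≤d)))) c-mid))
        ... | inj₁ j<b = ≤-trans M≥0 (high (suc d ℕ.∸ j) (ℕ.m+n≤o⇒m≤o∸n (suc (suc m)) (ℕ.≤-trans (ℕ.≤-reflexive (cong suc (trans (cong suc (ℕ.+-comm m j)) refl))) (s≤s (ℕ.≤-trans (ℕ.+-monoˡ-≤ m j<b) (ℕ.≤-reflexive (ℕ.m∸n+n≡m m≤d)))))))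
      third : - M * (∑ (suc d) h - ∑ (suc b) h) ≤ ∑ (suc d) g - ∑ (suc b) g
      third = subst₂ _≤_ eq (cong (λ n → ∑ n g - ∑ (suc b) g) n-eq)
          (∑-segment (suc b) m (λ j → - M * h j) g (λ j b<j _ → ≤-trans (≤-reflexive (*-comm (- M) (h j))) (mul-mono (nonneg j) (low (suc d ℕ.∸ j) (ℕ.≤-trans (ℕ.∸-monoʳ-≤ (suc d) b<j) (ℕ.≤-reflexive (ℕ.m∸[m∸n]≡n m≤d)))))))
        where
        n-eq : suc b ℕ.+ m ≡ suc d
        n-eq = cong suc (ℕ.m∸n+n≡m m≤d)
        lem : ∀ a x y → a * x - a * y ≡ a * (x - y)
        lem = solve-∀
        eq : ∑ (suc b ℕ.+ m) (λ j → - M * h j) - ∑ (suc b) (λ j → - M * h j) ≡ - M * (∑ (suc d) h - ∑ (suc b) h)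
        eq = trans (cong₂ _-_ (trans (∑-*ˡ (suc b ℕ.+ m) (- M) h) (cong (λ n → - M * ∑ n h) n-eq)) (∑-*ˡ (suc b) (- M) h)) (lem (- M) (∑ (suc d) h) (∑ (suc b) h))
      total : ⊕ 1 ≤ ∑ (suc d) g
      total = subst₂ _≤_ refl (lem₁ (∑ (suc m) g) (∑ (suc b) g) (∑ (suc d) g)) (≤-trans base (+-mono-≤ (+-mono-≤ first second) third))
        where
        lem₁ : ∀ a b e → a + (b - a) + (e - b) ≡ e
        lem₁ = solve-∀
        lem₂ : ∀ M s t → ⊕ 1 + M * (s - t) ≡ M * s + ⊕ 1 + ⊕ 0 + - M * t
        lem₂ = solve-∀
        -- Hibi's inequality at `i = 2 r` makes the coefficient of `M` nonnegative.
        base : ⊕ 1 ≤ M * ∑ (suc m) h + ⊕ 1 + ⊕ 0 + - M * (∑ (suc d) h - ∑ (suc b) h)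
        base = subst (⊕ 1 ≤_) (lem₂ M (∑ (suc m) h) (∑ (suc d) h - ∑ (suc b) h)) (≤-trans (≤-reflexive (trans (sym (+-identityʳ (⊕ 1))) (cong (⊕ 1 +_) (sym (*-zeroʳ M))))) (+-monoʳ-≤ (⊕ 1) (mul-mono M≥0 (i≤j⇒0≤j-i (hibi m m≤d)))))

    conclusions : 2 ℕ.≤ d →
      ((∀ k → k ℕ.+ 2 ℕ.≤ d ℕ./ 2 → f k < f (suc k)) × f (d ℕ./ 2 ℕ.∸ 1) ≤ f (d ℕ./ 2))
      × (∀ k → (3 ℕ.* d) ℕ./ 4 ℕ.≤ k → k ℕ.< d → f (suc k) < f k)
      × (∀ k → 2 ℕ.* k ℕ.+ 3 ℕ.≤ d → f k ≤ f (d ℕ.∸ 1 ℕ.∸ k))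
    conclusions 2≤d = (part-a , part-a′ (d ℕ./ 2) refl) , part-b , part-c
      where
      half : ∀ q → d ℕ./ 2 ≡ q → q ℕ.+ q ℕ.≤ d
      half q refl = ℕ.≤-trans (ℕ.≤-reflexive (lem (d ℕ./ 2))) (ℕ.m/n*n≤m d 2)
        where lem : ∀ q → q ℕ.+ q ≡ q ℕ.* 2
              lem = ℕ-Solver.solve-∀
      part-a : ∀ k → k ℕ.+ 2 ℕ.≤ d ℕ./ 2 → f k < f (suc k)
      part-a k p = increase-strict k (ℕ.≤-trans (ℕ.n≤1+n _) (ℕ.≤-trans (ℕ.≤-reflexive (lem k)) (ℕ.≤-trans (ℕ.+-mono-≤ p p) (half (d ℕ./ 2) refl))))
        where lem : ∀ k → suc (suc (suc (suc (k ℕ.+ k)))) ≡ k ℕ.+ 2 ℕ.+ (k ℕ.+ 2)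
              lem = ℕ-Solver.solve-∀
      part-a′ : ∀ q → d ℕ./ 2 ≡ q → f (q ℕ.∸ 1) ≤ f q
      part-a′ zero e = ≤-refl
      part-a′ (suc q) e = increase q (ℕ.≤-trans (ℕ.≤-reflexive (cong suc (sym (ℕ.+-suc q q)))) (half (suc q) e))
      part-b : ∀ k → (3 ℕ.* d) ℕ./ 4 ℕ.≤ k → k ℕ.< d → f (suc k) < f k
      part-b k p k<d = decrease 2≤d r k k+r≡d (ℕ.+-cancelʳ-≤ (3 ℕ.* d) _ _ bound)
        where
        r = d ℕ.∸ suc k
        k+r≡d : k ℕ.+ suc r ≡ d
        k+r≡d = trans (ℕ.+-suc k r) (ℕ.m+[n∸m]≡n k<d)
        -- `⌊3 d / 4⌋ ≤ k` is the same as `3 d < 4 (k + 1)`, and substituting `k = d - r - 1` gives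
        -- exactly `4 r < d`.
        3d<4k+4 : 3 ℕ.* d ℕ.< 4 ℕ.* suc k
        3d<4k+4 = ℕ.<-≤-trans (ℕ.≤-<-trans (ℕ.≤-reflexive (ℕ.m≡m%n+[m/n]*n (3 ℕ.* d) 4))
          (ℕ.+-mono-<-≤ (ℕ.m%n<n (3 ℕ.* d) 4) (ℕ.*-monoˡ-≤ 4 p))) (ℕ.≤-reflexive (ℕ.*-comm (suc k) 4))
        lem : ∀ k r → 4 ℕ.* r ℕ.+ 4 ℕ.* suc k ≡ 4 ℕ.* (k ℕ.+ suc r)
        lem = ℕ-Solver.solve-∀
        lem2 : ∀ d → 4 ℕ.* d ≡ d ℕ.+ 3 ℕ.* d
        lem2 = ℕ-Solver.solve-∀
        bound : suc (4 ℕ.* r) ℕ.+ 3 ℕ.* d ℕ.≤ d ℕ.+ 3 ℕ.* d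
        bound = ℕ.≤-trans (ℕ.≤-reflexive (sym (ℕ.+-suc (4 ℕ.* r) (3 ℕ.* d)))) (ℕ.≤-trans (ℕ.+-monoʳ-≤ (4 ℕ.* r) 3d<4k+4)
          (ℕ.≤-reflexive (trans (lem k r) (trans (cong (4 ℕ.*_) k+r≡d) (lem2 d)))))
      part-c : ∀ k → 2 ℕ.* k ℕ.+ 3 ℕ.≤ d → f k ≤ f (d ℕ.∸ 1 ℕ.∸ k)
      part-c k p = reflected k (ℕ.≤-trans (ℕ.≤-reflexive (lem k)) p)
        where lem : ∀ k → suc (suc (suc (k ℕ.+ k))) ≡ 2 ℕ.* k ℕ.+ 3
              lem = ℕ-Solver.solve-∀

-- Cardinalities of finite sets of lattice points.

module Cardinality where

  open import Data.Nat using (_+_; _≤_)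
  open import Data.Sum using ([_,_])

  lookup-injective : ∀ {A : Set} {xs : List A} → Unique xs → ∀ {i j} → List.lookup xs i ≡ List.lookup xs j → i ≡ j
  lookup-injective (x∉ AllPairs.∷ u) {zero} {zero} e = refl
  lookup-injective (x∉ AllPairs.∷ u) {zero} {suc j} e = contradiction e (All.lookup x∉ (∈-lookup j))
  lookup-injective (x∉ AllPairs.∷ u) {suc i} {zero} e = contradiction (sym e) (All.lookup x∉ (∈-lookup i))
  lookup-injective (x∉ AllPairs.∷ u) {suc i} {suc j} e = cong suc (lookup-injective u e)

  -- Positions in the two duplicate-free lists turn `f` into an injection of finite index sets, so
  -- injectivity is needed on `S` only.
  card-inject : ∀ {d e} {S : Point d → Set} {T : Point e → Set} {a b} → HasCard S a → HasCard T b →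
    (f : Point d → Point e) → (∀ x → S x → T (f x)) → (∀ x y → S x → S y → f x ≡ f y → x ≡ y) → a ≤ b
  card-inject (xs , ux , refl , mx) (ys , uy , refl , my) f f∈ f-inj = Fin.injective⇒≤ {f = g} g-inj
    where
    open Equivalence
    S∋ = λ i → to (mx (List.lookup xs i)) (∈-lookup i)
    pos : ∀ i → f (List.lookup xs i) ∈ ys
    pos i = from (my _) (f∈ _ (S∋ i))
    g : Fin (length xs) → Fin (length ys)
    g i = Any.index (pos i)
    g-inj : ∀ {i j} → g i ≡ g j → i ≡ j
    g-inj {i} {j} e = lookup-injective ux (f-inj _ _ (S∋ i) (S∋ j)
      (trans (Any.lookup-index (pos i)) (trans (cong (List.lookup ys) e) (sym (Any.lookup-index (pos j))))))

  card-biject : ∀ {d e} {S : Point d → Set} {T : Point e → Set} {a b} → HasCard S a → HasCard T b →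
    (f : Point d → Point e) (g : Point e → Point d) → (∀ x → S x → T (f x)) → (∀ y → T y → S (g y)) →
    (∀ x → S x → g (f x) ≡ x) → (∀ y → T y → f (g y) ≡ y) → a ≡ b
  card-biject cS cT f g f∈ g∈ gf fg = ℕ.≤-antisym
    (card-inject cS cT f f∈ (λ x y p q e → trans (sym (gf x p)) (trans (cong g e) (gf y q))))
    (card-inject cT cS g g∈ (λ x y p q e → trans (sym (fg x p)) (trans (cong f e) (fg y q))))

  card-unique : ∀ {d} {S T : Point d → Set} {a b} → HasCard S a → HasCard T b → (∀ x → S x ⇔ T x) → a ≡ b
  card-unique cS cT eq = card-biject cS cT id id (λ x → to (eq x)) (λ x → from (eq x)) (λ _ _ → refl) (λ _ _ → refl)
    where open Equivalence

  card-resp : ∀ {d} {S T : Point d → Set} {a} → (∀ x → S x ⇔ T x) → HasCard S a → HasCard T a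
  card-resp eq (xs , u , l , m) = xs , u , l , λ x → mk⇔ (to (eq x) ∘ to (m x)) (from (m x) ∘ from (eq x))
    where open Equivalence

  card-empty : ∀ {d} {S : Point d → Set} → (∀ x → ¬ S x) → HasCard S 0
  card-empty h = [] , AllPairs.[] , refl , λ x → mk⇔ (λ ()) (λ s → contradiction s (h x))

  card-filter : ∀ {d} {S P : Point d → Set} {a} → HasCard S a → Decidable P → ∃ (HasCard (λ x → S x × P x))
  card-filter (xs , u , _ , m) P? = _ , List.filter P? xs , Unique.filter⁺ P? u , refl , λ x → mk⇔
    (λ p → let q = ∈-filter⁻ P? p in to (m x) (proj₁ q) , proj₂ q)
    (λ { (s , p) → ∈-filter⁺ P? (from (m x) s) p })
    where open Equivalence

  card-⊎ : ∀ {d} {S T : Point d → Set} {a b} → HasCard S a → HasCard T b → (∀ x → S x → T x → ⊥) →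
    HasCard (λ x → S x ⊎ T x) (a + b)
  card-⊎ (xs , ux , refl , mx) (ys , uy , refl , my) disj = xs ++ ys
    , Unique.++⁺ ux uy (λ { (p , q) → disj _ (to (mx _) p) (to (my _) q) })
    , List.length-++ xs
    , λ x → mk⇔ (λ p → [ inj₁ ∘ to (mx x) , inj₂ ∘ to (my x) ] (∈-++⁻ xs p)) [ ∈-++⁺ˡ ∘ from (mx x) , ∈-++⁺ʳ xs ∘ from (my x) ]
    where open Equivalence

  sumOver : ∀ {A : Set} → List A → (A → ℕ) → ℕ
  sumOver [] c = 0
  sumOver (a ∷ as) c = c a + sumOver as c

  card-⋃ : ∀ {A : Set} {d} (as : List A) → Unique as → (Q : A → Point d → Set) (c : A → ℕ) → (∀ a → HasCard (Q a) (c a)) →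
    (∀ {a b} x → a ≢ b → Q a x → Q b x → ⊥) → HasCard (λ x → ∃ λ a → a ∈ as × Q a x) (sumOver as c)
  card-⋃ [] _ Q c card disj = card-empty (λ { x (_ , () , _) })
  card-⋃ (a ∷ as) (a∉ AllPairs.∷ u) Q c card disj = card-resp
    (λ x → mk⇔ (λ { (inj₁ q) → a , here refl , q ; (inj₂ (b , b∈ , q)) → b , there b∈ , q })
               (λ { (_ , here refl , q) → inj₁ q ; (b , there b∈ , q) → inj₂ (b , b∈ , q) }))
    (card-⊎ (card a) (card-⋃ as u Q c card disj) (λ { x q (b , b∈ , q') → disj x (All.lookup a∉ b∈) q q' }))

  interval : ℕ → List ℤ
  interval R = List.map (λ k → ⊕ k ℤ.- ⊕ R) (List.upTo (suc (R + R)))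

  ∈-interval : ∀ {R z} → ℤ.- ⊕ R ℤ.≤ z → z ℤ.≤ ⊕ R → z ∈ interval R
  ∈-interval {R} {z} lo hi = member (z ℤ.+ ⊕ R) refl
    (subst (ℤ._≤ z ℤ.+ ⊕ R) (ℤ.+-inverseˡ (⊕ R)) (ℤ.+-monoˡ-≤ (⊕ R) lo))
    (ℤ.+-monoˡ-≤ (⊕ R) hi)
    where
    member : ∀ y → y ≡ z ℤ.+ ⊕ R → ⊕ 0 ℤ.≤ y → y ℤ.≤ ⊕ R ℤ.+ ⊕ R → z ∈ interval R
    member (⊕ k) e _ (ℤ.+≤+ le) = subst (_∈ interval R) eq (∈-map⁺ (λ k → ⊕ k ℤ.- ⊕ R) (∈-upTo⁺ (s≤s le)))
      where
      eq : ⊕ k ℤ.- ⊕ R ≡ z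
      eq = trans (cong (ℤ._- ⊕ R) e) (trans (ℤ.+-assoc z (⊕ R) (ℤ.- ⊕ R)) (trans (cong (ℤ._+_ z) (ℤ.+-inverseʳ (⊕ R))) (ℤ.+-identityʳ z)))
    member ⊖[1+ _ ] _ () _

  interval-unique : ∀ R → Unique (interval R)
  interval-unique R = Unique.map⁺ inj (Unique.upTo⁺ (suc (R + R)))
    where
    inj : ∀ {a b} → ⊕ a ℤ.- ⊕ R ≡ ⊕ b ℤ.- ⊕ R → a ≡ b
    inj {a} {b} e = ℤ.+-injective (trans (sym (back a)) (trans (cong (ℤ._+ ⊕ R) e) (back b)))
      where
      back : ∀ k → ⊕ k ℤ.- ⊕ R ℤ.+ ⊕ R ≡ ⊕ k
      back k = trans (ℤ.+-assoc (⊕ k) (ℤ.- ⊕ R) (⊕ R)) (trans (cong (ℤ._+_ (⊕ k)) (ℤ.+-inverseˡ (⊕ R))) (ℤ.+-identityʳ (⊕ k)))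

  cube : ∀ n → ℕ → List (Vec ℤ n)
  cube zero R = Vec.[] ∷ []
  cube (suc n) R = List.cartesianProductWith Vec._∷_ (interval R) (cube n R)

  ∈-cube : ∀ {n R} (x : Vec ℤ n) → (∀ j → ℤ.- ⊕ R ℤ.≤ lookup x j × lookup x j ℤ.≤ ⊕ R) → x ∈ cube n R
  ∈-cube Vec.[] h = here refl
  ∈-cube (z Vec.∷ x) h = ∈-cartesianProductWith⁺ Vec._∷_ (∈-interval (proj₁ (h zero)) (proj₂ (h zero))) (∈-cube x (h ∘ suc))

  cube-unique : ∀ n R → Unique (cube n R)
  cube-unique zero R = [] AllPairs.∷ AllPairs.[]
  cube-unique (suc n) R = Unique.cartesianProductWith⁺ Vec._∷_ (λ { refl → refl , refl }) (interval-unique R) (cube-unique n R)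

  card-bounded : ∀ {d} {S : Point d → Set} R → Decidable S → (∀ x → S x → ∀ j → ℤ.- ⊕ R ℤ.≤ lookup x j × lookup x j ℤ.≤ ⊕ R) → ∃ (HasCard S)
  card-bounded {d} R S? bd = _ , List.filter S? (cube d R) , Unique.filter⁺ S? (cube-unique d R) , refl , λ x →
    mk⇔ (λ p → proj₂ (∈-filter⁻ S? {xs = cube d R} p)) (λ s → ∈-filter⁺ S? (∈-cube x (bd x s)) s)

-- Rational arithmetic, integer casts, finite sums and the lexicographic order.

module Rationals where

  open import Data.Rational hiding (∣_∣; _/_; pos)
  open import Data.Rational.Properties hiding (_≥?_; _>?_)
  open import Tactic.RingSolver using (solve-∀)

  ℚ-ring : AlmostCommutativeRing 0ℓ 0ℓ
  ℚ-ring = fromCommutativeRing +-*-commutativeRing (λ x → dec⇒maybe (0ℚ ≟ x))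

  0≤+ : ∀ {a b} → 0ℚ ≤ a → 0ℚ ≤ b → 0ℚ ≤ a + b
  0≤+ {a} {b} p q = subst (_≤ a + b) (+-identityˡ 0ℚ) (+-mono-≤ p q)

  0<+≤ : ∀ {a b} → 0ℚ < a → 0ℚ ≤ b → 0ℚ < a + b
  0<+≤ {a} {b} p q = subst (_< a + b) (+-identityˡ 0ℚ) (+-mono-<-≤ p q)

  0≤+< : ∀ {a b} → 0ℚ ≤ a → 0ℚ < b → 0ℚ < a + b
  0≤+< {a} {b} p q = subst (_< a + b) (+-identityˡ 0ℚ) (+-mono-≤-< p q)

  0≤* : ∀ {a b} → 0ℚ ≤ a → 0ℚ ≤ b → 0ℚ ≤ a * b
  0≤* {a} {b} p q = nonNegative⁻¹ (a * b) {{nonNeg*nonNeg⇒nonNeg a {{nonNegative p}} b {{nonNegative q}}}}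

  0<* : ∀ {a b} → 0ℚ < a → 0ℚ < b → 0ℚ < a * b
  0<* {a} {b} p q = positive⁻¹ (a * b) {{pos*pos⇒pos a {{positive p}} b {{positive q}}}}

  ≤⇒0≤- : ∀ {a b} → a ≤ b → 0ℚ ≤ b - a
  ≤⇒0≤- {a} {b} p = subst (_≤ b - a) (+-inverseʳ a) (+-monoˡ-≤ (- a) p)

  <⇒0<- : ∀ {a b} → a < b → 0ℚ < b - a
  <⇒0<- {a} {b} p = subst (_< b - a) (+-inverseʳ a) (+-monoˡ-< (- a) p)

  sub-add-cancel : ∀ a b → a - b + b ≡ a
  sub-add-cancel = solve-∀ ℚ-ring

  0≤-⇒≤ : ∀ {a b} → 0ℚ ≤ b - a → a ≤ b
  0≤-⇒≤ {a} {b} p = subst₂ _≤_ (+-identityˡ a) (sub-add-cancel b a) (+-monoˡ-≤ a p)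

  0<-⇒< : ∀ {a b} → 0ℚ < b - a → a < b
  0<-⇒< {a} {b} p = subst₂ _<_ (+-identityˡ a) (sub-add-cancel b a) (+-monoˡ-< a p)

  0-a : ∀ a → 0ℚ - a ≡ - a
  0-a = solve-∀ ℚ-ring

  a-0 : ∀ a → a - 0ℚ ≡ a
  a-0 = solve-∀ ℚ-ring

  neg-pos-flip : ∀ {a} → a < 0ℚ → 0ℚ < - a
  neg-pos-flip {a} p = subst (0ℚ <_) (0-a a) (<⇒0<- p)

  neg-nonneg-flip : ∀ {a} → a ≤ 0ℚ → 0ℚ ≤ - a
  neg-nonneg-flip {a} p = subst (0ℚ ≤_) (0-a a) (≤⇒0≤- p)

  neg-neg : ∀ a → - - a ≡ a
  neg-neg = solve-∀ ℚ-ring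

  0<⇒≢0 : ∀ {a} → 0ℚ < a → a ≢ 0ℚ
  0<⇒≢0 p e = <-irrefl (sym e) p

  0<1 : 0ℚ < 1ℚ
  0<1 = positive⁻¹ 1ℚ

  inverse : ∀ a → a ≢ 0ℚ → ∃ λ b → a * b ≡ 1ℚ
  inverse a a≢0 = 1/_ a {{≢-nonZero a≢0}} , *-inverseʳ a {{≢-nonZero a≢0}}

  inverse-pos : ∀ {a} → 0ℚ < a → ∃ λ b → 0ℚ < b × a * b ≡ 1ℚ
  inverse-pos {a} p = b , positive⁻¹ b {{1/pos⇒pos a {{positive p}}}} , *-inverseʳ a {{pos⇒nonZero a {{positive p}}}}
    where b = (1/ a) {{pos⇒nonZero a {{positive p}}}}

  *-cancel-0 : ∀ {a b} → a ≢ 0ℚ → a * b ≡ 0ℚ → b ≡ 0ℚ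
  *-cancel-0 {a} {b} a≢0 e with inverse a a≢0
  ... | c , ac≡1 = begin
    b ≡⟨ *-identityˡ b ⟨
    1ℚ * b ≡⟨ cong (_* b) ac≡1 ⟨
    a * c * b ≡⟨ lem a b c ⟩
    c * (a * b) ≡⟨ cong (c *_) e ⟩
    c * 0ℚ ≡⟨ *-zeroʳ c ⟩
    0ℚ ∎
    where open ≡-Reasoning
          lem : ∀ a b c → a * c * b ≡ c * (a * b)
          lem = solve-∀ ℚ-ring

  0≤*-cancel : ∀ {a b} → 0ℚ < a → 0ℚ ≤ a * b → 0ℚ ≤ b
  0≤*-cancel {a} {b} p q = *-cancelˡ-≤-pos a {{positive p}} (subst (_≤ a * b) (sym (*-zeroʳ a)) q)

  0<*-cancel : ∀ {a b} → 0ℚ < a → 0ℚ < a * b → 0ℚ < b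
  0<*-cancel {a} {b} p q = *-cancelˡ-<-nonNeg a {{pos⇒nonNeg a {{positive p}}}} (subst (_< a * b) (sym (*-zeroʳ a)) q)

  -- Normalised fractions carry a coprimality proof. Identities for the cast are therefore checked
  -- on unnormalised representatives, where `z / 1` is a plain pair.
  cast-toℚᵘ : ∀ z → toℚᵘ (ℤ→ℚ z) ℚᵘ.≃ ℚᵘ.mkℚᵘ z 0
  cast-toℚᵘ z = toℚᵘ-fromℚᵘ (ℚᵘ.mkℚᵘ z 0)

  cast-+ : ∀ a b → ℤ→ℚ (a ℤ.+ b) ≡ ℤ→ℚ a + ℤ→ℚ b
  cast-+ a b = toℚᵘ-injective (ℚᵘ.≃-trans (cast-toℚᵘ (a ℤ.+ b)) (ℚᵘ.≃-trans
    (ℚᵘ.*≡* (cong (ℤ._* ⊕ 1) (cong₂ ℤ._+_ (sym (ℤ.*-identityʳ a)) (sym (ℤ.*-identityʳ b)))))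
    (ℚᵘ.≃-sym (ℚᵘ.≃-trans (toℚᵘ-homo-+ (ℤ→ℚ a) (ℤ→ℚ b)) (ℚᵘ.+-cong (cast-toℚᵘ a) (cast-toℚᵘ b))))))

  cast-* : ∀ a b → ℤ→ℚ (a ℤ.* b) ≡ ℤ→ℚ a * ℤ→ℚ b
  cast-* a b = toℚᵘ-injective (ℚᵘ.≃-trans (cast-toℚᵘ (a ℤ.* b)) (ℚᵘ.≃-sym
    (ℚᵘ.≃-trans (toℚᵘ-homo-* (ℤ→ℚ a) (ℤ→ℚ b)) (ℚᵘ.*-cong (cast-toℚᵘ a) (cast-toℚᵘ b)))))

  cast-neg : ∀ a → ℤ→ℚ (ℤ.- a) ≡ - ℤ→ℚ a
  cast-neg a = toℚᵘ-injective (ℚᵘ.≃-trans (cast-toℚᵘ (ℤ.- a)) (ℚᵘ.≃-sym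
    (ℚᵘ.≃-trans (toℚᵘ-homo‿- (ℤ→ℚ a)) (ℚᵘ.-‿cong (cast-toℚᵘ a)))))

  cast-sub : ∀ a b → ℤ→ℚ (a ℤ.- b) ≡ ℤ→ℚ a - ℤ→ℚ b
  cast-sub a b = trans (cast-+ a (ℤ.- b)) (cong (ℤ→ℚ a +_) (cast-neg b))

  cast-mono-≤ : ∀ {a b} → a ℤ.≤ b → ℤ→ℚ a ≤ ℤ→ℚ b
  cast-mono-≤ {a} {b} p = toℚᵘ-cancel-≤ (ℚᵘ.≤-respˡ-≃ (ℚᵘ.≃-sym (cast-toℚᵘ a)) (ℚᵘ.≤-respʳ-≃ (ℚᵘ.≃-sym (cast-toℚᵘ b))
    (ℚᵘ.*≤* (subst₂ ℤ._≤_ (sym (ℤ.*-identityʳ a)) (sym (ℤ.*-identityʳ b)) p))))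

  cast-mono-< : ∀ {a b} → a ℤ.< b → ℤ→ℚ a < ℤ→ℚ b
  cast-mono-< {a} {b} p = toℚᵘ-cancel-< (ℚᵘ.<-respˡ-≃ (ℚᵘ.≃-sym (cast-toℚᵘ a)) (ℚᵘ.<-respʳ-≃ (ℚᵘ.≃-sym (cast-toℚᵘ b))
    (ℚᵘ.*<* (subst₂ ℤ._<_ (sym (ℤ.*-identityʳ a)) (sym (ℤ.*-identityʳ b)) p))))

  cast-cancel-< : ∀ {a b} → ℤ→ℚ a < ℤ→ℚ b → a ℤ.< b
  cast-cancel-< {a} {b} p with ℤ.<-cmp a b
  ... | tri< q _ _ = q
  ... | tri≈ _ refl _ = contradiction p (<-irrefl refl)
  ... | tri> _ _ q = contradiction p (<-asym (cast-mono-< q))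

  cast-cancel-≤ : ∀ {a b} → ℤ→ℚ a ≤ ℤ→ℚ b → a ℤ.≤ b
  cast-cancel-≤ {a} {b} p with a ℤ.≤? b
  ... | yes q = q
  ... | no q = contradiction (≤-<-trans p (cast-mono-< (ℤ.≰⇒> q))) (<-irrefl refl)

  cast-injective : ∀ {a b} → ℤ→ℚ a ≡ ℤ→ℚ b → a ≡ b
  cast-injective e = ℤ.≤-antisym (cast-cancel-≤ (≤-reflexive e)) (cast-cancel-≤ (≤-reflexive (sym e)))

  Σ-cong : ∀ n {f g : Fin n → ℚ} → (∀ i → f i ≡ g i) → Σℚ n f ≡ Σℚ n g
  Σ-cong zero e = refl
  Σ-cong (suc n) e = cong₂ _+_ (e zero) (Σ-cong n (e ∘ suc))

  Σ-zero : ∀ n {f : Fin n → ℚ} → (∀ i → f i ≡ 0ℚ) → Σℚ n f ≡ 0ℚ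
  Σ-zero zero e = refl
  Σ-zero (suc n) e = trans (cong₂ _+_ (e zero) (Σ-zero n (e ∘ suc))) (+-identityˡ 0ℚ)

  Σ-+ : ∀ n (f g : Fin n → ℚ) → Σℚ n (λ i → f i + g i) ≡ Σℚ n f + Σℚ n g
  Σ-+ zero f g = sym (+-identityˡ 0ℚ)
  Σ-+ (suc n) f g = trans (cong (f zero + g zero +_) (Σ-+ n (f ∘ suc) (g ∘ suc))) (lem (f zero) (g zero) (Σℚ n (f ∘ suc)) (Σℚ n (g ∘ suc)))
    where lem : ∀ a b c d → a + b + (c + d) ≡ a + c + (b + d)
          lem = solve-∀ ℚ-ring

  Σ-*ˡ : ∀ n c (f : Fin n → ℚ) → Σℚ n (λ i → c * f i) ≡ c * Σℚ n f
  Σ-*ˡ zero c f = sym (*-zeroʳ c)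
  Σ-*ˡ (suc n) c f = trans (cong (c * f zero +_) (Σ-*ˡ n c (f ∘ suc))) (sym (*-distribˡ-+ c _ _))

  Σ-*ʳ : ∀ n c (f : Fin n → ℚ) → Σℚ n (λ i → f i * c) ≡ Σℚ n f * c
  Σ-*ʳ n c f = trans (Σ-cong n (λ i → *-comm (f i) c)) (trans (Σ-*ˡ n c f) (*-comm c _))

  Σ-neg : ∀ n (f : Fin n → ℚ) → Σℚ n (λ i → - f i) ≡ - Σℚ n f
  Σ-neg zero f = refl
  Σ-neg (suc n) f = trans (cong (- f zero +_) (Σ-neg n (f ∘ suc))) (sym (neg-distrib-+ (f zero) (Σℚ n (f ∘ suc))))

  Σ-swap : ∀ n m (f : Fin n → Fin m → ℚ) → Σℚ n (λ i → Σℚ m (f i)) ≡ Σℚ m (λ j → Σℚ n (λ i → f i j))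
  Σ-swap zero m f = sym (Σ-zero m (λ _ → refl))
  Σ-swap (suc n) m f = trans (cong (Σℚ m (f zero) +_) (Σ-swap n m (f ∘ suc))) (sym (Σ-+ m (f zero) _))

  δ : ∀ {n} → Fin n → Fin n → ℚ
  δ zero zero = 1ℚ
  δ zero (suc j) = 0ℚ
  δ (suc i) zero = 0ℚ
  δ (suc i) (suc j) = δ i j

  δ-refl : ∀ {n} (i : Fin n) → δ i i ≡ 1ℚ
  δ-refl zero = refl
  δ-refl (suc i) = δ-refl i

  δ-≢ : ∀ {n} {i j : Fin n} → i ≢ j → δ i j ≡ 0ℚ
  δ-≢ {i = zero} {zero} p = contradiction refl p
  δ-≢ {i = zero} {suc j} p = refl
  δ-≢ {i = suc i} {zero} p = refl
  δ-≢ {i = suc i} {suc j} p = δ-≢ (p ∘ cong suc)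

  δ-sym : ∀ {n} (i j : Fin n) → δ i j ≡ δ j i
  δ-sym zero zero = refl
  δ-sym zero (suc j) = refl
  δ-sym (suc i) zero = refl
  δ-sym (suc i) (suc j) = δ-sym i j

  Σ-δˡ : ∀ n (f : Fin n → ℚ) (k : Fin n) → Σℚ n (λ i → δ k i * f i) ≡ f k
  Σ-δˡ (suc n) f zero = trans (cong₂ _+_ (*-identityˡ (f zero)) (Σ-zero n (λ i → *-zeroˡ (f (suc i))))) (+-identityʳ _)
  Σ-δˡ (suc n) f (suc k) = trans (cong₂ _+_ (*-zeroˡ (f zero)) (Σ-δˡ n (f ∘ suc) k)) (+-identityˡ _)

  Σ-δʳ : ∀ n (f : Fin n → ℚ) (k : Fin n) → Σℚ n (λ i → f i * δ i k) ≡ f k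
  Σ-δʳ n f k = trans (Σ-cong n (λ i → trans (*-comm (f i) _) (cong (_* f i) (δ-sym i k)))) (Σ-δˡ n f k)

  Σ-nonneg : ∀ n {f : Fin n → ℚ} → (∀ i → 0ℚ ≤ f i) → 0ℚ ≤ Σℚ n f
  Σ-nonneg zero p = ≤-refl
  Σ-nonneg (suc n) p = 0≤+ (p zero) (Σ-nonneg n (p ∘ suc))

  Σ-mono : ∀ n {f g : Fin n → ℚ} → (∀ i → f i ≤ g i) → Σℚ n f ≤ Σℚ n g
  Σ-mono zero p = ≤-refl
  Σ-mono (suc n) p = +-mono-≤ (p zero) (Σ-mono n (p ∘ suc))

  Σ-term : ∀ n {f : Fin n → ℚ} → (∀ i → 0ℚ ≤ f i) → ∀ k → f k ≤ Σℚ n f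
  Σ-term (suc n) {f} p zero = subst (_≤ Σℚ (suc n) f) (+-identityʳ _) (+-monoʳ-≤ (f zero) (Σ-nonneg n (p ∘ suc)))
  Σ-term (suc n) {f} p (suc k) = ≤-trans (Σ-term n (p ∘ suc) k) (subst (_≤ Σℚ (suc n) f) (+-identityˡ _) (+-monoˡ-≤ _ (p zero)))

  cast-Σ : ∀ n (f : Fin n → ℤ) → ℤ→ℚ (Σℤ n f) ≡ Σℚ n (λ i → ℤ→ℚ (f i))
  cast-Σ zero f = refl
  cast-Σ (suc n) f = trans (cast-+ (f zero) (Σℤ n (f ∘ suc))) (cong (ℤ→ℚ (f zero) +_) (cast-Σ n (f ∘ suc)))

  -- Lexicographic nonnegativity: the first nonzero entry, if there is one, is positive.
  LexNN : ∀ {n} → (Fin n → ℚ) → Set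
  LexNN {zero} y = ⊤
  LexNN {suc n} y = 0ℚ < y zero ⊎ (y zero ≡ 0ℚ × LexNN (y ∘ suc))

  lex-cong : ∀ {n} {y z : Fin n → ℚ} → (∀ i → y i ≡ z i) → LexNN y → LexNN z
  lex-cong {zero} e p = tt
  lex-cong {suc n} e (inj₁ p) = inj₁ (subst (0ℚ <_) (e zero) p)
  lex-cong {suc n} e (inj₂ (p , q)) = inj₂ (trans (sym (e zero)) p , lex-cong (e ∘ suc) q)

  lex-zero : ∀ {n} {y : Fin n → ℚ} → (∀ i → y i ≡ 0ℚ) → LexNN y
  lex-zero {zero} e = tt
  lex-zero {suc n} e = inj₂ (e zero , lex-zero (e ∘ suc))

  lex-add : ∀ {n} {y z : Fin n → ℚ} → LexNN y → LexNN z → LexNN (λ i → y i + z i)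
  lex-add {zero} p q = tt
  lex-add {suc n} (inj₁ p) (inj₁ q) = inj₁ (0<+≤ p (<⇒≤ q))
  lex-add {suc n} (inj₁ p) (inj₂ (e , q)) = inj₁ (0<+≤ p (≤-reflexive (sym e)))
  lex-add {suc n} (inj₂ (e , p)) (inj₁ q) = inj₁ (0≤+< (≤-reflexive (sym e)) q)
  lex-add {suc n} (inj₂ (e , p)) (inj₂ (e' , q)) = inj₂ (trans (cong₂ _+_ e e') (+-identityˡ 0ℚ) , lex-add p q)

  lex-* : ∀ {n} {t} {y : Fin n → ℚ} → 0ℚ < t → LexNN y → LexNN (λ i → t * y i)
  lex-* {zero} t>0 p = tt
  lex-* {suc n} t>0 (inj₁ p) = inj₁ (0<* t>0 p)
  lex-* {suc n} {t} t>0 (inj₂ (e , p)) = inj₂ (trans (cong (t *_) e) (*-zeroʳ t) , lex-* t>0 p)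

  lex-total : ∀ {n} (y : Fin n → ℚ) → LexNN y ⊎ LexNN (λ i → - y i)
  lex-total {zero} y = inj₁ tt
  lex-total {suc n} y with <-cmp 0ℚ (y zero)
  ... | tri< p _ _ = inj₁ (inj₁ p)
  ... | tri> _ _ p = inj₂ (inj₁ (neg-pos-flip p))
  ... | tri≈ _ e _ with lex-total (y ∘ suc)
  ...   | inj₁ q = inj₁ (inj₂ (sym e , q))
  ...   | inj₂ q = inj₂ (inj₂ (cong -_ (sym e) , q))

  lex-antisym : ∀ {n} {y : Fin n → ℚ} → LexNN y → LexNN (λ i → - y i) → ∀ i → y i ≡ 0ℚ
  lex-antisym {suc n} {y} (inj₁ p) (inj₁ q) i = contradiction (0<+≤ p (<⇒≤ q)) (<-irrefl (sym (+-inverseʳ (y zero))))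
  lex-antisym {suc n} {y} (inj₁ p) (inj₂ (e , _)) i = contradiction (trans (sym (neg-neg (y zero))) (cong -_ e)) (0<⇒≢0 p)
  lex-antisym {suc n} (inj₂ (e , p)) (inj₁ q) i = contradiction (cong -_ e) (0<⇒≢0 q)
  lex-antisym {suc n} (inj₂ (e , p)) (inj₂ _) zero = e
  lex-antisym {suc n} (inj₂ (e , p)) (inj₂ (_ , q)) (suc i) = lex-antisym p q i

-- Dual bases, pivoting and purification of feasible weights.

module LinearAlgebra where

  open import Data.Rational hiding (∣_∣; _/_; pos)
  open import Data.Rational.Properties hiding (_≥?_; _>?_)
  open import Tactic.RingSolver using (solve-∀)
  open import Data.Fin.Subset using (∣_∣)
  open Rationals

  -- Gaussian elimination: a nonzero entry of the first vector clears its column in all others, and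
  -- the recursion runs on the remaining columns. If the first vector is zero, it is a relation by
  -- itself.
  dependent : ∀ n (A : Fin (suc n) → Fin n → ℚ) →
    ∃ λ (c : Fin (suc n) → ℚ) → (∃ λ i → c i ≢ 0ℚ) × (∀ j → Σℚ (suc n) (λ i → c i * A i j) ≡ 0ℚ)
  dependent zero A = (λ _ → 1ℚ) , (zero , λ ()) , λ ()
  dependent (suc n) A with Fin.any? (λ j → ¬? (A zero j ≟ 0ℚ))
  ... | no none = δ zero , (zero , λ ()) , λ j →
    trans (Σ-δˡ (suc (suc n)) (λ i → A i j) zero) (zeros j)
    where
    zeros : ∀ j → A zero j ≡ 0ℚ
    zeros j = decidable-stable (A zero j ≟ 0ℚ) (λ ne → none (j , ne))
  ... | yes (j , ne) = c , (suc i , nz) , eq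
    where
    a = A zero j
    b = proj₁ (inverse a ne)
    ab≡1 = proj₂ (inverse a ne)
    A' : Fin (suc n) → Fin (suc n) → ℚ
    A' i l = A (suc i) l - A (suc i) j * b * A zero l
    rec = dependent n (λ i l → A' i (Fin.punchIn j l))
    c' = proj₁ rec
    i = proj₁ (proj₁ (proj₂ rec))
    nz = proj₂ (proj₁ (proj₂ rec))
    s = Σℚ (suc n) (λ i → c' i * A (suc i) j)
    c : Fin (suc (suc n)) → ℚ
    c zero = - (s * b)
    c (suc i) = c' i
    sum' : ∀ l → Σℚ (suc (suc n)) (λ i → c i * A i l) ≡ Σℚ (suc n) (λ i → c' i * A' i l)
    sum' l = sym (begin
      Σℚ (suc n) (λ i → c' i * A' i l)
        ≡⟨ Σ-cong (suc n) (λ i → lem (c' i) (A (suc i) l) (A (suc i) j) b (A zero l)) ⟩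
      Σℚ (suc n) (λ i → c' i * A (suc i) j * (- (b * A zero l)) + c' i * A (suc i) l)
        ≡⟨ Σ-+ (suc n) (λ i → c' i * A (suc i) j * (- (b * A zero l))) (λ i → c' i * A (suc i) l) ⟩
      Σℚ (suc n) (λ i → c' i * A (suc i) j * (- (b * A zero l))) + t
        ≡⟨ cong (_+ t) (Σ-*ʳ (suc n) (- (b * A zero l)) (λ i → c' i * A (suc i) j)) ⟩
      s * (- (b * A zero l)) + t
        ≡⟨ cong (_+ t) (lem2 s b (A zero l)) ⟩
      Σℚ (suc (suc n)) (λ i → c i * A i l) ∎)
      where
      open ≡-Reasoning
      t = Σℚ (suc n) (λ i → c' i * A (suc i) l)
      lem : ∀ c x y b z → c * (x - y * b * z) ≡ c * y * (- (b * z)) + c * x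
      lem = solve-∀ ℚ-ring
      lem2 : ∀ s b z → s * (- (b * z)) ≡ - (s * b) * z
      lem2 = solve-∀ ℚ-ring
    pivotcol : ∀ i → A' i j ≡ 0ℚ
    pivotcol i = trans (cong (λ t → A (suc i) j - t) (trans (lem (A (suc i) j) b a) (cong (A (suc i) j *_) ab≡1))) (lem2 (A (suc i) j))
      where
      lem : ∀ x b a → x * b * a ≡ x * (a * b)
      lem = solve-∀ ℚ-ring
      lem2 : ∀ x → x - x * 1ℚ ≡ 0ℚ
      lem2 = solve-∀ ℚ-ring
    eq : ∀ l → Σℚ (suc (suc n)) (λ i → c i * A i l) ≡ 0ℚ
    eq l with j Fin.≟ l
    ... | yes refl = trans (sum' j) (Σ-zero (suc n) (λ i → trans (cong (c' i *_) (pivotcol i)) (*-zeroʳ (c' i))))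
    ... | no j≢l = trans (sum' l) (subst (λ l → Σℚ (suc n) (λ i → c' i * A' i l) ≡ 0ℚ)
                     (Fin.punchIn-punchOut j≢l) (proj₂ (proj₂ rec) (Fin.punchOut j≢l)))

  dot : ∀ {D} → (Fin D → ℚ) → (Fin D → ℚ) → ℚ
  dot {D} a x = Σℚ D (λ j → a j * x j)

  dot-congʳ : ∀ {D} (a : Fin D → ℚ) {x y : Fin D → ℚ} → (∀ j → x j ≡ y j) → dot a x ≡ dot a y
  dot-congʳ {D} a e = Σ-cong D (λ j → cong (a j *_) (e j))

  dot-addʳ : ∀ {D} (a x y : Fin D → ℚ) → dot a (λ j → x j + y j) ≡ dot a x + dot a y
  dot-addʳ {D} a x y = trans (Σ-cong D (λ j → *-distribˡ-+ (a j) (x j) (y j))) (Σ-+ D (λ j → a j * x j) (λ j → a j * y j))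

  dot-*ʳ : ∀ {D} c (a x : Fin D → ℚ) → dot a (λ j → c * x j) ≡ c * dot a x
  dot-*ʳ {D} c a x = trans (Σ-cong D (λ j → lem (a j) c (x j))) (Σ-*ˡ D c (λ j → a j * x j))
    where lem : ∀ a c x → a * (c * x) ≡ c * (a * x)
          lem = solve-∀ ℚ-ring

  dot-negʳ : ∀ {D} (a x : Fin D → ℚ) → dot a (λ j → - x j) ≡ - dot a x
  dot-negʳ {D} a x = trans (Σ-cong D (λ j → sym (neg-distribʳ-* (a j) (x j)))) (Σ-neg D (λ j → a j * x j))

  dot-subʳ : ∀ {D} (a x y : Fin D → ℚ) → dot a (λ j → x j - y j) ≡ dot a x - dot a y
  dot-subʳ a x y = trans (dot-addʳ a x (λ j → - y j)) (cong (dot a x +_) (dot-negʳ a y))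

  comb : ∀ {M D} → (Fin M → Fin D → ℚ) → (Fin M → ℚ) → Fin D → ℚ
  comb {M} ω y j = Σℚ M (λ i → y i * ω i j)

  comb-cong : ∀ {M D} (ω : Fin M → Fin D → ℚ) {y z} → (∀ i → y i ≡ z i) → ∀ j → comb ω y j ≡ comb ω z j
  comb-cong {M} ω e j = Σ-cong M (λ i → cong (_* ω i j) (e i))

  comb-add : ∀ {M D} (ω : Fin M → Fin D → ℚ) y z j → comb ω (λ i → y i + z i) j ≡ comb ω y j + comb ω z j
  comb-add {M} ω y z j = trans (Σ-cong M (λ i → *-distribʳ-+ (ω i j) (y i) (z i))) (Σ-+ M (λ i → y i * ω i j) (λ i → z i * ω i j))

  comb-* : ∀ {M D} (ω : Fin M → Fin D → ℚ) c y j → comb ω (λ i → c * y i) j ≡ c * comb ω y j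
  comb-* {M} ω c y j = trans (Σ-cong M (λ i → *-assoc c (y i) (ω i j))) (Σ-*ˡ M c (λ i → y i * ω i j))

  comb-neg : ∀ {M D} (ω : Fin M → Fin D → ℚ) y j → comb ω (λ i → - y i) j ≡ - comb ω y j
  comb-neg {M} ω y j = trans (Σ-cong M (λ i → sym (neg-distribˡ-* (y i) (ω i j)))) (Σ-neg M (λ i → y i * ω i j))

  comb-sub : ∀ {M D} (ω : Fin M → Fin D → ℚ) y z j → comb ω (λ i → y i - z i) j ≡ comb ω y j - comb ω z j
  comb-sub ω y z j = trans (comb-add ω y (λ i → - z i) j) (cong (comb ω y j +_) (comb-neg ω z j))

  comb-δ : ∀ {M D} (ω : Fin M → Fin D → ℚ) k j → comb ω (δ k) j ≡ ω k j
  comb-δ {M} ω k j = Σ-δˡ M (λ i → ω i j) k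

  dot-comb : ∀ {M D} (ω : Fin M → Fin D → ℚ) a y → dot a (comb ω y) ≡ Σℚ M (λ i → y i * dot a (ω i))
  dot-comb {M} {D} ω a y = begin
    Σℚ D (λ j → a j * Σℚ M (λ i → y i * ω i j)) ≡⟨ Σ-cong D (λ j → Σ-*ˡ M (a j) (λ i → y i * ω i j)) ⟨
    Σℚ D (λ j → Σℚ M (λ i → a j * (y i * ω i j))) ≡⟨ Σ-swap D M (λ j i → a j * (y i * ω i j)) ⟩
    Σℚ M (λ i → Σℚ D (λ j → a j * (y i * ω i j))) ≡⟨ Σ-cong M (λ i → Σ-cong D (λ j → lem (a j) (y i) (ω i j))) ⟩
    Σℚ M (λ i → Σℚ D (λ j → y i * (a j * ω i j))) ≡⟨ Σ-cong M (λ i → Σ-*ˡ D (y i) (λ j → a j * ω i j)) ⟩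
    Σℚ M (λ i → y i * dot a (ω i)) ∎
    where
    open ≡-Reasoning
    lem : ∀ a y x → a * (y * x) ≡ y * (a * x)
    lem = solve-∀ ℚ-ring

  argmin : ∀ n {P : Fin n → Set} → (∀ i → Dec (P i)) → (r : Fin n → ℚ) → ∃ P →
           ∃ λ i → P i × (∀ l → P l → r i ≤ r l)
  argmin (suc n) {P} P? r (k , pk) with P? zero | Fin.any? (λ i → P? (suc i))
  ... | no ¬p0 | no ¬ps = ⊥-elim (impossible k pk)
    where impossible : ∀ k → P k → ⊥
          impossible zero p = ¬p0 p
          impossible (suc k) p = ¬ps (k , p)
  ... | yes p0 | no ¬ps = zero , p0 , λ { zero _ → ≤-refl ; (suc l) p → contradiction (l , p) ¬ps }
  ... | no ¬p0 | yes ex with argmin n (λ i → P? (suc i)) (r ∘ suc) ex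
  ...   | i , pi , min = suc i , pi , λ { zero p → contradiction p ¬p0 ; (suc l) p → min l p }
  argmin (suc n) {P} P? r (k , pk) | yes p0 | yes ex with argmin n (λ i → P? (suc i)) (r ∘ suc) ex
  ... | i , pi , min with ≤-total (r zero) (r (suc i))
  ...   | inj₁ le = zero , p0 , λ { zero _ → ≤-refl ; (suc l) p → ≤-trans le (min l p) }
  ...   | inj₂ ge = suc i , pi , λ { zero _ → ge ; (suc l) p → min l p }

  -- `recon` expresses spanning and `dual` independence. The dual functionals are extended by zero
  -- to all `M` generators, so that `λ i → dot (φ i) x` is a full weight vector, the basic solution
  -- for `x`.
  record Basis {M D : ℕ} (ω : Fin M → Fin D → ℚ) (S : Vec Bool M) : Set where
    field
      φ : Fin M → Fin D → ℚ
      recon : ∀ x j → comb ω (λ i → dot (φ i) x) j ≡ x j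
      off : ∀ i → lookup S i ≡ false → ∀ j → φ i j ≡ 0ℚ
      dual : ∀ i k → lookup S k ≡ true → dot (φ i) (ω k) ≡ δ i k

    off-dot : ∀ i → lookup S i ≡ false → ∀ x → dot (φ i) x ≡ 0ℚ
    off-dot i e x = Σ-zero D (λ j → trans (cong (_* x j) (off i e j)) (*-zeroˡ (x j)))

    coord : ∀ (y : Fin M → ℚ) → (∀ i → lookup S i ≡ false → y i ≡ 0ℚ) → ∀ i → dot (φ i) (comb ω y) ≡ y i
    coord y supp i = trans (dot-comb ω (φ i) y) (trans (Σ-cong M eq) (Σ-δʳ M y i))
      where
      eq : ∀ k → y k * dot (φ i) (ω k) ≡ y k * δ k i
      eq k with lookup S k in e
      ... | true = cong (y k *_) (trans (dual i k e) (δ-sym i k))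
      ... | false = trans (cong (_* dot (φ i) (ω k)) (supp k e)) (trans (*-zeroˡ (dot (φ i) (ω k))) (sym (trans (cong (_* δ k i) (supp k e)) (*-zeroˡ (δ k i)))))

    -- For `k` outside the basis this is the relation `ω k - (its expansion in the basis) = 0`, the
    -- direction of motion of the simplex method when `k` enters.
    circuit : Fin M → Fin M → ℚ
    circuit k l = δ l k - dot (φ l) (ω k)

    circuit-kernel : ∀ k j → comb ω (circuit k) j ≡ 0ℚ
    circuit-kernel k j = begin
      comb ω (circuit k) j ≡⟨ comb-sub ω (λ l → δ l k) (λ l → dot (φ l) (ω k)) j ⟩
      comb ω (λ l → δ l k) j - comb ω (λ l → dot (φ l) (ω k)) j ≡⟨ cong₂ _-_ (trans (comb-cong ω (λ l → δ-sym l k) j) (comb-δ ω k j)) (recon (ω k) j) ⟩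
      ω k j - ω k j ≡⟨ +-inverseʳ (ω k j) ⟩
      0ℚ ∎
      where open ≡-Reasoning

    circuit-self : ∀ k → lookup S k ≡ false → circuit k k ≡ 1ℚ
    circuit-self k e = cong₂ _-_ (δ-refl k) (off-dot k e (ω k))

    circuit-off : ∀ k l → lookup S l ≡ false → l ≢ k → circuit k l ≡ 0ℚ
    circuit-off k l e l≢k = cong₂ _-_ (δ-≢ l≢k) (off-dot l e (ω k))

    pivot : ∀ i k → lookup S i ≡ true → lookup S k ≡ false → circuit k i ≢ 0ℚ →
            Basis ω ((S [ i ]≔ false) [ k ]≔ true)
    pivot i k i∈S k∉S c≢0 = record { φ = φ' ; recon = recon' ; off = off' ; dual = dual' }
      where
      i≢k : i ≢ k
      i≢k refl with trans (sym i∈S) k∉S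
      ... | ()
      c = circuit k i
      r = - proj₁ (inverse c c≢0)
      cr : c * r ≡ - 1ℚ
      cr = trans (sym (neg-distribʳ-* c (proj₁ (inverse c c≢0)))) (cong -_ (proj₂ (inverse c c≢0)))
      y = circuit k
      φ' : Fin M → Fin D → ℚ
      -- Adding a multiple of a relation does not change the represented vector; the multiple is
      -- chosen so that coordinate `i` becomes zero.
      φ' l j = φ l j + y l * (r * φ i j)
      dot' : ∀ l x → dot (φ' l) x ≡ dot (φ l) x + r * dot (φ i) x * y l
      dot' l x = begin
        dot (φ' l) x ≡⟨ Σ-cong D (λ j → lem (φ l j) (y l) r (φ i j) (x j)) ⟩
        Σℚ D (λ j → φ l j * x j + r * y l * (φ i j * x j)) ≡⟨ Σ-+ D (λ j → φ l j * x j) (λ j → r * y l * (φ i j * x j)) ⟩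
        dot (φ l) x + Σℚ D (λ j → r * y l * (φ i j * x j)) ≡⟨ cong (dot (φ l) x +_) (Σ-*ˡ D (r * y l) (λ j → φ i j * x j)) ⟩
        dot (φ l) x + r * y l * dot (φ i) x ≡⟨ cong (dot (φ l) x +_) (lem2 r (y l) (dot (φ i) x)) ⟩
        dot (φ l) x + r * dot (φ i) x * y l ∎
        where
        open ≡-Reasoning
        lem : ∀ a y r b x → (a + y * (r * b)) * x ≡ a * x + r * y * (b * x)
        lem = solve-∀ ℚ-ring
        lem2 : ∀ r y d → r * y * d ≡ r * d * y
        lem2 = solve-∀ ℚ-ring
      recon' : ∀ x j → comb ω (λ l → dot (φ' l) x) j ≡ x j
      recon' x j = begin
        comb ω (λ l → dot (φ' l) x) j ≡⟨ comb-cong ω (λ l → dot' l x) j ⟩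
        comb ω (λ l → dot (φ l) x + r * dot (φ i) x * y l) j ≡⟨ comb-add ω (λ l → dot (φ l) x) (λ l → r * dot (φ i) x * y l) j ⟩
        comb ω (λ l → dot (φ l) x) j + comb ω (λ l → r * dot (φ i) x * y l) j ≡⟨ cong₂ _+_ (recon x j) (comb-* ω (r * dot (φ i) x) y j) ⟩
        x j + r * dot (φ i) x * comb ω y j ≡⟨ cong (λ t → x j + r * dot (φ i) x * t) (circuit-kernel k j) ⟩
        x j + r * dot (φ i) x * 0ℚ ≡⟨ cong (x j +_) (*-zeroʳ (r * dot (φ i) x)) ⟩
        x j + 0ℚ ≡⟨ +-identityʳ (x j) ⟩
        x j ∎
        where open ≡-Reasoning
      off' : ∀ l → lookup ((S [ i ]≔ false) [ k ]≔ true) l ≡ false → ∀ j → φ' l j ≡ 0ℚ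
      off' l e j with k Fin.≟ l
      ... | yes refl with trans (sym (Vec.lookup∘updateAt k (S [ i ]≔ false))) e
      ...   | ()
      off' l e j | no k≢l with i Fin.≟ l
      ... | yes refl = trans (cong (φ i j +_) (trans (sym (*-assoc c r (φ i j))) (cong (_* φ i j) cr))) (lem (φ i j))
        where lem : ∀ x → x + - 1ℚ * x ≡ 0ℚ
              lem = solve-∀ ℚ-ring
      ... | no i≢l = trans (cong₂ (λ a b → a + b * (r * φ i j)) (off l l∉S j) (circuit-off k l l∉S (k≢l ∘ sym))) (trans (cong (0ℚ +_) (*-zeroˡ (r * φ i j))) (+-identityˡ 0ℚ))
        where
        l∉S : lookup S l ≡ false
        l∉S = trans (sym (Vec.lookup∘updateAt′ l i (i≢l ∘ sym) S)) (trans (sym (Vec.lookup∘updateAt′ l k (k≢l ∘ sym) (S [ i ]≔ false))) e)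
      dual' : ∀ l m → lookup ((S [ i ]≔ false) [ k ]≔ true) m ≡ true → dot (φ' l) (ω m) ≡ δ l m
      dual' l m e with k Fin.≟ m
      ... | yes refl = trans (dot' l (ω k)) (lem (dot (φ l) (ω k)) (δ l k) r (dot (φ i) (ω k)) rc)
        where
        rc : r * dot (φ i) (ω k) ≡ 1ℚ
        rc = begin
          r * dot (φ i) (ω k) ≡⟨ lem1 r (dot (φ i) (ω k)) ⟩
          - ((0ℚ - dot (φ i) (ω k)) * r) ≡⟨ cong (λ t → - ((t - dot (φ i) (ω k)) * r)) (sym (δ-≢ i≢k)) ⟩
          - (c * r) ≡⟨ cong -_ cr ⟩
          1ℚ ∎
          where
          open ≡-Reasoning
          lem1 : ∀ r d → r * d ≡ - ((0ℚ - d) * r)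
          lem1 = solve-∀ ℚ-ring
        lem : ∀ d e r f → r * f ≡ 1ℚ → d + r * f * (e - d) ≡ e
        lem d e r f p = trans (cong (λ t → d + t * (e - d)) p) (lem2 d e)
          where lem2 : ∀ d e → d + 1ℚ * (e - d) ≡ e
                lem2 = solve-∀ ℚ-ring
      ... | no k≢m with i Fin.≟ m
      ...   | yes refl with trans (sym e) (trans (Vec.lookup∘updateAt′ i k i≢k (S [ i ]≔ false)) (Vec.lookup∘updateAt i S))
      ...     | ()
      dual' l m e | no k≢m | no i≢m = trans (dot' l (ω m)) (trans (cong₂ (λ a b → a + r * b * y l) (dual l m m∈S) (trans (dual i m m∈S) (δ-≢ i≢m))) (lem (δ l m) r (y l)))
        where
        m∈S : lookup S m ≡ true
        m∈S = trans (sym (Vec.lookup∘updateAt′ m i (i≢m ∘ sym) S)) (trans (sym (Vec.lookup∘updateAt′ m k (k≢m ∘ sym) (S [ i ]≔ false))) e)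
        lem : ∀ a r y → a + r * 0ℚ * y ≡ a
        lem = solve-∀ ℚ-ring
  ratio : ∀ a b → ∃ λ t → b ≢ 0ℚ → t * b ≡ a
  ratio a b with b ≟ 0ℚ
  ... | yes e = 0ℚ , λ ne → contradiction e ne
  ... | no ne with inverse b ne
  ...   | c , bc≡1 = a * c , λ _ → trans (lem a b c) (trans (cong (a *_) bc≡1) (*-identityʳ a))
    where lem : ∀ a b c → a * c * b ≡ a * (b * c)
          lem = solve-∀ ℚ-ring

  -- The weights always represent `x` and never fall lexicographically below `ref`. They need not be
  -- supported on the basis: only the indices in `done` have been brought into it or reduced to
  -- weight zero.
  record Purification {M D} (ω : Fin M → Fin D → ℚ) (x : Fin D → ℚ) (ref : Fin M → ℚ) (done : List (Fin M)) : Set where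
    field
      {S} : Vec Bool M
      basis : Basis ω S
      wt : Fin M → ℚ
      nonneg : ∀ i → 0ℚ ≤ wt i
      rep : ∀ j → comb ω wt j ≡ x j
      better : LexNN (λ i → wt i - ref i)
      covered : ∀ l → l ∈ done → lookup S l ≡ true ⊎ wt l ≡ 0ℚ

  module _ {M D} {ω : Fin M → Fin D → ℚ} (η : Fin D → ℚ) (η-pos : ∀ i → 0ℚ < dot η (ω i))
    {x : Fin D → ℚ} {ref : Fin M → ℚ} where

    -- As `η` is positive on every generator, a nonnegative relation among the generators is zero.
    -- Hence motion along a nonzero relation is always stopped by a decreasing weight.
    kernel-negative : ∀ z → (∀ j → comb ω z j ≡ 0ℚ) → (∃ λ k → z k ≢ 0ℚ) → ∃ λ i → z i < 0ℚ
    kernel-negative z ker (k , zk≢0) with Fin.any? (λ i → z i <? 0ℚ)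
    ... | yes p = p
    ... | no none = contradiction zk≡0 zk≢0
      where
      z≥0 : ∀ i → 0ℚ ≤ z i
      z≥0 i = ≮⇒≥ (λ p → none (i , p))
      terms : ∀ i → 0ℚ ≤ z i * dot η (ω i)
      terms i = 0≤* (z≥0 i) (<⇒≤ (η-pos i))
      total : Σℚ M (λ i → z i * dot η (ω i)) ≡ 0ℚ
      total = trans (sym (dot-comb ω η z)) (Σ-zero D (λ j → trans (cong (η j *_) (ker j)) (*-zeroʳ (η j))))
      zk≡0 : z k ≡ 0ℚ
      zk≡0 = *-cancel-0 (0<⇒≢0 (η-pos k)) (trans (*-comm (dot η (ω k)) (z k))
        (≤-antisym (subst (z k * dot η (ω k) ≤_) total (Σ-term M terms k)) (terms k)))

    -- Either the circuit of `k` or its negative is lexicographically nonnegative. Moving in that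
    -- direction until a weight vanishes does not make the weights worse, and it settles `k`.
    purify-step : ∀ {ks} → Purification ω x ref ks → ∀ k → Purification ω x ref (k ∷ ks)
    purify-step {ks} st k with lookup (Purification.S st) k in ek
    ... | true = record { Purification st ; covered = λ { _ (here refl) → inj₁ ek ; l (there p) → Purification.covered st l p } }
    ... | false = result (lex-total (circuit k))
      where
      open Purification st
      open Basis basis
      module Move (z : Fin M → ℚ) (z-ker : ∀ j → comb ω z j ≡ 0ℚ) (z-lex : LexNN z) (zk≢0 : z k ≢ 0ℚ)
                  (z-off : ∀ l → lookup S l ≡ false → l ≢ k → z l ≡ 0ℚ)
                  (z-circuit : ∀ l → z l ≢ 0ℚ → circuit k l ≢ 0ℚ) where
        -- Ratio test: `t i` is the step at which weight `i` reaches zero. Only indices with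
        -- `z i < 0` are consulted, so the default value of `ratio` for a zero divisor is harmless.
        t : Fin M → ℚ
        t i = proj₁ (ratio (wt i) (- z i))
        t-eq : ∀ i → z i < 0ℚ → t i * (- z i) ≡ wt i
        t-eq i p = proj₂ (ratio (wt i) (- z i)) (0<⇒≢0 (neg-pos-flip p))
        leaving = argmin M (λ i → z i <? 0ℚ) t (kernel-negative z z-ker (k , zk≢0))
        i = proj₁ leaving
        zi<0 = proj₁ (proj₂ leaving)
        τ = t i
        τ≥0 : 0ℚ ≤ τ
        τ≥0 = 0≤*-cancel (neg-pos-flip zi<0) (subst (0ℚ ≤_) (trans (sym (t-eq i zi<0)) (*-comm τ (- z i))) (nonneg i))
        wt' : Fin M → ℚ
        wt' l = wt l + τ * z l
        nonneg' : ∀ l → 0ℚ ≤ wt' l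
        nonneg' l with z l <? 0ℚ
        ... | no p = 0≤+ (nonneg l) (0≤* τ≥0 (≮⇒≥ p))
        ... | yes p = subst (0ℚ ≤_) (trans (lem (t l) τ (z l)) (cong (_+ τ * z l) (t-eq l p)))
                        (0≤* (≤⇒0≤- (proj₂ (proj₂ leaving) l p)) (<⇒≤ (neg-pos-flip p)))
          where lem : ∀ t τ z → (t - τ) * (- z) ≡ t * (- z) + τ * z
                lem = solve-∀ ℚ-ring
        rep' : ∀ j → comb ω wt' j ≡ x j
        rep' j = begin
          comb ω wt' j ≡⟨ comb-add ω wt (λ l → τ * z l) j ⟩
          comb ω wt j + comb ω (λ l → τ * z l) j ≡⟨ cong₂ _+_ (rep j) (comb-* ω τ z j) ⟩
          x j + τ * comb ω z j ≡⟨ cong (λ a → x j + τ * a) (z-ker j) ⟩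
          x j + τ * 0ℚ ≡⟨ cong (x j +_) (*-zeroʳ τ) ⟩
          x j + 0ℚ ≡⟨ +-identityʳ (x j) ⟩
          x j ∎
          where open ≡-Reasoning
        τz-lex : LexNN (λ l → τ * z l)
        τz-lex with <-cmp 0ℚ τ
        ... | tri< p _ _ = lex-* p z-lex
        ... | tri≈ _ e _ = lex-zero (λ l → trans (cong (_* z l) (sym e)) (*-zeroˡ (z l)))
        ... | tri> _ _ p = contradiction (<-≤-trans p τ≥0) (<-irrefl refl)
        better' : LexNN (λ l → wt' l - ref l)
        better' = lex-cong (λ l → lem (wt l) (ref l) (τ * z l)) (lex-add better τz-lex)
          where lem : ∀ a b c → a - b + c ≡ a + c - b
                lem = solve-∀ ℚ-ring
        wt'-off : ∀ l → lookup S l ≡ false → l ≢ k → wt l ≡ 0ℚ → wt' l ≡ 0ℚ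
        wt'-off l l∉S l≢k e = trans (cong₂ (λ a b → a + τ * b) e (z-off l l∉S l≢k)) (trans (+-identityˡ (τ * 0ℚ)) (*-zeroʳ τ))
        wt'i≡0 : wt' i ≡ 0ℚ
        wt'i≡0 = trans (cong (_+ τ * z i) (sym (t-eq i zi<0))) (lem τ (z i))
          where lem : ∀ a b → a * (- b) + a * b ≡ 0ℚ
                lem = solve-∀ ℚ-ring
        -- If `k` itself vanishes first, the basis stays. Otherwise the vanishing index belongs to
        -- `S`, since outside `S` the relation is supported at `k` alone, and `k` takes its place.
        out : Purification ω x ref (k ∷ ks)
        out with i Fin.≟ k
        ... | yes i≡k = record { basis = basis ; wt = wt' ; nonneg = nonneg' ; rep = rep' ; better = better' ; covered = cov }
          where
          cov : ∀ l → l ∈ k ∷ ks → lookup S l ≡ true ⊎ wt' l ≡ 0ℚ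
          cov l p with l Fin.≟ k
          ... | yes refl = inj₂ (subst (λ l → wt' l ≡ 0ℚ) i≡k wt'i≡0)
          cov l (here e) | no l≢k = contradiction e l≢k
          cov l (there p) | no l≢k with lookup S l in el
          ... | true = inj₁ refl
          ... | false with covered l p
          ...   | inj₁ q = contradiction (trans (sym el) q) λ ()
          ...   | inj₂ q = inj₂ (wt'-off l el l≢k q)
        ... | no i≢k = record { basis = pivot i k i∈S ek (z-circuit i (zi≢0)) ; wt = wt' ; nonneg = nonneg' ; rep = rep' ; better = better' ; covered = cov }
          where
          zi≢0 : z i ≢ 0ℚ
          zi≢0 e = <-irrefl e zi<0
          i∈S : lookup S i ≡ true
          i∈S with lookup S i in ei
          ... | true = refl
          ... | false = contradiction (z-off i ei i≢k) zi≢0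
          cov : ∀ l → l ∈ k ∷ ks → lookup ((S [ i ]≔ false) [ k ]≔ true) l ≡ true ⊎ wt' l ≡ 0ℚ
          cov l p with l Fin.≟ k | l Fin.≟ i
          ... | yes refl | _ = inj₁ (Vec.lookup∘updateAt l (S [ i ]≔ false))
          ... | no l≢k | yes refl = inj₂ wt'i≡0
          cov l (here e) | no l≢k | no _ = contradiction e l≢k
          cov l (there p) | no l≢k | no l≢i with lookup S l in el
          ... | true = inj₁ (trans (Vec.lookup∘updateAt′ l k l≢k (S [ i ]≔ false)) (trans (Vec.lookup∘updateAt′ l i l≢i S) el))
          ... | false with covered l p
          ...   | inj₁ q = contradiction (trans (sym el) q) λ ()
          ...   | inj₂ q = inj₂ (wt'-off l el l≢k q)
      result : LexNN (circuit k) ⊎ LexNN (λ l → - circuit k l) → Purification ω x ref (k ∷ ks)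
      result (inj₁ p) = Move.out (circuit k) (circuit-kernel k) p
        (λ e → 1≢0 (trans (sym (circuit-self k ek)) e)) (circuit-off k) (λ _ q → q)
      result (inj₂ p) = Move.out (λ l → - circuit k l) (λ j → trans (comb-neg ω (circuit k) j) (cong -_ (circuit-kernel k j))) p
        (λ e → 1≢0 (trans (sym (circuit-self k ek)) (trans (sym (neg-neg (circuit k k))) (cong -_ e))))
        (λ l l∉S l≢k → cong -_ (circuit-off k l l∉S l≢k)) (λ _ q e → q (cong -_ e))

    purify : ∀ ks → Purification ω x ref [] → Purification ω x ref ks
    purify [] st = st
    purify (k ∷ ks) st = purify-step (purify ks st) k

    -- Once all indices are covered, the weights vanish off the basis and so coincide with the basic
    -- coordinates of `x`.
    purified : Purification ω x ref [] → ∃ λ S → Σ (Basis ω S) λ B → (∀ i → 0ℚ ≤ dot (Basis.φ B i) x) × LexNN (λ i → dot (Basis.φ B i) x - ref i)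
    purified st = _ , basis , (λ i → subst (0ℚ ≤_) (eq i) (nonneg i)) , lex-cong (λ i → cong (_- ref i) (eq i)) better
      where
      open Purification (purify (List.allFin M) st)
      eq : ∀ i → wt i ≡ dot (Basis.φ basis i) x
      eq i = trans (sym (Basis.coord basis wt supp i)) (dot-congʳ (Basis.φ basis i) rep)
        where
        supp : ∀ l → lookup S l ≡ false → wt l ≡ 0ℚ
        supp l e with covered l (∈-allFin l)
        ... | inj₁ q = contradiction (trans (sym e) q) λ ()
        ... | inj₂ q = q

  indicator : Bool → ℚ
  indicator true = 1ℚ
  indicator false = 0ℚ

  Σ-indicator : ∀ {n} (S : Vec Bool n) → Σℚ n (λ i → indicator (lookup S i)) ≡ ℤ→ℚ (⊕ ∣ S ∣)
  Σ-indicator Vec.[] = refl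
  Σ-indicator (true Vec.∷ S) = trans (cong (1ℚ +_) (Σ-indicator S)) (sym (cast-+ (⊕ 1) (⊕ ∣ S ∣)))
  Σ-indicator (false Vec.∷ S) = trans (+-identityˡ (Σℚ _ (λ i → indicator (lookup S i)))) (Σ-indicator S)

  Σ-one : ∀ n → Σℚ n (λ _ → 1ℚ) ≡ ℤ→ℚ (⊕ n)
  Σ-one zero = refl
  Σ-one (suc n) = trans (cong (1ℚ +_) (Σ-one n)) (sym (cast-+ (⊕ 1) (⊕ n)))

  -- Both sides are the trace of the identity x ↦ Σ φ i (x) ω i.
  basis-card : ∀ {M D} {ω : Fin M → Fin D → ℚ} {S} → Basis ω S → ∣ S ∣ ≡ D
  basis-card {M} {D} {ω} {S} B = ℤ.+-injective (cast-injective (begin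
    ℤ→ℚ (⊕ ∣ S ∣) ≡⟨ Σ-indicator S ⟨
    Σℚ M (λ i → indicator (lookup S i)) ≡⟨ Σ-cong M diag ⟨
    Σℚ M (λ i → dot (φ i) (ω i)) ≡⟨ Σ-swap M D (λ i j → φ i j * ω i j) ⟩
    Σℚ D (λ j → Σℚ M (λ i → φ i j * ω i j)) ≡⟨ Σ-cong D (λ j → Σ-cong M (λ i → cong (_* ω i j) (Σ-δʳ D (φ i) j))) ⟨
    Σℚ D (λ j → comb ω (λ i → dot (φ i) (λ l → δ l j)) j) ≡⟨ Σ-cong D (λ j → trans (recon (λ l → δ l j) j) (δ-refl j)) ⟩
    Σℚ D (λ _ → 1ℚ) ≡⟨ Σ-one D ⟩
    ℤ→ℚ (⊕ D) ∎))
    where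
    open ≡-Reasoning
    open Basis B
    diag : ∀ i → dot (φ i) (ω i) ≡ indicator (lookup S i)
    diag i with lookup S i in e
    ... | true = trans (dual i i e) (δ-refl i)
    ... | false = off-dot i e (ω i)
  module _ {M D} (ω : Fin M → Fin D → ℚ) (idx : Fin D → Fin M)
    (indep : ∀ (c : Fin D → ℚ) → (∀ j → Σℚ D (λ k → c k * ω (idx k) j) ≡ 0ℚ) → ∀ k → c k ≡ 0ℚ) where

    -- The unit vector and the `D` given vectors satisfy a relation. Independence forbids that its
    -- coefficient at the unit vector is zero, so it can be solved for the unit vector.
    independent⇒spanning : ∀ j → ∃ λ (ψ : Fin D → ℚ) → ∀ l → Σℚ D (λ k → ψ k * ω (idx k) l) ≡ δ j l
    independent⇒spanning j = (λ k → - r * c (suc k)) , eq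
      where
      A : Fin (suc D) → Fin D → ℚ
      A zero = δ j
      A (suc k) = ω (idx k)
      relation = dependent D A
      c = proj₁ relation
      s : Fin D → ℚ
      s l = Σℚ D (λ k → c (suc k) * ω (idx k) l)
      c-eq : ∀ l → c zero * δ j l + s l ≡ 0ℚ
      c-eq = proj₂ (proj₂ relation)
      c₀≢0 : c zero ≢ 0ℚ
      c₀≢0 e = proj₂ (proj₁ (proj₂ relation)) (all0 (proj₁ (proj₁ (proj₂ relation))))
        where
        all0 : ∀ i → c i ≡ 0ℚ
        all0 zero = e
        all0 (suc k) = indep (λ k → c (suc k)) (λ l → trans (lem (δ j l) (s l)) (trans (cong (λ t → t * δ j l + s l) (sym e)) (c-eq l))) k
          where lem : ∀ d s → s ≡ 0ℚ * d + s
                lem = solve-∀ ℚ-ring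
      r = proj₁ (inverse (c zero) c₀≢0)
      eq : ∀ l → Σℚ D (λ k → - r * c (suc k) * ω (idx k) l) ≡ δ j l
      eq l = begin
        Σℚ D (λ k → - r * c (suc k) * ω (idx k) l) ≡⟨ Σ-cong D (λ k → *-assoc (- r) (c (suc k)) (ω (idx k) l)) ⟩
        Σℚ D (λ k → - r * (c (suc k) * ω (idx k) l)) ≡⟨ Σ-*ˡ D (- r) (λ k → c (suc k) * ω (idx k) l) ⟩
        - r * s l ≡⟨ lem r (s l) (c zero) (δ j l) ⟩
        c zero * r * δ j l - r * (c zero * δ j l + s l) ≡⟨ cong₂ (λ a b → a * δ j l - r * b) (proj₂ (inverse (c zero) c₀≢0)) (c-eq l) ⟩
        1ℚ * δ j l - r * 0ℚ ≡⟨ lem2 (δ j l) r ⟩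
        δ j l ∎
        where
        open ≡-Reasoning
        lem : ∀ r s c d → - r * s ≡ c * r * d - r * (c * d + s)
        lem = solve-∀ ℚ-ring
        lem2 : ∀ d r → 1ℚ * d - r * 0ℚ ≡ d
        lem2 = solve-∀ ℚ-ring

    independent⇒basis : ∃ λ S → Basis ω S
    independent⇒basis = S , record { φ = φ ; recon = recon ; off = off ; dual = dual }
      where
      hit? : ∀ i → Dec (∃ λ k → idx k ≡ i)
      hit? i = Fin.any? (λ k → idx k Fin.≟ i)
      S : Vec Bool M
      S = Vec.tabulate (λ i → does (hit? i))
      ψ : Fin D → Fin D → ℚ
      ψ k j = proj₁ (independent⇒spanning j) k
      -- Transports the dual system `ψ` of the `D` chosen generators along `idx`, with value zero
      -- off its image.
      φ : Fin M → Fin D → ℚ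
      φ i j = Σℚ D (λ k → δ (idx k) i * ψ k j)
      φ-dot : ∀ i x → dot (φ i) x ≡ Σℚ D (λ k → δ (idx k) i * dot (ψ k) x)
      φ-dot i x = begin
        Σℚ D (λ j → Σℚ D (λ k → δ (idx k) i * ψ k j) * x j) ≡⟨ Σ-cong D (λ j → Σ-*ʳ D (x j) (λ k → δ (idx k) i * ψ k j)) ⟨
        Σℚ D (λ j → Σℚ D (λ k → δ (idx k) i * ψ k j * x j)) ≡⟨ Σ-swap D D (λ j k → δ (idx k) i * ψ k j * x j) ⟩
        Σℚ D (λ k → Σℚ D (λ j → δ (idx k) i * ψ k j * x j)) ≡⟨ Σ-cong D (λ k → trans (Σ-cong D (λ j → *-assoc (δ (idx k) i) (ψ k j) (x j))) (Σ-*ˡ D (δ (idx k) i) (λ j → ψ k j * x j))) ⟩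
        Σℚ D (λ k → δ (idx k) i * dot (ψ k) x) ∎
        where open ≡-Reasoning
      ψ-recon : ∀ x l → Σℚ D (λ k → dot (ψ k) x * ω (idx k) l) ≡ x l
      ψ-recon x l = begin
        Σℚ D (λ k → dot (ψ k) x * ω (idx k) l) ≡⟨ Σ-cong D (λ k → Σ-*ʳ D (ω (idx k) l) (λ j → ψ k j * x j)) ⟨
        Σℚ D (λ k → Σℚ D (λ j → ψ k j * x j * ω (idx k) l)) ≡⟨ Σ-swap D D (λ k j → ψ k j * x j * ω (idx k) l) ⟩
        Σℚ D (λ j → Σℚ D (λ k → ψ k j * x j * ω (idx k) l)) ≡⟨ Σ-cong D (λ j → trans (Σ-cong D (λ k → lem (ψ k j) (x j) (ω (idx k) l))) (Σ-*ˡ D (x j) (λ k → ψ k j * ω (idx k) l))) ⟩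
        Σℚ D (λ j → x j * Σℚ D (λ k → ψ k j * ω (idx k) l)) ≡⟨ Σ-cong D (λ j → cong (x j *_) (proj₂ (independent⇒spanning j) l)) ⟩
        Σℚ D (λ j → x j * δ j l) ≡⟨ Σ-δʳ D x l ⟩
        x l ∎
        where
        open ≡-Reasoning
        lem : ∀ a b c → a * b * c ≡ b * (a * c)
        lem = solve-∀ ℚ-ring
      -- `ω (idx k')` is represented by its `ψ`-values and also by the unit weight at `k'`;
      -- independence identifies the two.
      ψ-dual : ∀ k k' → dot (ψ k) (ω (idx k')) ≡ δ k k'
      ψ-dual k k' = begin
        dot (ψ k) (ω (idx k')) ≡⟨ lem (dot (ψ k) (ω (idx k'))) (δ k k') ⟩
        dot (ψ k) (ω (idx k')) - δ k k' + δ k k' ≡⟨ cong (_+ δ k k') (indep (λ k → dot (ψ k) (ω (idx k')) - δ k k') zeros k) ⟩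
        0ℚ + δ k k' ≡⟨ +-identityˡ (δ k k') ⟩
        δ k k' ∎
        where
        open ≡-Reasoning
        lem : ∀ a b → a ≡ a - b + b
        lem = solve-∀ ℚ-ring
        zeros : ∀ j → Σℚ D (λ k → (dot (ψ k) (ω (idx k')) - δ k k') * ω (idx k) j) ≡ 0ℚ
        zeros j = trans (comb-sub (λ k → ω (idx k)) (λ k → dot (ψ k) (ω (idx k'))) (λ k → δ k k') j)
          (trans (cong₂ _-_ (ψ-recon (ω (idx k')) j) (trans (comb-cong (λ k → ω (idx k)) (λ k → δ-sym k k') j) (comb-δ (λ k → ω (idx k)) k' j)))
            (+-inverseʳ (ω (idx k') j)))
      recon : ∀ x j → comb ω (λ i → dot (φ i) x) j ≡ x j
      recon x l = begin
        Σℚ M (λ i → dot (φ i) x * ω i l) ≡⟨ Σ-cong M (λ i → trans (cong (_* ω i l) (φ-dot i x)) (sym (Σ-*ʳ D (ω i l) (λ k → δ (idx k) i * dot (ψ k) x)))) ⟩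
        Σℚ M (λ i → Σℚ D (λ k → δ (idx k) i * dot (ψ k) x * ω i l)) ≡⟨ Σ-swap M D (λ i k → δ (idx k) i * dot (ψ k) x * ω i l) ⟩
        Σℚ D (λ k → Σℚ M (λ i → δ (idx k) i * dot (ψ k) x * ω i l)) ≡⟨ Σ-cong D (λ k → trans (Σ-cong M (λ i → *-assoc (δ (idx k) i) (dot (ψ k) x) (ω i l))) (Σ-δˡ M (λ i → dot (ψ k) x * ω i l) (idx k))) ⟩
        Σℚ D (λ k → dot (ψ k) x * ω (idx k) l) ≡⟨ ψ-recon x l ⟩
        x l ∎
        where open ≡-Reasoning
      off : ∀ i → lookup S i ≡ false → ∀ j → φ i j ≡ 0ℚ
      off i e j with hit? i in eq
      ... | yes _ = contradiction (trans (sym e) (trans (Vec.lookup∘tabulate (λ i → does (hit? i)) i) (cong does eq))) λ ()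
      ... | no ne = Σ-zero D (λ k → trans (cong (_* ψ k j) (δ-≢ (λ p → ne (k , p)))) (*-zeroˡ (ψ k j)))
      dual : ∀ i m → lookup S m ≡ true → dot (φ i) (ω m) ≡ δ i m
      dual i m e with hit? m in eq
      ... | no _ = contradiction (trans (sym e) (trans (Vec.lookup∘tabulate (λ i → does (hit? i)) m) (cong does eq))) λ ()
      ... | yes (k , refl) = begin
        dot (φ i) (ω (idx k)) ≡⟨ φ-dot i (ω (idx k)) ⟩
        Σℚ D (λ k' → δ (idx k') i * dot (ψ k') (ω (idx k))) ≡⟨ Σ-cong D (λ k' → cong (δ (idx k') i *_) (ψ-dual k' k)) ⟩
        Σℚ D (λ k' → δ (idx k') i * δ k' k) ≡⟨ Σ-δʳ D (λ k' → δ (idx k') i) k ⟩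
        δ (idx k) i ≡⟨ δ-sym (idx k) i ⟩
        δ i (idx k) ∎
        where open ≡-Reasoning

-- Lexicographic linear programming and the pulling triangulation.

module Triangulation where

  open import Data.Rational hiding (∣_∣; _/_; pos)
  open import Data.Rational.Properties hiding (_≥?_; _>?_)
  open import Tactic.RingSolver using (solve-∀)
  open Rationals
  open LinearAlgebra

  min-positive : ∀ {s t} → 0ℚ < s → 0ℚ < t → ∃ λ u → 0ℚ < u × u ≤ s × u ≤ t
  min-positive {s} {t} s>0 t>0 with ≤-total s t
  ... | inj₁ s≤t = s , s>0 , ≤-refl , s≤t
  ... | inj₂ t≤s = t , t>0 , t≤s , ≤-refl

  nonneg-shrink : ∀ a b t' {t} → 0ℚ < t → 0ℚ ≤ a → t ≤ t' → 0ℚ ≤ a + t' * b → 0ℚ ≤ a + t * b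
  nonneg-shrink a b t' {t} t>0 a≥0 t≤t' q with 0ℚ ≤? b
  ... | yes r = 0≤+ a≥0 (0≤* (<⇒≤ t>0) r)
  ... | no r = subst (0ℚ ≤_) (lem a b t t') (0≤+ q (0≤* (≤⇒0≤- t≤t') (neg-nonneg-flip (<⇒≤ (≰⇒> r)))))
    where lem : ∀ a b t t' → a + t' * b + (t' - t) * (- b) ≡ a + t * b
          lem = solve-∀ ℚ-ring

  0≤1*+ : ∀ {a b} → 0ℚ ≤ a → 0ℚ ≤ b → 0ℚ ≤ a + 1ℚ * b
  0≤1*+ {a} {b} p q = subst (λ t → 0ℚ ≤ a + t) (sym (*-identityˡ b)) (0≤+ p q)

  positive-step-neg : ∀ {a b c} → 0ℚ < a → 0ℚ < c → - b * c ≡ 1ℚ → ∃ λ t → 0ℚ < t × 0ℚ ≤ a + t * b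
  positive-step-neg {a} {b} {c} a>0 c>0 bc = a * c , 0<* a>0 c>0 , ≤-reflexive (sym eq)
    where
    open ≡-Reasoning
    lem : ∀ a b c → a + a * c * b ≡ a - a * (- b * c)
    lem = solve-∀ ℚ-ring
    lem2 : ∀ a → a - a * 1ℚ ≡ 0ℚ
    lem2 = solve-∀ ℚ-ring
    eq : a + a * c * b ≡ 0ℚ
    eq = begin
      a + a * c * b ≡⟨ lem a b c ⟩
      a - a * (- b * c) ≡⟨ cong (λ t → a - a * t) bc ⟩
      a - a * 1ℚ ≡⟨ lem2 a ⟩
      0ℚ ∎

  positive-step₁ : ∀ a b → 0ℚ < a ⊎ (0ℚ ≤ a × 0ℚ ≤ b) → ∃ λ t → 0ℚ < t × 0ℚ ≤ a + t * b
  positive-step₁ a b (inj₂ (q , r)) = 1ℚ , 0<1 , 0≤1*+ q r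
  positive-step₁ a b (inj₁ q) with 0ℚ ≤? b
  ... | yes r = 1ℚ , 0<1 , 0≤1*+ (<⇒≤ q) r
  ... | no r = positive-step-neg q (proj₁ (proj₂ inv)) (proj₂ (proj₂ inv))
    where
    inv : ∃ λ c → 0ℚ < c × - b * c ≡ 1ℚ
    inv = inverse-pos (neg-pos-flip (≰⇒> r))

  -- A positive entry tolerates any direction for a short time, a vanishing one only an upward
  -- direction; finitely many entries leave a common step length.
  positive-step : ∀ n (a b : Fin n → ℚ) → (∀ i → 0ℚ < a i ⊎ (0ℚ ≤ a i × 0ℚ ≤ b i)) →
    ∃ λ t → 0ℚ < t × (∀ i → 0ℚ ≤ a i + t * b i)
  positive-step zero a b p = 1ℚ , 0<1 , λ ()
  positive-step (suc n) a b p with positive-step₁ (a zero) (b zero) (p zero) | positive-step n (a ∘ suc) (b ∘ suc) (p ∘ suc)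
  ... | t₀ , t₀>0 , bound₀ | t₁ , t₁>0 , bound₁ with min-positive t₀>0 t₁>0
  ...   | t , t>0 , t≤t₀ , t≤t₁ = t , t>0 , bound
    where
    0≤a : ∀ i → 0ℚ ≤ a i
    0≤a i with p i
    ... | inj₁ q = <⇒≤ q
    ... | inj₂ (q , _) = q
    bound : ∀ i → 0ℚ ≤ a i + t * b i
    bound zero = nonneg-shrink (a zero) (b zero) t₀ t>0 (0≤a zero) t≤t₀ bound₀
    bound (suc i) = nonneg-shrink (a (suc i)) (b (suc i)) t₁ t>0 (0≤a (suc i)) t≤t₁ (bound₁ i)

  -- The vector attached to `a` is computed from a witness of `F a`; the independence hypothesis
  -- makes the comparison one between elements `a`.
  lexmax : ∀ {A : Set} {n} (F : A → Set) (F? : ∀ a → Dec (F a)) (v : ∀ a → F a → Fin n → ℚ) →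
    (∀ a f f' i → v a f i ≡ v a f' i) → ∀ xs {a} → a ∈ xs → F a →
    ∃ λ a → Σ (F a) λ f → ∀ a' → a' ∈ xs → ∀ f' → LexNN (λ i → v a f i - v a' f' i)
  lexmax {A} F F? v irr (x ∷ xs) {a} p fa with any? F? xs | F? x
  ... | yes ex | no ¬fx with find ex
  ...   | a₁ , a₁∈ , fa₁ with lexmax F F? v irr xs a₁∈ fa₁
  ...     | b , fb , max = b , fb , λ { _ (here refl) f' → contradiction f' ¬fx ; a' (there q) f' → max a' q f' }
  lexmax {A} F F? v irr (x ∷ xs) {a} p fa | no ¬ex | no ¬fx with p
  ... | here refl = contradiction fa ¬fx
  ... | there q = contradiction (lose q fa) ¬ex
  lexmax {A} F F? v irr (x ∷ xs) {a} p fa | no ¬ex | yes fx = x , fx , λ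
    { _ (here refl) f' → lex-zero (λ i → trans (cong (_- v x f' i) (irr x fx f' i)) (+-inverseʳ (v x f' i)))
    ; a' (there q) f' → contradiction (lose q f') ¬ex }
  lexmax {A} F F? v irr (x ∷ xs) {a} p fa | yes ex | yes fx with find ex
  ... | a₁ , a₁∈ , fa₁ with lexmax F F? v irr xs a₁∈ fa₁
  ...   | b , fb , max with lex-total (λ i → v b fb i - v x fx i)
  ...     | inj₁ q = b , fb , λ
    { _ (here refl) f' → lex-cong (λ i → cong (λ t → v b fb i - t) (irr x fx f' i)) q
    ; a' (there r) f' → max a' r f' }
  ...     | inj₂ q = x , fx , λ
    { _ (here refl) f' → lex-zero (λ i → trans (cong (_- v x f' i) (irr x fx f' i)) (+-inverseʳ (v x f' i)))
    ; a' (there r) f' → lex-cong (λ i → lem (v b fb i) (v x fx i) (v a' f' i)) (lex-add q (max a' r f')) }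
    where lem : ∀ b x a → - (b - x) + (b - a) ≡ x - a
          lem = solve-∀ ℚ-ring

  subsets : ∀ n → List (Vec Bool n)
  subsets zero = Vec.[] ∷ []
  subsets (suc n) = List.map (true Vec.∷_) (subsets n) List.++ List.map (false Vec.∷_) (subsets n)

  ∈-subsets : ∀ {n} (S : Vec Bool n) → S ∈ subsets n
  ∈-subsets Vec.[] = here refl
  ∈-subsets (true Vec.∷ S) = ∈-++⁺ˡ (∈-map⁺ (true Vec.∷_) (∈-subsets S))
  ∈-subsets (false Vec.∷ S) = ∈-++⁺ʳ (List.map (true Vec.∷_) (subsets _)) (∈-map⁺ (false Vec.∷_) (∈-subsets S))

  subsets-unique : ∀ n → Unique (subsets n)
  subsets-unique zero = All.[] AllPairs.∷ AllPairs.[]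
  subsets-unique (suc n) = Unique.++⁺ (Unique.map⁺ (λ { refl → refl }) (subsets-unique n)) (Unique.map⁺ (λ { refl → refl }) (subsets-unique n)) disj
    where
    disj : ∀ {v} → ¬ (v ∈ List.map (true Vec.∷_) (subsets n) × v ∈ List.map (false Vec.∷_) (subsets n))
    disj (p , q) with ∈-map⁻ (true Vec.∷_) p | ∈-map⁻ (false Vec.∷_) q
    ... | _ , _ , refl | _ , _ , ()

  -- Dual feasibility for maximising the weights lexicographically: the bases that satisfy it are the cells of the pulling triangulation.
  LexOptimal : ∀ {M D} → (Fin M → Fin D → ℚ) → Vec Bool M → Set
  LexOptimal ω S = ∀ y → (∀ j → comb ω y j ≡ 0ℚ) → (∀ i → lookup S i ≡ false → 0ℚ ≤ y i) → LexNN (λ i → - y i)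

  module _ {M D} {ω : Fin M → Fin D → ℚ} where

    -- Coordinates depend on `S` alone, by uniqueness of representations, so cells may be indexed by
    -- subsets whatever dual functionals a decision procedure returns.
    basis-irrelevant : ∀ {S} (B B' : Basis ω S) x i → dot (Basis.φ B i) x ≡ dot (Basis.φ B' i) x
    basis-irrelevant B B' x i = trans (dot-congʳ (Basis.φ B i) (λ j → sym (Basis.recon B' x j)))
      (Basis.coord B (λ i → dot (Basis.φ B' i) x) (λ i e → Basis.off-dot B' i e x) i)

    lex-descale : (a y : Fin M → ℚ) (t : ℚ) → 0ℚ < t → LexNN (λ i → a i - (a i + t * y i)) → LexNN (λ i → - y i)
    lex-descale a y t t>0 p with inverse-pos t>0
    ... | s , s>0 , ts = lex-cong eq (lex-* s>0 p)
      where
      open ≡-Reasoning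
      lem : ∀ s a t y → s * (a - (a + t * y)) ≡ - (t * s * y)
      lem = solve-∀ ℚ-ring
      eq : ∀ i → s * (a i - (a i + t * y i)) ≡ - y i
      eq i = begin
        s * (a i - (a i + t * y i)) ≡⟨ lem s (a i) t (y i) ⟩
        - (t * s * y i) ≡⟨ cong (λ u → - (u * y i)) ts ⟩
        - (1ℚ * y i) ≡⟨ cong -_ (*-identityˡ (y i)) ⟩
        - y i ∎

    module _ (η : Fin D → ℚ) (η-λ*>0 : ∀ i → 0ℚ < dot η (ω i)) (basis? : ∀ S → Dec (Basis ω S))
      {S₀} (B₀ : Basis ω S₀) (x : Fin D → ℚ) where

      Represents : (Fin M → ℚ) → Set
      Represents wt = (∀ i → 0ℚ ≤ wt i) × (∀ j → comb ω wt j ≡ x j)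

      Feasible : Vec Bool M → Set
      Feasible S = Σ (Basis ω S) λ B → ∀ i → 0ℚ ≤ dot (Basis.φ B i) x

      feasible? : ∀ S → Dec (Feasible S)
      feasible? S with basis? S
      ... | no ¬B = no (¬B ∘ proj₁)
      ... | yes B with Fin.all? (λ i → 0ℚ ≤? dot (Basis.φ B i) x)
      ...   | yes p = yes (B , p)
      ...   | no ¬p = no (λ { (B' , p) → ¬p (λ i → subst (0ℚ ≤_) (basis-irrelevant B' B x i) (p i)) })

      -- Fundamental theorem of linear programming in lexicographic form. Purification may start
      -- from any basis; `B₀` need not be feasible for `x`.
      vertex-above : ∀ {wt} → Represents wt → ∃ λ S → Σ (Feasible S) λ F → LexNN (λ i → dot (Basis.φ (proj₁ F) i) x - wt i)
      vertex-above {wt} (nn , rp) = pack (purified η η-λ*>0 start)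
        where
        start : Purification ω x wt []
        start = record { basis = B₀ ; wt = wt ; nonneg = nn ; rep = rp
          ; better = lex-zero (λ i → +-inverseʳ (wt i)) ; covered = λ _ () }
        pack : (∃ λ S → Σ (Basis ω S) λ B → (∀ i → 0ℚ ≤ dot (Basis.φ B i) x) × LexNN (λ i → dot (Basis.φ B i) x - wt i)) →
          ∃ λ S → Σ (Feasible S) λ F → LexNN (λ i → dot (Basis.φ (proj₁ F) i) x - wt i)
        pack (S , B , p , q) = S , (B , p) , q

      -- There are finitely many bases and each representation is dominated by a feasible one, so a
      -- maximum over feasible bases is a maximum over all representations.
      maximal-vertex : ∀ {wt} → Represents wt → ∃ λ S → Σ (Feasible S) λ F →
        ∀ wt → Represents wt → LexNN (λ i → dot (Basis.φ (proj₁ F) i) x - wt i)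
      maximal-vertex r = pack (lexmax Feasible feasible? (λ S F i → dot (Basis.φ (proj₁ F) i) x)
          (λ S F F' → basis-irrelevant (proj₁ F) (proj₁ F') x) (subsets M) (∈-subsets _) (proj₁ (proj₂ (vertex-above r))))
        where
        pack : (∃ λ S → Σ (Feasible S) λ F → ∀ S' → S' ∈ subsets M → ∀ F' → LexNN (λ i → dot (Basis.φ (proj₁ F) i) x - dot (Basis.φ (proj₁ F') i) x)) →
          ∃ λ S → Σ (Feasible S) λ F → ∀ wt → Represents wt → LexNN (λ i → dot (Basis.φ (proj₁ F) i) x - wt i)
        pack (S , F , max) = S , F , λ wt r' → above wt (vertex-above r')
          where
          above : ∀ wt → (∃ λ S' → Σ (Feasible S') λ F' → LexNN (λ i → dot (Basis.φ (proj₁ F') i) x - wt i)) →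
            LexNN (λ i → dot (Basis.φ (proj₁ F) i) x - wt i)
          above wt (S' , F' , lx) = lex-cong (λ i → lem (dot (Basis.φ (proj₁ F) i) x) (dot (Basis.φ (proj₁ F') i) x) (wt i)) (lex-add (max S' (∈-subsets S') F') lx)
            where lem : ∀ a b c → a - b + (b - c) ≡ a - c
                  lem = solve-∀ ℚ-ring

      -- Positivity of all basic coordinates excludes degeneracy: a short step along any relation
      -- that is nonnegative off `S` stays feasible, hence cannot be a lexicographic improvement.
      maximal⇒optimal : ∀ {S} (B : Basis ω S) → (∀ i → lookup S i ≡ true → 0ℚ < dot (Basis.φ B i) x) →
        (∀ wt → Represents wt → LexNN (λ i → dot (Basis.φ B i) x - wt i)) → LexOptimal ω S
      maximal⇒optimal {S} B λ*>0 max y ker y-off = finish (positive-step M λ* y cases)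
        where
        λ* : Fin M → ℚ
        λ* i = dot (Basis.φ B i) x
        cases : ∀ i → 0ℚ < λ* i ⊎ (0ℚ ≤ λ* i × 0ℚ ≤ y i)
        cases i with lookup S i in e
        ... | true = inj₁ (λ*>0 i e)
        ... | false = inj₂ (≤-reflexive (sym (Basis.off-dot B i e x)) , y-off i e)
        finish : (∃ λ t → 0ℚ < t × (∀ i → 0ℚ ≤ λ* i + t * y i)) → LexNN (λ i → - y i)
        finish (t , t>0 , nn') = lex-descale λ* y t t>0 (max (λ i → λ* i + t * y i) (nn' , rep'))
          where
          rep' : ∀ j → comb ω (λ i → λ* i + t * y i) j ≡ x j
          rep' j = begin
            comb ω (λ i → λ* i + t * y i) j ≡⟨ comb-add ω λ* (λ i → t * y i) j ⟩
            comb ω λ* j + comb ω (λ i → t * y i) j ≡⟨ cong₂ _+_ (Basis.recon B x j) (comb-* ω t y j) ⟩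
            x j + t * comb ω y j ≡⟨ cong (λ u → x j + t * u) (ker j) ⟩
            x j + t * 0ℚ ≡⟨ cong (x j +_) (*-zeroʳ t) ⟩
            x j + 0ℚ ≡⟨ +-identityʳ (x j) ⟩
            x j ∎
            where open ≡-Reasoning

      optimal-exists : (∀ S (B : Basis ω S) i → lookup S i ≡ true → dot (Basis.φ B i) x ≢ 0ℚ) →
        ∀ {wt} → Represents wt →
        ∃ λ S → Σ (Basis ω S) λ B → LexOptimal ω S × (∀ i → lookup S i ≡ true → 0ℚ < dot (Basis.φ B i) x)
      optimal-exists generic r = finish (maximal-vertex r)
        where
        finish : (∃ λ S → Σ (Feasible S) λ F → ∀ wt → Represents wt → LexNN (λ i → dot (Basis.φ (proj₁ F) i) x - wt i)) →
          ∃ λ S → Σ (Basis ω S) λ B → LexOptimal ω S × (∀ i → lookup S i ≡ true → 0ℚ < dot (Basis.φ B i) x)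
        finish (S , (B , nn) , max) = S , B , maximal⇒optimal B λ*>0 max , λ*>0
          where
          λ*>0 : ∀ i → lookup S i ≡ true → 0ℚ < dot (Basis.φ B i) x
          λ*>0 i e with <-cmp 0ℚ (dot (Basis.φ B i) x)
          ... | tri< p _ _ = p
          ... | tri≈ _ q _ = contradiction (sym q) (generic S B i e)
          ... | tri> _ _ p = contradiction (<-≤-trans p (nn i)) (<-irrefl refl)
  module _ {M D} {ω : Fin M → Fin D → ℚ} where
    -- The difference of the two coordinate vectors of `x` is a relation that is nonnegative off
    -- `S`, and its negative is nonnegative off `S'`. Optimality on both sides forces it to be zero,
    -- and positivity then recovers each subset as the common support.
    optimal-unique : ∀ {S S'} (B : Basis ω S) (B' : Basis ω S') x → LexOptimal ω S → LexOptimal ω S' →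
      (∀ i → lookup S i ≡ true → 0ℚ < dot (Basis.φ B i) x) → (∀ i → lookup S' i ≡ true → 0ℚ < dot (Basis.φ B' i) x) → S ≡ S'
    optimal-unique {S} {S'} B B' x opt opt' pos' pos'' = Vec-ext same
      where
      a b : Fin M → ℚ
      a i = dot (Basis.φ B i) x
      b i = dot (Basis.φ B' i) x
      nonneg : ∀ {S} (B : Basis ω S) → (∀ i → lookup S i ≡ true → 0ℚ < dot (Basis.φ B i) x) → ∀ i → 0ℚ ≤ dot (Basis.φ B i) x
      nonneg {S} B p i with lookup S i in e
      ... | true = <⇒≤ (p i e)
      ... | false = ≤-reflexive (sym (Basis.off-dot B i e x))
      ker : ∀ {S S'} (B : Basis ω S) (B' : Basis ω S') j → comb ω (λ i → dot (Basis.φ B' i) x - dot (Basis.φ B i) x) j ≡ 0ℚ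
      ker B B' j = trans (comb-sub ω (λ i → dot (Basis.φ B' i) x) (λ i → dot (Basis.φ B i) x) j) (trans (cong₂ _-_ (Basis.recon B' x j) (Basis.recon B x j)) (+-inverseʳ (x j)))
      offB : ∀ {S S'} (B : Basis ω S) (B' : Basis ω S') → (∀ i → lookup S' i ≡ true → 0ℚ < dot (Basis.φ B' i) x) → ∀ i → lookup S i ≡ false → 0ℚ ≤ dot (Basis.φ B' i) x - dot (Basis.φ B i) x
      offB B B' p i e = ≤⇒0≤- (subst (_≤ dot (Basis.φ B' i) x) (sym (Basis.off-dot B i e x)) (nonneg B' p i))
      eq : ∀ i → a i ≡ b i
      eq i = begin
        a i ≡⟨ lem (a i) (b i) ⟩
        b i - (b i - a i) ≡⟨ cong (λ t → b i - t) (lex-antisym {y = λ i → b i - a i} nn (opt (λ i → b i - a i) (ker B B') (offB B B' pos'')) i) ⟩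
        b i - 0ℚ ≡⟨ a-0 (b i) ⟩
        b i ∎
        where
        open ≡-Reasoning
        lem : ∀ a b → a ≡ b - (b - a)
        lem = solve-∀ ℚ-ring
        nn : LexNN (λ i → b i - a i)
        nn = lex-cong (λ i → lem2 (a i) (b i)) (opt' (λ i → a i - b i) (ker B' B) (offB B' B pos'))
          where lem2 : ∀ a b → - (a - b) ≡ b - a
                lem2 = solve-∀ ℚ-ring
      same : ∀ i → lookup S i ≡ lookup S' i
      same i with lookup S i in e | lookup S' i in e'
      ... | true | true = refl
      ... | false | false = refl
      ... | true | false = contradiction (trans (eq i) (Basis.off-dot B' i e' x)) (0<⇒≢0 (pos' i e))
      ... | false | true = contradiction (trans (sym (eq i)) (Basis.off-dot B i e x)) (0<⇒≢0 (pos'' i e'))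
      Vec-ext : (∀ i → lookup S i ≡ lookup S' i) → S ≡ S'
      Vec-ext h = trans (sym (Vec.tabulate∘lookup S)) (trans (Vec.tabulate-cong h) (Vec.tabulate∘lookup S'))

  -- If the first generator were missing, its circuit would raise the first weight, which dominates
  -- the lexicographic order. This is why the generator pulled first is an apex of every cell.
  optimal-first : ∀ {M' D} {ω : Fin (suc M') → Fin D → ℚ} {S} (B : Basis ω S) → LexOptimal ω S → lookup S zero ≡ true
  optimal-first {ω = ω} {S} B opt with lookup S zero in e
  ... | true = refl
  ... | false = contradiction (opt (Basis.circuit B zero) (Basis.circuit-kernel B zero) off≥0) bad
    where
    off≥0 : ∀ i → lookup S i ≡ false → 0ℚ ≤ Basis.circuit B zero i
    off≥0 i e' with i Fin.≟ zero
    ... | yes refl = subst (0ℚ ≤_) (sym (Basis.circuit-self B zero e)) (<⇒≤ 0<1)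
    ... | no i≢0 = ≤-reflexive (sym (Basis.circuit-off B zero i e' i≢0))
    bad : ¬ LexNN (λ i → - Basis.circuit B zero i)
    bad (inj₁ p) = contradiction (subst (λ t → 0ℚ < - t) (Basis.circuit-self B zero e) p) (<-asym (neg-antimono-< 0<1))
    bad (inj₂ (p , _)) = contradiction (subst (λ t → - t ≡ 0ℚ) (Basis.circuit-self B zero e) p) λ ()

-- Generic perturbations that are small against all denominators.

module Perturbation where

  open import Data.Rational hiding (∣_∣; _/_; pos)
  open import Data.Rational.Properties hiding (_≥?_; _>?_)
  open import Tactic.RingSolver using (solve-∀)
  open Rationals
  open LinearAlgebra
  open Triangulation using (min-positive)

  castVec : ∀ {n} → Vec ℤ n → Fin n → ℚ
  castVec x j = ℤ→ℚ (lookup x j)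

  positive-shrink : ∀ α β t' {t} → 0ℚ < t → 0ℚ < β → t ≤ t' → 0ℚ < β + t' * α → 0ℚ < β + t * α
  positive-shrink α β t' {t} t>0 β>0 t≤t' q with 0ℚ ≤? α
  ... | yes r = 0<+≤ β>0 (0≤* (<⇒≤ t>0) r)
  ... | no r = subst (0ℚ <_) (lem α β t t') (0<+≤ q (0≤* (≤⇒0≤- t≤t') (neg-nonneg-flip (<⇒≤ (≰⇒> r)))))
    where lem : ∀ a b t t' → b + t' * a + (t' - t) * (- a) ≡ b + t * a
          lem = solve-∀ ℚ-ring

  -- The bound `|t α| < β`, kept as two linear inequalities to avoid an absolute value.
  Below : ℚ → ℚ × ℚ → Set
  Below t (α , β) = 0ℚ < β + t * α × 0ℚ < β + t * (- α)

  below-shrink : ∀ {s t} p → 0ℚ < proj₂ p → 0ℚ < t → t ≤ s → Below s p → Below t p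
  below-shrink {s} (α , β) β>0 t>0 t≤s (q , r) = positive-shrink α β s t>0 β>0 t≤s q , positive-shrink (- α) β s t>0 β>0 t≤s r

  below-one : ∀ p → 0ℚ < proj₂ p → ∃ λ t → 0ℚ < t × Below t p
  below-one (α , β) β>0 = pick (abs α)
    where
    abs : ∀ α → ∃ λ s → 0ℚ ≤ s × 0ℚ ≤ s - α × 0ℚ ≤ s + α
    abs α with ≤-total 0ℚ α
    ... | inj₁ p = α , p , ≤-reflexive (sym (+-inverseʳ α)) , 0≤+ p p
    ... | inj₂ p = - α , neg-nonneg-flip p , 0≤+ (neg-nonneg-flip p) (neg-nonneg-flip p) , ≤-reflexive (sym (+-inverseˡ α))
    finish : ∀ s c → 0ℚ < c → (1ℚ + s) * c ≡ 1ℚ → 0ℚ ≤ s - α → 0ℚ ≤ s + α → ∃ λ t → 0ℚ < t × Below t (α , β)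
    -- The witness is `β / (1 + s)`, where `s` is a bound for `|α|`.
    finish s c c>0 e u v = β * c , bc>0 , subst (0ℚ <_) (eq α) (0<* bc>0 (0<+≤ 0<1 v)) , subst (0ℚ <_) (eq (- α)) (0<* bc>0 (0<+≤ 0<1 u))
      where
      open ≡-Reasoning
      bc>0 = 0<* β>0 c>0
      lem : ∀ a s b c → b * c * (1ℚ + (s + a)) ≡ b * ((1ℚ + s) * c) + b * c * a
      lem = solve-∀ ℚ-ring
      eq : ∀ a → β * c * (1ℚ + (s + a)) ≡ β + β * c * a
      eq a = begin
        β * c * (1ℚ + (s + a)) ≡⟨ lem a s β c ⟩
        β * ((1ℚ + s) * c) + β * c * a ≡⟨ cong (λ t → β * t + β * c * a) e ⟩
        β * 1ℚ + β * c * a ≡⟨ cong (_+ β * c * a) (*-identityʳ β) ⟩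
        β + β * c * a ∎
    pick : (∃ λ s → 0ℚ ≤ s × 0ℚ ≤ s - α × 0ℚ ≤ s + α) → ∃ λ t → 0ℚ < t × Below t (α , β)
    pick (s , s≥0 , u , v) = go (inverse-pos (0<+≤ 0<1 s≥0))
      where
      go : (∃ λ c → 0ℚ < c × (1ℚ + s) * c ≡ 1ℚ) → ∃ λ t → 0ℚ < t × Below t (α , β)
      go (c , c>0 , e) = finish s c c>0 e u v

  uniformly : ∀ {A : Set} (P : A → ℚ → Set) → (∀ a {s t} → 0ℚ < t → t ≤ s → P a s → P a t) →
    (∀ a → ∃ λ t → 0ℚ < t × P a t) → ∀ L → ∃ λ t → 0ℚ < t × All (λ a → P a t) L
  uniformly P down one [] = 1ℚ , 0<1 , []
  uniformly {A} P down one (a ∷ L) = join (one a) (uniformly P down one L)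
    where
    join : (∃ λ t → 0ℚ < t × P a t) → (∃ λ t → 0ℚ < t × All (λ a → P a t) L) → ∃ λ t → 0ℚ < t × All (λ a → P a t) (a ∷ L)
    join (s , s>0 , ps) (t , t>0 , pt) = shrink (min-positive s>0 t>0)
      where
      shrink : (∃ λ u → 0ℚ < u × u ≤ s × u ≤ t) → ∃ λ t → 0ℚ < t × All (λ a → P a t) (a ∷ L)
      shrink (u , u>0 , u≤s , u≤t) = u , u>0 , down a u>0 u≤s ps ∷ All.map (λ {b} → down b u>0 u≤t) pt

  dot-zero : ∀ {n} (ψ : Fin n → ℚ) → (∀ j → ψ j ≡ 0ℚ) → ∀ u → dot ψ u ≡ 0ℚ
  dot-zero {n} ψ e u = Σ-zero n (λ j → trans (cong (_* u j) (e j)) (*-zeroˡ (u j)))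

  Nonzero : ∀ {n} → (Fin n → ℚ) → Set
  Nonzero ψ = ∃ λ u → dot ψ u ≢ 0ℚ

  cast-↧ : ∀ a → ℤ→ℚ (↧ a) * a ≡ ℤ→ℚ (↥ a)
  cast-↧ a = toℚᵘ-injective (ℚᵘ.≃-trans (toℚᵘ-homo-* (ℤ→ℚ (↧ a)) a) (ℚᵘ.≃-trans (ℚᵘ.*-cong (cast-toℚᵘ (↧ a)) (ℚᵘ.≃-reflexive (split a)))
    (ℚᵘ.≃-trans (ℚᵘ.*≡* lem) (ℚᵘ.≃-sym (cast-toℚᵘ (↥ a))))))
    where
    split : ∀ a → toℚᵘ a ≡ ℚᵘ.mkℚᵘ (↥ a) (ℚ.denominator-1 a)
    split (mkℚ _ _ _) = refl
    lem : (↧ a ℤ.* ↥ a) ℤ.* ⊕ 1 ≡ ↥ a ℤ.* (⊕ 1 ℤ.* ↧ a)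
    lem = trans (ℤ.*-identityʳ (↧ a ℤ.* ↥ a)) (trans (ℤ.*-comm (↧ a) (↥ a)) (cong (↥ a ℤ.*_) (sym (ℤ.*-identityˡ (↧ a)))))

  IntegralMultiple : ∀ {n} → ℤ → (Fin n → ℚ) → Set
  IntegralMultiple N ψ = ∀ x → ∃ λ z → ℤ→ℚ N * dot ψ (castVec x) ≡ ℤ→ℚ z

  denominator : ∀ {n} (ψ : Fin n → ℚ) → ∃ λ N → 0ℚ < ℤ→ℚ N × IntegralMultiple N ψ
  denominator {zero} ψ = ⊕ 1 , 0<1 , λ _ → ⊕ 0 , *-zeroʳ 1ℚ
  denominator {suc n} ψ = combine (denominator (λ j → ψ (suc j)))
    where
    a = ψ zero
    combine : (∃ λ N → 0ℚ < ℤ→ℚ N × IntegralMultiple N (λ j → ψ (suc j))) → ∃ λ N → 0ℚ < ℤ→ℚ N × IntegralMultiple N ψ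
    combine (N , N>0 , int) = ↧ a ℤ.* N , subst (0ℚ <_) (sym (cast-* (↧ a) N)) (0<* d>0 N>0) , total
      where
      d>0 : 0ℚ < ℤ→ℚ (↧ a)
      d>0 = cast-mono-< {⊕ 0} {↧ a} (ℤ.+<+ (ℕ.s≤s ℕ.z≤n))
      total : IntegralMultiple (↧ a ℤ.* N) ψ
      total (x₀ Vec.∷ x) = with-tail (int x)
        where
        r = dot (λ j → ψ (suc j)) (castVec x)
        with-tail : (∃ λ z → ℤ→ℚ N * r ≡ ℤ→ℚ z) → ∃ λ z → ℤ→ℚ (↧ a ℤ.* N) * (a * ℤ→ℚ x₀ + r) ≡ ℤ→ℚ z
        with-tail (z , e) = ↥ a ℤ.* (N ℤ.* x₀) ℤ.+ ↧ a ℤ.* z , eq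
          where
          open ≡-Reasoning
          lem : ∀ d N a x r → d * N * (a * x + r) ≡ d * a * (N * x) + d * (N * r)
          lem = solve-∀ ℚ-ring
          eq : ℤ→ℚ (↧ a ℤ.* N) * (a * ℤ→ℚ x₀ + r) ≡ ℤ→ℚ (↥ a ℤ.* (N ℤ.* x₀) ℤ.+ ↧ a ℤ.* z)
          eq = begin
            ℤ→ℚ (↧ a ℤ.* N) * (a * ℤ→ℚ x₀ + r) ≡⟨ cong (_* (a * ℤ→ℚ x₀ + r)) (cast-* (↧ a) N) ⟩
            ℤ→ℚ (↧ a) * ℤ→ℚ N * (a * ℤ→ℚ x₀ + r) ≡⟨ lem (ℤ→ℚ (↧ a)) (ℤ→ℚ N) a (ℤ→ℚ x₀) r ⟩
            ℤ→ℚ (↧ a) * a * (ℤ→ℚ N * ℤ→ℚ x₀) + ℤ→ℚ (↧ a) * (ℤ→ℚ N * r) ≡⟨ cong₂ (λ u v → u * (ℤ→ℚ N * ℤ→ℚ x₀) + ℤ→ℚ (↧ a) * v) (cast-↧ a) e ⟩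
            ℤ→ℚ (↥ a) * (ℤ→ℚ N * ℤ→ℚ x₀) + ℤ→ℚ (↧ a) * ℤ→ℚ z ≡⟨ cong₂ _+_ (trans (cast-* (↥ a) (N ℤ.* x₀)) (cong (ℤ→ℚ (↥ a) *_) (cast-* N x₀))) (cast-* (↧ a) z) ⟨
            ℤ→ℚ (↥ a ℤ.* (N ℤ.* x₀)) + ℤ→ℚ (↧ a ℤ.* z) ≡⟨ cast-+ (↥ a ℤ.* (N ℤ.* x₀)) (↧ a ℤ.* z) ⟨
            ℤ→ℚ (↥ a ℤ.* (N ℤ.* x₀) ℤ.+ ↧ a ℤ.* z) ∎
  square-pos : ∀ b → b ≢ 0ℚ → 0ℚ < b * b
  square-pos b ne with <-cmp 0ℚ b
  ... | tri< p _ _ = 0<* p p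
  ... | tri≈ _ q _ = contradiction (sym q) ne
  ... | tri> _ _ p = subst (0ℚ <_) (lem b) (0<* (neg-pos-flip p) (neg-pos-flip p))
    where lem : ∀ b → - b * - b ≡ b * b
          lem = solve-∀ ℚ-ring

  -- The pair encodes b (b + t a) = b² + t a b > 0, whence b + t a ≠ 0.
  avoid : ∀ a b → ∃ λ t → 0ℚ < t × (b ≢ 0ℚ → Below t (b * a , b * b))
  avoid a b with b ≟ 0ℚ
  ... | yes z = 1ℚ , 0<1 , λ ne → contradiction z ne
  ... | no ne = pack (below-one (b * a , b * b) (square-pos b ne))
    where
    pack : (∃ λ t → 0ℚ < t × Below t (b * a , b * b)) → ∃ λ t → 0ℚ < t × (b ≢ 0ℚ → Below t (b * a , b * b))
    pack (t , t>0 , h) = t , t>0 , λ _ → h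

  avoids : ∀ {t} a b → Below t (b * a , b * b) → b + t * a ≢ 0ℚ
  avoids {t} a b (h , _) z = 0<⇒≢0 h eq
    where
    open ≡-Reasoning
    lem : ∀ a b t → b * b + t * (b * a) ≡ b * (b + t * a)
    lem = solve-∀ ℚ-ring
    eq : b * b + t * (b * a) ≡ 0ℚ
    eq = begin
      b * b + t * (b * a) ≡⟨ lem a b t ⟩
      b * (b + t * a) ≡⟨ cong (b *_) z ⟩
      b * 0ℚ ≡⟨ *-zeroʳ b ⟩
      0ℚ ∎

  Generic : ∀ {n} → (Fin n → ℚ) → (Fin n → ℚ) → Set
  Generic q ψ = Nonzero ψ → dot ψ q ≢ 0ℚ

  generic-shift : ∀ {n} (L : List (Fin n → ℚ)) q e → All (Generic q) L → ∃ λ t → 0ℚ < t × All (Generic (λ i → q i + t * e i)) L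
  generic-shift {n} L q e gen = pack (uniformly (λ ψ t → dot ψ q ≢ 0ℚ → Below t (pair ψ)) down (λ ψ → avoid (dot ψ e) (dot ψ q)) L)
    where
    pair : (Fin n → ℚ) → ℚ × ℚ
    pair ψ = dot ψ q * dot ψ e , dot ψ q * dot ψ q
    down : ∀ ψ {s t} → 0ℚ < t → t ≤ s → (dot ψ q ≢ 0ℚ → Below s (pair ψ)) → dot ψ q ≢ 0ℚ → Below t (pair ψ)
    down ψ t>0 t≤s h ne = below-shrink (pair ψ) (square-pos (dot ψ q) ne) t>0 t≤s (h ne)
    pack : (∃ λ t → 0ℚ < t × All (λ ψ → dot ψ q ≢ 0ℚ → Below t (pair ψ)) L) → ∃ λ t → 0ℚ < t × All (Generic (λ i → q i + t * e i)) L
    pack (t , t>0 , hs) = t , t>0 , All.zipWith (λ { {ψ} (g , h) → use ψ g h }) (gen , hs)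
      where
      use : ∀ ψ → Generic q ψ → (dot ψ q ≢ 0ℚ → Below t (pair ψ)) → Generic (λ i → q i + t * e i) ψ
      use ψ g h nz z = avoids {t} (dot ψ e) (dot ψ q) (h (g nz)) (trans (sym (trans (dot-addʳ ψ q (λ i → t * e i)) (cong (dot ψ q +_) (dot-*ʳ t ψ e)))) z)

  -- Functionals are treated one at a time. If `ψ` vanishes at `q`, a small multiple of a unit
  -- vector on which `ψ` is nonzero is added, small enough to keep the functionals already treated
  -- nonzero.
  generic-vector : ∀ {n} (L : List (Fin n → ℚ)) → ∃ λ q → All (Generic q) L
  generic-vector [] = (λ _ → 0ℚ) , []
  generic-vector {n} (ψ ∷ L) = extend (generic-vector L)
    where
    extend : (∃ λ q → All (Generic q) L) → ∃ λ q → All (Generic q) (ψ ∷ L)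
    extend (q , gen) with dot ψ q ≟ 0ℚ | Fin.any? (λ j → ¬? (ψ j ≟ 0ℚ))
    ... | no ne | _ = q , (λ _ → ne) ∷ gen
    ... | yes _ | no none = q , (λ { (u , ne) → contradiction (dot-zero ψ (λ j → decidable-stable (ψ j ≟ 0ℚ) (λ ne → none (j , ne))) u) ne }) ∷ gen
    ... | yes ψq≡0 | yes (j , ψj≢0) = shifted (generic-shift L q (λ i → δ i j) gen)
      where
      shifted : (∃ λ t → 0ℚ < t × All (Generic (λ i → q i + t * δ i j)) L) → ∃ λ q → All (Generic q) (ψ ∷ L)
      shifted (t , t>0 , hs) = (λ i → q i + t * δ i j) , (λ _ z → ψj≢0 (*-cancel-0 (0<⇒≢0 t>0) (trans (sym value) z))) ∷ hs
        where
        open ≡-Reasoning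
        value : dot ψ (λ i → q i + t * δ i j) ≡ t * ψ j
        value = begin
          dot ψ (λ i → q i + t * δ i j) ≡⟨ dot-addʳ ψ q (λ i → t * δ i j) ⟩
          dot ψ q + dot ψ (λ i → t * δ i j) ≡⟨ cong₂ _+_ ψq≡0 (dot-*ʳ t ψ (λ i → δ i j)) ⟩
          0ℚ + t * dot ψ (λ i → δ i j) ≡⟨ +-identityˡ (t * dot ψ (λ i → δ i j)) ⟩
          t * dot ψ (λ i → δ i j) ≡⟨ cong (t *_) (Σ-δʳ n ψ j) ⟩
          t * ψ j ∎

  uniformly-below : ∀ {A : Set} (α β : A → ℚ) → ∀ L → ∃ λ t → 0ℚ < t × All (λ a → Below t (α a , 1ℚ) × Below t (β a , 1ℚ)) L
  uniformly-below α β = uniformly (λ a t → Below t (α a , 1ℚ) × Below t (β a , 1ℚ)) down one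
    where
    down : ∀ a {s t} → 0ℚ < t → t ≤ s → Below s (α a , 1ℚ) × Below s (β a , 1ℚ) → Below t (α a , 1ℚ) × Below t (β a , 1ℚ)
    down a t>0 t≤s (p , q) = below-shrink (α a , 1ℚ) 0<1 t>0 t≤s p , below-shrink (β a , 1ℚ) 0<1 t>0 t≤s q
    one : ∀ a → ∃ λ t → 0ℚ < t × Below t (α a , 1ℚ) × Below t (β a , 1ℚ)
    one a = join (below-one (α a , 1ℚ) 0<1) (below-one (β a , 1ℚ) 0<1)
      where
      join : (∃ λ t → 0ℚ < t × Below t (α a , 1ℚ)) → (∃ λ t → 0ℚ < t × Below t (β a , 1ℚ)) → ∃ λ t → 0ℚ < t × Below t (α a , 1ℚ) × Below t (β a , 1ℚ)
      join (s , s>0 , ps) (t , t>0 , pt) = shrink (min-positive s>0 t>0)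
        where
        shrink : (∃ λ u → 0ℚ < u × u ≤ s × u ≤ t) → ∃ λ t → 0ℚ < t × Below t (α a , 1ℚ) × Below t (β a , 1ℚ)
        shrink (u , u>0 , u≤s , u≤t) = u , u>0 , below-shrink (α a , 1ℚ) 0<1 u>0 u≤s ps , below-shrink (β a , 1ℚ) 0<1 u>0 u≤t pt

  -- To be read with `a` the coordinate of a lattice point and `v` that of the shift: ties at zero
  -- are broken, a positive sum comes from a nonnegative `a`, and a positive `a` survives the shift
  -- in both directions.
  Separated : ℚ → ℚ → Set
  Separated a v = a + v ≢ 0ℚ × (0ℚ < a + v → 0ℚ ≤ a) × (0ℚ < a → 0ℚ < a + v × 0ℚ < a - v)

  -- `N a` is an integer and `N v` lies strictly between -1 and 1, so `v` cannot carry `a` across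
  -- zero; at `a = 0` the hypothesis `v ≢ 0ℚ` decides.
  separated : ∀ {N a v : ℚ} → 0ℚ < N → (∃ λ z → N * a ≡ ℤ→ℚ z) → v ≢ 0ℚ → 0ℚ < 1ℚ + N * v → 0ℚ < 1ℚ - N * v → Separated a v
  separated {N} {a} {v} N>0 (z , e) v≢0 lo hi = nz , weak , strict
    where
    open ≡-Reasoning
    z>-1 : 0ℚ < ℤ→ℚ z + 1ℚ → 0ℚ ≤ a
    z>-1 p = 0≤*-cancel N>0 (subst (0ℚ ≤_) (sym e) (cast-mono-≤ z≥0))
      where
      z≥0 : ⊕ 0 ℤ.≤ z
      z≥0 = subst (⊕ 0 ℤ.≤_) (trans (cong ℤ.pred (ℤ.+-comm z (⊕ 1))) (ℤ.pred-suc z))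
        (ℤ.i<j⇒i≤pred[j] {⊕ 0} {z ℤ.+ ⊕ 1} (cast-cancel-< (subst (0ℚ <_) (sym (cast-+ z (⊕ 1))) p)))
    weak : 0ℚ < a + v → 0ℚ ≤ a
    weak p = z>-1 (subst (0ℚ <_) (trans (lem N a v) (cong (_+ 1ℚ) e)) (0<+≤ (0<* N>0 p) (<⇒≤ hi)))
      where lem : ∀ N a v → N * (a + v) + (1ℚ - N * v) ≡ N * a + 1ℚ
            lem = solve-∀ ℚ-ring
    strict : 0ℚ < a → 0ℚ < a + v × 0ℚ < a - v
    strict p = 0<*-cancel N>0 (subst (0ℚ <_) (lem₁ N a v) (0≤+< z-1≥0 lo)) , 0<*-cancel N>0 (subst (0ℚ <_) (lem₂ N a v) (0≤+< z-1≥0 hi))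
      where
      z>0 : ⊕ 0 ℤ.< z
      z>0 = cast-cancel-< (subst (0ℚ <_) e (0<* N>0 p))
      z-1≥0 : 0ℚ ≤ N * a - 1ℚ
      z-1≥0 = ≤⇒0≤- (subst (1ℚ ≤_) (sym e) (cast-mono-≤ (ℤ.i<j⇒suc[i]≤j z>0)))
      lem₁ : ∀ N a v → N * a - 1ℚ + (1ℚ + N * v) ≡ N * (a + v)
      lem₁ = solve-∀ ℚ-ring
      lem₂ : ∀ N a v → N * a - 1ℚ + (1ℚ - N * v) ≡ N * (a - v)
      lem₂ = solve-∀ ℚ-ring
    nz : a + v ≢ 0ℚ
    nz q with <-cmp 0ℚ a
    ... | tri< p _ _ = 0<⇒≢0 (proj₁ (strict p)) q
    ... | tri≈ _ p _ = v≢0 (trans (sym (trans (cong (_+ v) (sym p)) (+-identityˡ v))) q)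
    ... | tri> _ _ p = contradiction (<-≤-trans p (z>-1 (subst (0ℚ <_) eq hi))) (<-irrefl refl)
      where
      lem : ∀ N a v → 1ℚ - N * v ≡ N * a + 1ℚ - N * (a + v)
      lem = solve-∀ ℚ-ring
      lem2 : ∀ z N → z + 1ℚ - N * 0ℚ ≡ z + 1ℚ
      lem2 = solve-∀ ℚ-ring
      eq : 1ℚ - N * v ≡ ℤ→ℚ z + 1ℚ
      eq = begin
        1ℚ - N * v ≡⟨ lem N a v ⟩
        N * a + 1ℚ - N * (a + v) ≡⟨ cong₂ (λ s t → s + 1ℚ - N * t) e q ⟩
        ℤ→ℚ z + 1ℚ - N * 0ℚ ≡⟨ lem2 (ℤ→ℚ z) N ⟩
        ℤ→ℚ z + 1ℚ ∎

  Gap : ∀ {n} → (Fin n → ℚ) → (Fin n → ℚ) → Set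
  Gap p ψ = ∀ x → Separated (dot ψ (castVec x)) (dot ψ p)

  -- The `small` fields state `|ψ q| < 1`. They keep `ψ` positive on `g + q` and on `g - q` whenever
  -- `ψ` takes a value of at least 1 at `g`.
  record Perturbed {n} (g : Vec ℤ n) (ε : ℚ) (q ψ : Fin n → ℚ) : Set where
    field
      gap₊ : Nonzero ψ → Gap (λ j → ε * (castVec g j + q j)) ψ
      gap₋ : Nonzero ψ → Gap (λ j → ε * (castVec g j - q j)) ψ
      small₊ : 0ℚ < 1ℚ + dot ψ q
      small₋ : 0ℚ < 1ℚ - dot ψ q

  -- Two scales are needed. With `q = δ q₀` and `δ` small, `ψ (g ± q)` is nonzero: by integrality if
  -- `ψ g` is nonzero, by genericity of `q₀` if it is zero. Only then can `ε` be chosen against the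
  -- denominators of these values' functionals.
  perturbation : ∀ {n} (L : List (Fin n → ℚ)) (g : Vec ℤ n) → ∃ λ ε → ∃ λ q → 0ℚ < ε × All (Perturbed g ε q) L
  perturbation {n} L g = stage₁ (generic-vector L)
    where
    Goal = ∃ λ ε → ∃ λ q → 0ℚ < ε × All (Perturbed g ε q) L
    N : (Fin n → ℚ) → ℤ
    N ψ = proj₁ (denominator ψ)
    stage₃ : ∀ q₀ δ ε → 0ℚ < δ → 0ℚ < ε → ∀ ψ → Generic q₀ ψ →
      ∀ N → 0ℚ < ℤ→ℚ N → IntegralMultiple N ψ →
      Below δ (ℤ→ℚ N * dot ψ q₀ , 1ℚ) × Below δ (dot ψ q₀ , 1ℚ) →
      Below ε (ℤ→ℚ N * (dot ψ (castVec g) + δ * dot ψ q₀) , 1ℚ) × Below ε (ℤ→ℚ N * (dot ψ (castVec g) - δ * dot ψ q₀) , 1ℚ) →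
      Perturbed g ε (λ j → δ * q₀ j) ψ
    stage₃ q₀ δ ε δ>0 ε>0 ψ gen N N>0 int ((lo , hi) , (lo' , hi')) ((a , b) , (a' , b')) = record
      { gap₊ = λ nz x → separated N>0 (int x) (λ e → proj₁ (sep₊ nz) (*-cancel-0 (0<⇒≢0 ε>0) (trans (sym dot₊) e)))
          (subst (0ℚ <_) (trans (lem₁ ε N' (c + δb)) (cong (λ t → 1ℚ + N' * t) (sym dot₊))) a)
          (subst (0ℚ <_) (trans (lem₂ ε N' (c + δb)) (cong (λ t → 1ℚ - N' * t) (sym dot₊))) b)
      ; gap₋ = λ nz x → separated N>0 (int x) (λ e → proj₁ (sep₋ nz) (*-cancel-0 (0<⇒≢0 ε>0) (trans (sym dot₋) e)))
          (subst (0ℚ <_) (trans (lem₁ ε N' (c - δb)) (cong (λ t → 1ℚ + N' * t) (sym dot₋))) a')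
          (subst (0ℚ <_) (trans (lem₂ ε N' (c - δb)) (cong (λ t → 1ℚ - N' * t) (sym dot₋))) b')
      ; small₊ = subst (λ t → 0ℚ < 1ℚ + t) (sym dotq) lo'
      ; small₋ = subst (0ℚ <_) (trans (lem₃ δ (dot ψ q₀)) (cong (λ t → 1ℚ - t) (sym dotq))) hi' }
      where
      N' = ℤ→ℚ N
      c = dot ψ (castVec g)
      δb = δ * dot ψ q₀
      dotq : dot ψ (λ j → δ * q₀ j) ≡ δb
      dotq = dot-*ʳ δ ψ q₀
      dot₊ : dot ψ (λ j → ε * (castVec g j + δ * q₀ j)) ≡ ε * (c + δb)
      dot₊ = trans (dot-*ʳ ε ψ (λ j → castVec g j + δ * q₀ j)) (cong (ε *_) (trans (dot-addʳ ψ (castVec g) (λ j → δ * q₀ j)) (cong (c +_) dotq)))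
      dot₋ : dot ψ (λ j → ε * (castVec g j - δ * q₀ j)) ≡ ε * (c - δb)
      dot₋ = trans (dot-*ʳ ε ψ (λ j → castVec g j - δ * q₀ j)) (cong (ε *_) (trans (dot-subʳ ψ (castVec g) (λ j → δ * q₀ j)) (cong (λ t → c - t) dotq)))
      lem₁ : ∀ e N v → 1ℚ + e * (N * v) ≡ 1ℚ + N * (e * v)
      lem₁ = solve-∀ ℚ-ring
      lem₂ : ∀ e N v → 1ℚ + e * - (N * v) ≡ 1ℚ - N * (e * v)
      lem₂ = solve-∀ ℚ-ring
      lem₃ : ∀ d b → 1ℚ + d * - b ≡ 1ℚ - d * b
      lem₃ = solve-∀ ℚ-ring
      lem₄ : ∀ d N b → 1ℚ + d * (N * b) ≡ 1ℚ - N * - (d * b)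
      lem₄ = solve-∀ ℚ-ring
      lem₅ : ∀ d N b → 1ℚ + d * - (N * b) ≡ 1ℚ + N * - (d * b)
      lem₅ = solve-∀ ℚ-ring
      δb≢0 : Nonzero ψ → δb ≢ 0ℚ
      δb≢0 nz e = gen nz (*-cancel-0 (0<⇒≢0 δ>0) e)
      sep₊ : Nonzero ψ → Separated c δb
      sep₊ nz = separated N>0 (int g) (δb≢0 nz) (subst (0ℚ <_) (lem₁ δ N' (dot ψ q₀)) lo) (subst (0ℚ <_) (lem₂ δ N' (dot ψ q₀)) hi)
      sep₋ : Nonzero ψ → Separated c (- δb)
      sep₋ nz = separated N>0 (int g) (λ e → δb≢0 nz (trans (sym (neg-neg δb)) (cong -_ e))) (subst (0ℚ <_) (lem₅ δ N' (dot ψ q₀)) hi) (subst (0ℚ <_) (lem₄ δ N' (dot ψ q₀)) lo)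
    stage₂ : ∀ q₀ → All (Generic q₀) L → ∀ δ → 0ℚ < δ →
      All (λ ψ → Below δ (ℤ→ℚ (N ψ) * dot ψ q₀ , 1ℚ) × Below δ (dot ψ q₀ , 1ℚ)) L → 
      (∃ λ ε → 0ℚ < ε × All (λ ψ → Below ε (ℤ→ℚ (N ψ) * (dot ψ (castVec g) + δ * dot ψ q₀) , 1ℚ) × Below ε (ℤ→ℚ (N ψ) * (dot ψ (castVec g) - δ * dot ψ q₀) , 1ℚ)) L) → Goal
    stage₂ q₀ gen δ δ>0 bs (ε , ε>0 , cs) = ε , (λ j → δ * q₀ j) , ε>0 ,
      All.zipWith (λ { {ψ} (h , b , c) → stage₃ q₀ δ ε δ>0 ε>0 ψ h (N ψ) (proj₁ (proj₂ (denominator ψ))) (proj₂ (proj₂ (denominator ψ))) b c })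
        (gen , All.zipWith (λ z → z) (bs , cs))
    stage₁ : (∃ λ q₀ → All (Generic q₀) L) → Goal
    stage₁ (q₀ , gen) = next (uniformly-below (λ ψ → ℤ→ℚ (N ψ) * dot ψ q₀) (λ ψ → dot ψ q₀) L)
      where
      next : (∃ λ δ → 0ℚ < δ × All (λ ψ → Below δ (ℤ→ℚ (N ψ) * dot ψ q₀ , 1ℚ) × Below δ (dot ψ q₀ , 1ℚ)) L) → Goal
      next (δ , δ>0 , bs) = stage₂ q₀ gen δ δ>0 bs (uniformly-below (λ ψ → ℤ→ℚ (N ψ) * (dot ψ (castVec g) + δ * dot ψ q₀)) (λ ψ → ℤ→ℚ (N ψ) * (dot ψ (castVec g) - δ * dot ψ q₀)) L)

-- Lattice points of a half-open simplicial cone.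

module LatticeCones where

  open import Data.Rational hiding (∣_∣; _/_; pos)
  open import Data.Rational.Properties hiding (_≥?_; _>?_)
  open import Tactic.RingSolver using (solve-∀)
  open import Data.Fin.Subset using (∣_∣)
  open Rationals
  open LinearAlgebra
  open Triangulation
  open Perturbation
  open Cardinality
  open Sequences

  InCone : ∀ {M D} → (Fin M → Fin D → ℚ) → (Fin D → ℚ) → Set
  InCone ω x = ∃ λ wt → (∀ i → 0ℚ ≤ wt i) × (∀ j → comb ω wt j ≡ x j)

  castVec-add : ∀ {n} (x y : Vec ℤ n) j → castVec (Vec.zipWith ℤ._+_ x y) j ≡ castVec x j + castVec y j
  castVec-add x y j = trans (cong ℤ→ℚ (Vec.lookup-zipWith ℤ._+_ j x y)) (cast-+ (lookup x j) (lookup y j))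

  castVec-sub : ∀ {n} (x y : Vec ℤ n) j → castVec (Vec.zipWith ℤ._-_ x y) j ≡ castVec x j - castVec y j
  castVec-sub x y j = trans (cong ℤ→ℚ (Vec.lookup-zipWith ℤ._-_ j x y)) (cast-sub (lookup x j) (lookup y j))

  vec-ext : ∀ {A : Set} {n} {x y : Vec A n} → (∀ j → lookup x j ≡ lookup y j) → x ≡ y
  vec-ext {x = x} {y} h = trans (sym (Vec.tabulate∘lookup x)) (trans (Vec.tabulate-cong h) (Vec.tabulate∘lookup y))

  add-then-sub : ∀ {n} (x y : Vec ℤ n) → Vec.zipWith ℤ._-_ (Vec.zipWith ℤ._+_ x y) y ≡ x
  add-then-sub x y = vec-ext λ j → trans (Vec.lookup-zipWith ℤ._-_ j (Vec.zipWith ℤ._+_ x y) y) (trans (cong (ℤ._- lookup y j) (Vec.lookup-zipWith ℤ._+_ j x y))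
    (trans (ℤ.+-assoc (lookup x j) (lookup y j) (ℤ.- lookup y j)) (trans (cong (ℤ._+_ (lookup x j)) (ℤ.+-inverseʳ (lookup y j))) (ℤ.+-identityʳ (lookup x j)))))

  sub-then-add : ∀ {n} (x y : Vec ℤ n) → Vec.zipWith ℤ._+_ (Vec.zipWith ℤ._-_ x y) y ≡ x
  sub-then-add x y = vec-ext λ j → trans (Vec.lookup-zipWith ℤ._+_ j (Vec.zipWith ℤ._-_ x y) y) (trans (cong (ℤ._+ lookup y j) (Vec.lookup-zipWith ℤ._-_ j x y))
    (trans (ℤ.+-assoc (lookup x j) (ℤ.- lookup y j) (lookup y j)) (trans (cong (ℤ._+_ (lookup x j)) (ℤ.+-inverseˡ (lookup y j))) (ℤ.+-identityʳ (lookup x j)))))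

  sumℕ : ∀ n → (Fin n → ℕ) → ℕ
  sumℕ zero f = 0
  sumℕ (suc n) f = f zero ℕ.+ sumℕ n (f ∘ suc)

  term≤sumℕ : ∀ n (f : Fin n → ℕ) i → f i ℕ.≤ sumℕ n f
  term≤sumℕ (suc n) f zero = ℕ.m≤m+n (f zero) (sumℕ n (f ∘ suc))
  term≤sumℕ (suc n) f (suc i) = ℕ.≤-trans (term≤sumℕ n (f ∘ suc) i) (ℕ.m≤n+m (sumℕ n (f ∘ suc)) (f zero))

  cast-sumℕ : ∀ n (f : Fin n → ℕ) → ℤ→ℚ (⊕ sumℕ n f) ≡ Σℚ n (λ i → ℤ→ℚ (⊕ f i))
  cast-sumℕ zero f = refl
  cast-sumℕ (suc n) f = trans (cast-+ (⊕ f zero) (⊕ sumℕ n (f ∘ suc))) (cong (ℤ→ℚ (⊕ f zero) +_) (cast-sumℕ n (f ∘ suc)))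

  i≤∣i∣ : ∀ i → i ℤ.≤ ⊕ ℤ.∣ i ∣
  i≤∣i∣ (⊕ n) = ℤ.≤-refl
  i≤∣i∣ (ℤ.-[1+ n ]) = ℤ.-≤+

  -i≤∣i∣ : ∀ i → ℤ.- i ℤ.≤ ⊕ ℤ.∣ i ∣
  -i≤∣i∣ (⊕ zero) = ℤ.≤-refl
  -i≤∣i∣ (⊕ suc n) = ℤ.-≤+
  -i≤∣i∣ (ℤ.-[1+ n ]) = ℤ.≤-refl

  module Simplex {M d} (w : Fin M → Vec ℤ (suc d)) (ℓ : Fin M → ℕ) (height : ∀ i → lookup (w i) zero ≡ ⊕ ℓ i) (ℓ-pos : ∀ i → 1 ℕ.≤ ℓ i)
    (p : Fin (suc d) → ℚ) {S : Vec Bool M} (B : Basis (λ i → castVec (w i)) S)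
    (gap : ∀ i → lookup S i ≡ true → Gap p (Basis.φ B i)) where

    open Basis B

    coordinate : Fin M → Vec ℤ (suc d) → ℚ
    coordinate i x = dot (φ i) (castVec x)

    u : Fin M → Vec ℤ (suc d) → ℚ
    u i x = coordinate i x + dot (φ i) p

    -- Confining one more coordinate i to the unit box amounts to applying ∇ (ℓ i) to the counting sequence.
    Region : List (Fin M) → ℕ → Vec ℤ (suc d) → Set
    Region J n x = lookup x zero ≡ ⊕ n × (∀ i → lookup S i ≡ true → 0ℚ < u i x) × (∀ i → lookup S i ≡ true → i ∈ J → u i x ≤ 1ℚ)

    region? : ∀ J n x → Dec (Region J n x)
    region? J n x = (lookup x zero ℤ.≟ ⊕ n) ×-dec (Fin.all? (λ i → (lookup S i ≟ᵇ true) →-dec (0ℚ <? u i x)))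
      ×-dec (Fin.all? (λ i → (lookup S i ≟ᵇ true) →-dec ((i ∈? J) →-dec (u i x ≤? 1ℚ))))
      where open import Data.List.Membership.DecPropositional Fin._≟_ using (_∈?_)

    -- Here the perturbation is forgotten again: by `Gap`, a lattice point with positive shifted
    -- coordinates lies in the closed unshifted cone.
    coordinate-nonneg : ∀ x → (∀ i → lookup S i ≡ true → 0ℚ < u i x) → ∀ i → 0ℚ ≤ coordinate i x
    coordinate-nonneg x h i with lookup S i in e
    ... | true = proj₁ (proj₂ (gap i e x)) (h i e)
    ... | false = ≤-reflexive (sym (off-dot i e (castVec x)))

    cast-ℓ : ∀ i → castVec (w i) zero ≡ ℤ→ℚ (⊕ ℓ i)
    cast-ℓ i = cong ℤ→ℚ (height i)

    1≤castℓ : ∀ i → 1ℚ ≤ ℤ→ℚ (⊕ ℓ i)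
    1≤castℓ i = cast-mono-≤ (ℤ.+≤+ (ℓ-pos i))

    height-sum : ∀ x → Σℚ M (λ i → coordinate i x * ℤ→ℚ (⊕ ℓ i)) ≡ castVec x zero
    height-sum x = trans (Σ-cong M (λ i → cong (coordinate i x *_) (sym (cast-ℓ i)))) (recon (castVec x) zero)

    height-nonneg : ∀ x → (∀ i → lookup S i ≡ true → 0ℚ < u i x) → 0ℚ ≤ castVec x zero
    height-nonneg x h = subst (0ℚ ≤_) (height-sum x) (Σ-nonneg M (λ i → 0≤* (coordinate-nonneg x h i) (≤-trans (<⇒≤ 0<1) (1≤castℓ i))))

    coordinate-≤-height : ∀ x → (∀ i → lookup S i ≡ true → 0ℚ < u i x) → ∀ i → coordinate i x ≤ castVec x zero
    coordinate-≤-height x h i = ≤-trans (0≤-⇒≤ (subst (0ℚ ≤_) (lem (coordinate i x) (ℤ→ℚ (⊕ ℓ i))) (0≤* (coordinate-nonneg x h i) (≤⇒0≤- (1≤castℓ i)))))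
      (subst (coordinate i x * ℤ→ℚ (⊕ ℓ i) ≤_) (height-sum x) (Σ-term M (λ i → 0≤* (coordinate-nonneg x h i) (≤-trans (<⇒≤ 0<1) (1≤castℓ i))) i))
      where lem : ∀ a b → a * (b - 1ℚ) ≡ a * b - a
            lem = solve-∀ ℚ-ring

    row-bound : Fin M → ℕ
    row-bound i = sumℕ (suc d) (λ j → ℤ.∣ lookup (w i) j ∣)

    weighted-bound : ∀ n (a b : Fin M → ℚ) → (∀ i → 0ℚ ≤ a i × a i ≤ ℤ→ℚ (⊕ n)) → (∀ i → b i ≤ ℤ→ℚ (⊕ row-bound i)) →
      Σℚ M (λ i → a i * b i) ≤ ℤ→ℚ (⊕ (n ℕ.* sumℕ M row-bound))
    weighted-bound n a b ha hb = subst (Σℚ M (λ i → a i * b i) ≤_) total (Σ-mono M term)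
      where
      N = ℤ→ℚ (⊕ n)
      r : Fin M → ℚ
      r i = ℤ→ℚ (⊕ row-bound i)
      term : ∀ i → a i * b i ≤ N * r i
      term i = 0≤-⇒≤ (subst (0ℚ ≤_) (lem (a i) (b i) N (r i))
        (0≤+ (0≤* (proj₁ (ha i)) (≤⇒0≤- (hb i))) (0≤* (cast-mono-≤ {⊕ 0} {⊕ row-bound i} (ℤ.+≤+ ℕ.z≤n)) (≤⇒0≤- (proj₂ (ha i))))))
        where lem : ∀ a b N r → a * (r - b) + r * (N - a) ≡ N * r - a * b
              lem = solve-∀ ℚ-ring
      total : Σℚ M (λ i → N * r i) ≡ ℤ→ℚ (⊕ (n ℕ.* sumℕ M row-bound))
      total = trans (Σ-*ˡ M N r) (trans (cong (N *_) (sym (cast-sumℕ M row-bound))) (trans (sym (cast-* (⊕ n) (⊕ sumℕ M row-bound))) (cong ℤ→ℚ (sym (ℤ.pos-* n (sumℕ M row-bound))))))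

    -- All generators have height at least 1, so the nonnegative coordinates are at most the height
    -- `n`. This bounds every entry and makes the region finite.
    region-bounded : ∀ J n x → Region J n x → ∀ j → ℤ.- ⊕ (n ℕ.* sumℕ M row-bound) ℤ.≤ lookup x j × lookup x j ℤ.≤ ⊕ (n ℕ.* sumℕ M row-bound)
    region-bounded J n x (hx , pos , _) j = lower , upper
      where
      coords : ∀ i → 0ℚ ≤ coordinate i x × coordinate i x ≤ ℤ→ℚ (⊕ n)
      coords i = coordinate-nonneg x pos i , subst (coordinate i x ≤_) (cong ℤ→ℚ hx) (coordinate-≤-height x pos i)
      entry : ∀ i → ⊕ ℤ.∣ lookup (w i) j ∣ ℤ.≤ ⊕ row-bound i
      entry i = ℤ.+≤+ (term≤sumℕ (suc d) (λ j → ℤ.∣ lookup (w i) j ∣) j)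
      upper : lookup x j ℤ.≤ ⊕ (n ℕ.* sumℕ M row-bound)
      upper = cast-cancel-≤ (subst (_≤ ℤ→ℚ (⊕ (n ℕ.* sumℕ M row-bound))) (recon (castVec x) j)
        (weighted-bound n (λ i → coordinate i x) (λ i → castVec (w i) j) coords (λ i → cast-mono-≤ (ℤ.≤-trans (i≤∣i∣ (lookup (w i) j)) (entry i)))))
      lower : ℤ.- ⊕ (n ℕ.* sumℕ M row-bound) ℤ.≤ lookup x j
      lower = subst (ℤ.- ⊕ (n ℕ.* sumℕ M row-bound) ℤ.≤_) (ℤ.neg-involutive (lookup x j)) (ℤ.neg-mono-≤ (cast-cancel-≤ {ℤ.- lookup x j} (subst (_≤ ℤ→ℚ (⊕ (n ℕ.* sumℕ M row-bound))) flipped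
        (weighted-bound n (λ i → coordinate i x) (λ i → - castVec (w i) j) coords
          (λ i → subst (_≤ ℤ→ℚ (⊕ row-bound i)) (cast-neg (lookup (w i) j)) (cast-mono-≤ (ℤ.≤-trans (-i≤∣i∣ (lookup (w i) j)) (entry i))))))))
        where
        flipped : Σℚ M (λ i → coordinate i x * - castVec (w i) j) ≡ ℤ→ℚ (ℤ.- lookup x j)
        flipped = trans (Σ-cong M (λ i → sym (neg-distribʳ-* (coordinate i x) (castVec (w i) j)))) (trans (Σ-neg M (λ i → coordinate i x * castVec (w i) j))
          (trans (cong -_ (recon (castVec x) j)) (sym (cast-neg (lookup x j)))))

    region-card : ∀ J n → ∃ (HasCard (Region J n))
    region-card J n = card-bounded (n ℕ.* sumℕ M row-bound) (region? J n) (region-bounded J n)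

    count : List (Fin M) → ℕ → ℕ
    count J n = proj₁ (region-card J n)

    count-card : ∀ J n → HasCard (Region J n) (count J n)
    count-card J n = proj₂ (region-card J n)

    count-outside : ∀ i J → lookup S i ≡ false → ∀ n → count (i ∷ J) n ≡ count J n
    count-outside i J i∉S n = card-unique (count-card (i ∷ J) n) (count-card J n) λ x → mk⇔
      (λ { (h , p , b) → h , p , λ k k∈S k∈J → b k k∈S (there k∈J) })
      (λ { (h , p , b) → h , p , λ { k k∈S (here refl) → contradiction (trans (sym i∉S) k∈S) λ () ; k k∈S (there k∈J) → b k k∈S k∈J } })

    module _ (i : Fin M) (i∈S : lookup S i ≡ true) where

      up down : Vec ℤ (suc d) → Vec ℤ (suc d)
      up x = Vec.zipWith ℤ._+_ x (w i)
      down x = Vec.zipWith ℤ._-_ x (w i)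

      u-up : ∀ k x → u k (up x) ≡ u k x + δ k i
      u-up k x = trans (cong (_+ dot (φ k) p) (trans (dot-congʳ (φ k) (castVec-add x (w i))) (trans (dot-addʳ (φ k) (castVec x) (castVec (w i))) (cong (coordinate k x +_) (dual k i i∈S)))))
        (lem (coordinate k x) (δ k i) (dot (φ k) p))
        where lem : ∀ a b c → a + b + c ≡ a + c + b
              lem = solve-∀ ℚ-ring

      u-down : ∀ k x → u k (down x) ≡ u k x - δ k i
      u-down k x = trans (lem (u k (down x)) (δ k i)) (cong (_- δ k i) (trans (sym (u-up k (down x))) (cong (u k) (sub-then-add x (w i)))))
        where lem : ∀ a b → a ≡ a + b - b
              lem = solve-∀ ℚ-ring

      height-up : ∀ x → lookup (up x) zero ≡ lookup x zero ℤ.+ ⊕ ℓ i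
      height-up x = trans (Vec.lookup-zipWith ℤ._+_ zero x (w i)) (cong (ℤ._+_ (lookup x zero)) (height i))

      down-positive : ∀ x → (∀ k → lookup S k ≡ true → 0ℚ < u k x) → ¬ (u i x ≤ 1ℚ) → ∀ k → lookup S k ≡ true → 0ℚ < u k (down x)
      down-positive x h big k k∈S with k Fin.≟ i
      ... | yes refl = subst (0ℚ <_) (sym (trans (u-down i x) (cong (λ t → u i x - t) (δ-refl i)))) (<⇒0<- (≰⇒> big))
      ... | no k≢i = subst (0ℚ <_) (sym (trans (u-down k x) (trans (cong (λ t → u k x - t) (δ-≢ k≢i)) (a-0 (u k x))))) (h k k∈S)

      Tall : List (Fin M) → ℕ → Vec ℤ (suc d) → Set
      Tall J n x = Region J n x × ¬ (u i x ≤ 1ℚ)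

      region-split : ∀ J n {a} → HasCard (Tall J n) a → count J n ≡ count (i ∷ J) n ℕ.+ a
      region-split J n cT = card-unique (count-card J n) (card-⊎ (count-card (i ∷ J) n) cT (λ { x (_ , _ , b) (_ , big) → big (b i i∈S (here refl)) })) λ x → mk⇔
        (to x)
        (λ { (inj₁ (h , p , b)) → h , p , (λ k k∈S k∈J → b k k∈S (there k∈J)) ; (inj₂ (r , _)) → r })
        where
        to : ∀ x → Region J n x → Region (i ∷ J) n x ⊎ Tall J n x
        to x r@(h , p , b) with u i x ≤? 1ℚ
        ... | yes small = inj₁ (h , p , λ { k k∈S (here refl) → small ; k k∈S (there k∈J) → b k k∈S k∈J })
        ... | no big = inj₂ (r , big)

      tall-card : ∀ J n → ∃ (HasCard (Tall J n))
      tall-card J n = card-filter (count-card J n) (λ x → ¬? (u i x ≤? 1ℚ))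

      -- Subtracting the generator would leave a point of the half-open cone at negative height.
      tall-low : ∀ J n → n ℕ.< ℓ i → ∀ x → ¬ Tall J n x
      tall-low J n n<ℓ x ((h , p , _) , big) = contradiction (cast-cancel-≤ {⊕ ℓ i} {⊕ n} bound) (λ { (ℤ.+≤+ ℓ≤n) → ℕ.<⇒≱ n<ℓ ℓ≤n })
        where
        bound : ℤ→ℚ (⊕ ℓ i) ≤ ℤ→ℚ (⊕ n)
        bound = 0≤-⇒≤ (subst (0ℚ ≤_) (trans (castVec-sub x (w i) zero) (cong₂ _-_ (cong ℤ→ℚ h) (cast-ℓ i))) (height-nonneg (down x) (down-positive x p big)))

      -- Subtracting generator `i` lowers the height by `ℓ i` and coordinate `i` by 1 and fixes the
      -- other coordinates. The box conditions of `J` survive because `i` is not in `J`.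
      tall-high : ∀ J n {a} → ¬ (i ∈ J) → HasCard (Tall J (ℓ i ℕ.+ n)) a → a ≡ count J n
      tall-high J n i∉J cT = card-biject cT (count-card J n) down up down∈ up∈ (λ x _ → sub-then-add x (w i)) (λ y _ → add-then-sub y (w i))
        where
        unshift : ∀ k x → k ∈ J → u k (down x) ≡ u k x
        unshift k x k∈J = trans (u-down k x) (trans (cong (λ t → u k x - t) (δ-≢ (λ e → i∉J (subst (_∈ J) e k∈J)))) (a-0 (u k x)))
        down∈ : ∀ x → Tall J (ℓ i ℕ.+ n) x → Region J n (down x)
        down∈ x ((h , p , b) , big) = hd , down-positive x p big , λ k k∈S k∈J → subst (_≤ 1ℚ) (sym (unshift k x k∈J)) (b k k∈S k∈J)
          where
          hd : lookup (down x) zero ≡ ⊕ n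
          hd = trans (Vec.lookup-zipWith ℤ._-_ zero x (w i)) (trans (cong₂ ℤ._-_ h (height i)) (trans (ℤ.m-n≡m⊖n (ℓ i ℕ.+ n) (ℓ i)) (trans (ℤ.⊖-≥ (ℕ.m≤m+n (ℓ i) n)) (cong ⊕_ (ℕ.m+n∸m≡n (ℓ i) n)))))
        up∈ : ∀ y → Region J n y → Tall J (ℓ i ℕ.+ n) (up y)
        up∈ y (h , p , b) = (hu , pu , bu) , λ le → <-irrefl refl (<-≤-trans (subst (1ℚ <_) (sym ui) one<) le)
          where
          hu : lookup (up y) zero ≡ ⊕ (ℓ i ℕ.+ n)
          hu = trans (height-up y) (trans (cong (ℤ._+ ⊕ ℓ i) h) (cong ⊕_ (ℕ.+-comm n (ℓ i))))
          pu : ∀ k → lookup S k ≡ true → 0ℚ < u k (up y)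
          pu k k∈S = subst (0ℚ <_) (sym (u-up k y)) (0<+≤ (p k k∈S) (δ-nonneg k i))
            where
            δ-nonneg : ∀ {n} (k i : Fin n) → 0ℚ ≤ δ k i
            δ-nonneg zero zero = <⇒≤ 0<1
            δ-nonneg zero (suc i) = ≤-refl
            δ-nonneg (suc k) zero = ≤-refl
            δ-nonneg (suc k) (suc i) = δ-nonneg k i
          bu : ∀ k → lookup S k ≡ true → k ∈ J → u k (up y) ≤ 1ℚ
          bu k k∈S k∈J = subst (_≤ 1ℚ) (trans (cong (u k) (sym (add-then-sub y (w i)))) (unshift k (up y) k∈J)) (b k k∈S k∈J)
          ui : u i (up y) ≡ u i y + 1ℚ
          ui = trans (u-up i y) (cong (u i y +_) (δ-refl i))
          one< : 1ℚ < u i y + 1ℚ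
          one< = 0<-⇒< (subst (0ℚ <_) (lem (u i y)) (p i i∈S))
            where lem : ∀ a → a ≡ a + 1ℚ - 1ℚ
                  lem = solve-∀ ℚ-ring

      count-∇ : ∀ J → ¬ (i ∈ J) → ∀ n → ⊕ count (i ∷ J) n ≡ ∇ (ℓ i) (λ n → ⊕ count J n) n
      count-∇ J i∉J n = pack (tall-card J n)
        where
        c : ℕ → ℤ
        c n = ⊕ count J n
        shifted : ∀ a → HasCard (Tall J n) a → ⊕ a ≡ shift (ℓ i) c n
        shifted a cT with ℓ i ℕ.≤? n
        ... | no ℓ≰n = trans (cong ⊕_ (card-unique cT (card-empty (tall-low J n (ℕ.≰⇒> ℓ≰n))) (λ x → mk⇔ (λ t → contradiction t (tall-low J n (ℕ.≰⇒> ℓ≰n) x)) (λ t → contradiction t (tall-low J n (ℕ.≰⇒> ℓ≰n) x))))) (sym (shift-< (ℓ i) c n (ℕ.≰⇒> ℓ≰n)))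
        ... | yes ℓ≤n = go (n ℕ.∸ ℓ i) (ℕ.m+[n∸m]≡n ℓ≤n)
          where
          go : ∀ m → ℓ i ℕ.+ m ≡ n → ⊕ a ≡ shift (ℓ i) c n
          go m refl = trans (cong ⊕_ (tall-high J m i∉J cT)) (sym (shift-+ (ℓ i) c m))
        pack : ∃ (HasCard (Tall J n)) → ⊕ count (i ∷ J) n ≡ ∇ (ℓ i) c n
        pack (a , cT) = trans (lem (⊕ count (i ∷ J) n) (⊕ a)) (cong₂ ℤ._-_ (cong ⊕_ (sym (region-split J n cT))) (shifted a cT))
          where
          lem : ∀ x y → x ≡ (x ℤ.+ y) ℤ.- y
          lem x y = sym (trans (ℤ.+-assoc x y (ℤ.- y)) (trans (cong (ℤ._+_ x) (ℤ.+-inverseʳ y)) (ℤ.+-identityʳ x)))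

    count-reduce : ∀ J → Unique J → ∀ n → ⊕ count J n ≡ reduce (lookup S) ℓ J (λ n → ⊕ count [] n) n
    count-reduce [] _ n = refl
    count-reduce (i ∷ J) (i∉J AllPairs.∷ uJ) n with lookup S i in e
    ... | true = trans (count-∇ i e J (λ p → All.lookup i∉J p refl) n) (∇-cong (ℓ i) (count-reduce J uJ) n)
    ... | false = trans (cong ⊕_ (count-outside i J e n)) (count-reduce J uJ n)

  -- Half-open decomposition of the whole cone.

  module Fan {M d} (w : Fin M → Vec ℤ (suc d)) (ℓ : Fin M → ℕ) (height : ∀ i → lookup (w i) zero ≡ ⊕ ℓ i) (ℓ-pos : ∀ i → 1 ℕ.≤ ℓ i)
    (basis? : ∀ S → Dec (Basis (λ i → castVec (w i)) S)) (optimal? : ∀ S → Dec (LexOptimal (λ i → castVec (w i)) S))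
    {S₀ : Vec Bool M} (B₀ : Basis (λ i → castVec (w i)) S₀)
    (p : Fin (suc d) → ℚ) (p∈cone : InCone (λ i → castVec (w i)) p)
    (gap : ∀ {S} (B : Basis (λ i → castVec (w i)) S) i → lookup S i ≡ true → Gap p (Basis.φ B i)) where

    ω : Fin M → Fin (suc d) → ℚ
    ω i = castVec (w i)

    module Cone {S} (B : Basis ω S) = Simplex w ℓ height ℓ-pos p B (gap B)

    HalfOpen : ∀ {S} → Basis ω S → Vec ℤ (suc d) → Set
    HalfOpen {S} B x = ∀ i → lookup S i ≡ true → 0ℚ < Cone.u B i x

    dot-shift : ∀ {S} (B : Basis ω S) i x → dot (Basis.φ B i) (λ j → castVec x j + p j) ≡ Cone.u B i x
    dot-shift B i x = dot-addʳ (Basis.φ B i) (castVec x) p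

    -- `x + p` is in the cone because both summands are, and `gap` makes all its basic coordinates
    -- nonzero, which is the nondegeneracy that `optimal-exists` requires.
    locate : ∀ x → InCone ω (castVec x) → ∃ λ S → Σ (Basis ω S) λ B → LexOptimal ω S × HalfOpen B x
    locate x (wt , wt≥0 , wt-rep) = unshift (optimal-exists (δ zero) η-pos basis? B₀ (λ j → castVec x j + p j) generic represents)
      where
      η-pos : ∀ i → 0ℚ < dot (δ zero) (ω i)
      η-pos i = subst (0ℚ <_) (sym (trans (Σ-δˡ (suc d) (ω i) zero) (cong ℤ→ℚ (height i)))) (cast-mono-< (ℤ.+<+ (ℓ-pos i)))
      generic : ∀ S (B : Basis ω S) i → lookup S i ≡ true → dot (Basis.φ B i) (λ j → castVec x j + p j) ≢ 0ℚ
      generic S B i e z = proj₁ (gap B i e x) (trans (sym (dot-shift B i x)) z)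
      represents : (∀ i → 0ℚ ≤ wt i + proj₁ p∈cone i) × (∀ j → comb ω (λ i → wt i + proj₁ p∈cone i) j ≡ castVec x j + p j)
      represents = (λ i → 0≤+ (wt≥0 i) (proj₁ (proj₂ p∈cone) i)) , λ j → trans (comb-add ω wt (proj₁ p∈cone) j) (cong₂ _+_ (wt-rep j) (proj₂ (proj₂ p∈cone) j))
      unshift : (∃ λ S → Σ (Basis ω S) λ B → LexOptimal ω S × (∀ i → lookup S i ≡ true → 0ℚ < dot (Basis.φ B i) (λ j → castVec x j + p j))) →
        ∃ λ S → Σ (Basis ω S) λ B → LexOptimal ω S × HalfOpen B x
      unshift (S , B , opt , h) = S , B , opt , λ i e → subst (0ℚ <_) (dot-shift B i x) (h i e)

    halfOpen⇒inCone : ∀ {S} (B : Basis ω S) x → HalfOpen B x → InCone ω (castVec x)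
    halfOpen⇒inCone B x h = (λ i → Cone.coordinate B i x) , Cone.coordinate-nonneg B x h , Basis.recon B (castVec x)

    locate-unique : ∀ {S S'} (B : Basis ω S) (B' : Basis ω S') x → LexOptimal ω S → LexOptimal ω S' → HalfOpen B x → HalfOpen B' x → S ≡ S'
    locate-unique B B' x opt opt' h h' = optimal-unique B B' (λ j → castVec x j + p j) opt opt'
      (λ i e → subst (0ℚ <_) (sym (dot-shift B i x)) (h i e)) (λ i e → subst (0ℚ <_) (sym (dot-shift B' i x)) (h' i e))

    InCell : List (Fin M) → ℕ → Vec Bool M → Vec ℤ (suc d) → Set
    InCell J n S x = Σ (Basis ω S) λ B → LexOptimal ω S × Cone.Region B J n x

    cell-count : List (Fin M) → ℕ → Vec Bool M → ℕ
    cell-count J n S with basis? S | optimal? S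
    ... | yes B | yes _ = Cone.count B J n
    ... | yes _ | no _ = 0
    ... | no _ | _ = 0

    region-irrelevant : ∀ {S} (B B' : Basis ω S) J n x → Cone.Region B J n x → Cone.Region B' J n x
    region-irrelevant B B' J n x (h , pos , b) = h , (λ i e → subst (0ℚ <_) (eq i) (pos i e)) , λ i e i∈J → subst (_≤ 1ℚ) (eq i) (b i e i∈J)
      where
      eq : ∀ i → Cone.u B i x ≡ Cone.u B' i x
      eq i = cong₂ _+_ (basis-irrelevant B B' (castVec x) i) (basis-irrelevant B B' p i)

    cell-card : ∀ J n S → HasCard (InCell J n S) (cell-count J n S)
    cell-card J n S with basis? S | optimal? S
    ... | yes B | yes opt = card-resp (λ x → mk⇔ (λ r → B , opt , r) (λ { (B' , _ , r) → region-irrelevant B' B J n x r })) (Cone.count-card B J n)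
    ... | yes _ | no ¬opt = card-empty (λ { x (_ , opt , _) → ¬opt opt })
    ... | no ¬B | _ = card-empty (λ { x (B , _) → ¬B B })

    total : List (Fin M) → ℕ → ℕ
    total J n = sumOver (subsets M) (cell-count J n)

    -- With the empty list no coordinate is confined to the box. `locate` shows that the half-open
    -- cells cover the lattice points of the cone and `locate-unique` that they are disjoint.
    total-card : ∀ n → HasCard (λ x → lookup x zero ≡ ⊕ n × InCone ω (castVec x)) (total [] n)
    total-card n = card-resp (λ x → mk⇔ (λ { (S , _ , B , _ , h , pos , _) → h , halfOpen⇒inCone B x pos }) (λ { (h , c) → into x h (locate x c) }))
      (card-⋃ (subsets M) (subsets-unique M) (InCell [] n) (cell-count [] n) (cell-card [] n)
        (λ { x ne (B , opt , _ , pos , _) (B' , opt' , _ , pos' , _) → ne (locate-unique B B' x opt opt' pos pos') }))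
      where
      into : ∀ x → lookup x zero ≡ ⊕ n → (∃ λ S → Σ (Basis ω S) λ B → LexOptimal ω S × HalfOpen B x) → ∃ λ S → S ∈ subsets M × InCell [] n S x
      into x h (S , B , opt , pos) = S , ∈-subsets S , B , opt , h , pos , λ _ _ ()

    -- A linear operator that clears the denominator of every cell clears that of the sum. It is
    -- left abstract because two cases occur: `(1 - t)^(d + 1)` for unit heights, and
    -- `(1 - t^(d + 1)) (1 - t)^d` with the apex of height `d + 1`.
    total-reduce : (op : (ℕ → ℤ) → ℕ → ℤ) → (∀ n → op (λ _ → ⊕ 0) n ≡ ⊕ 0) → (∀ s t n → op (λ n → s n ℤ.+ t n) n ≡ op s n ℤ.+ op t n) →
      (∀ {S} → Basis ω S → LexOptimal ω S → ∀ s n → reduce (lookup S) ℓ (List.allFin M) s n ≡ op s n) →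
      ∀ n → ⊕ total (List.allFin M) n ≡ op (λ n → ⊕ total [] n) n
    total-reduce op op-0 op-+ op-cell = sum (subsets M)
      where
      cell : ∀ S n → ⊕ cell-count (List.allFin M) n S ≡ op (λ n → ⊕ cell-count [] n S) n
      cell S n with basis? S | optimal? S
      ... | yes B | yes opt = trans (Cone.count-reduce B (List.allFin M) (Unique.allFin⁺ M) n) (op-cell B opt (λ n → ⊕ Cone.count B [] n) n)
      ... | yes _ | no _ = sym (op-0 n)
      ... | no _ | _ = sym (op-0 n)
      sum : ∀ Ss n → ⊕ sumOver Ss (cell-count (List.allFin M) n) ≡ op (λ n → ⊕ sumOver Ss (cell-count [] n)) n
      sum [] n = sym (op-0 n)
      sum (S ∷ Ss) n = trans (cong₂ ℤ._+_ (cell S n) (sum Ss n)) (sym (op-+ (λ n → ⊕ cell-count [] n S) (λ n → ⊕ sumOver Ss (cell-count [] n)) n))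

    total-zero : ∀ J n → (∀ {S} (B : Basis ω S) x → ¬ Cone.Region B J n x) → total J n ≡ 0
    total-zero J n none = zeros (subsets M)
      where
      cell : ∀ S → cell-count J n S ≡ 0
      cell S = card-unique (cell-card J n S) (card-empty {S = λ _ → ⊥} (λ _ z → z)) λ x → mk⇔ (λ { (B , _ , r) → none B x r }) λ ()
      zeros : ∀ Ss → sumOver Ss (cell-count J n) ≡ 0
      zeros [] = refl
      zeros (S ∷ Ss) = cong₂ ℕ._+_ (cell S) (zeros Ss)

    module _ (unit : ∀ i → ℓ i ≡ 1) where

      total-∇^ : ∀ n → ⊕ total (List.allFin M) n ≡ ∇^ (suc d) (λ n → ⊕ total [] n) n
      total-∇^ = total-reduce (∇^ (suc d)) (∇^-zero (suc d)) (∇^-add (suc d)) λ {S} B _ s n →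
        trans (reduce-one (lookup S) ℓ (List.allFin M) (All.tabulate (λ {i} _ → unit i)) s n) (cong (λ k → ∇^ k s n) (trans (trues-allFin S) (basis-card B)))

      -- With unit heights the shifted coordinates of a box point add up to `n + p zero`, and each
      -- of the `d + 1` of them is at most 1. As `p zero` is positive, `n = d + 1` is excluded too.
      boxes-low : 0ℚ < p zero → ∀ n → d ℕ.< n → total (List.allFin M) n ≡ 0
      boxes-low p₀>0 n d<n = total-zero (List.allFin M) n λ B x r → ℕ.<⇒≱ d<n (bound B x r)
        where
        bound : ∀ {S} (B : Basis ω S) x → Cone.Region B (List.allFin M) n x → n ℕ.≤ d
        bound {S} B x (h , pos , b) = ℕ.≤-pred (drop (cast-cancel-< {⊕ n} {⊕ suc d} (<-≤-trans n<sum sum≤)))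
          where
          open Cone B
          drop : ⊕ n ℤ.< ⊕ suc d → n ℕ.< suc d
          drop (ℤ.+<+ q) = q
          sum = Σℚ M (λ i → u i x)
          sum-eq : sum ≡ ℤ→ℚ (⊕ n) + p zero
          sum-eq = trans (Σ-cong M (λ i → trans (sym (*-identityʳ (u i x))) (cong (λ t → u i x * t) (sym (cong ℤ→ℚ (trans (height i) (cong ⊕_ (unit i))))))))
            (trans (comb-add ω (λ i → coordinate i x) (λ i → dot (Basis.φ B i) p) zero) (cong₂ _+_ (trans (Basis.recon B (castVec x) zero) (cong ℤ→ℚ h)) (Basis.recon B p zero)))
          n<sum : ℤ→ℚ (⊕ n) < sum
          n<sum = 0<-⇒< (subst (0ℚ <_) (trans (lem (ℤ→ℚ (⊕ n)) (p zero)) (cong (_- ℤ→ℚ (⊕ n)) (sym sum-eq))) p₀>0)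
            where lem : ∀ a b → b ≡ a + b - a
                  lem = solve-∀ ℚ-ring
          each : ∀ i → u i x ≤ indicator (lookup S i)
          each i with lookup S i in e
          ... | true = b i e (∈-allFin i)
          ... | false = ≤-reflexive (cong₂ _+_ (Basis.off-dot B i e (castVec x)) (Basis.off-dot B i e p))
          sum≤ : sum ≤ ℤ→ℚ (⊕ suc d)
          sum≤ = subst (sum ≤_) (trans (Σ-indicator S) (cong (λ k → ℤ→ℚ (⊕ k)) (basis-card B))) (Σ-mono M each)

  -- Reflection of box points in a cell with an apex of height `d + 1`.

  select : Bool → ℤ → ℤ
  select true z = z
  select false z = ⊕ 0

  cast-select : ∀ b z → ℤ→ℚ (select b z) ≡ indicator b * ℤ→ℚ z
  cast-select true z = sym (*-identityˡ (ℤ→ℚ z))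
  cast-select false z = sym (*-zeroˡ (ℤ→ℚ z))

  vertexSum : ∀ {M D} → Vec Bool M → (Fin M → Vec ℤ D) → Vec ℤ D
  vertexSum {M} S w = Vec.tabulate (λ j → Σℤ M (λ i → select (lookup S i) (lookup (w i) j)))

  castVec-vertexSum : ∀ {M D} (S : Vec Bool M) (w : Fin M → Vec ℤ D) j → castVec (vertexSum S w) j ≡ comb (λ i → castVec (w i)) (λ i → indicator (lookup S i)) j
  castVec-vertexSum {M} S w j = trans (cong ℤ→ℚ (Vec.lookup∘tabulate (λ j → Σℤ M (λ i → select (lookup S i) (lookup (w i) j))) j))
    (trans (cast-Σ M (λ i → select (lookup S i) (lookup (w i) j))) (Σ-cong M (λ i → cast-select (lookup S i) (lookup (w i) j))))

  coordinate-vertexSum : ∀ {M D} (w : Fin M → Vec ℤ D) {S} (B : Basis (λ i → castVec (w i)) S) i → dot (Basis.φ B i) (castVec (vertexSum S w)) ≡ indicator (lookup S i)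
  coordinate-vertexSum w {S} B i = trans (dot-congʳ (Basis.φ B i) (castVec-vertexSum S w)) (Basis.coord B (λ i → indicator (lookup S i)) (λ i e → cong indicator e) i)

  module Mirror {M d} (w : Fin (suc M) → Vec ℤ (suc d)) (ℓ : Fin (suc M) → ℕ) (height : ∀ i → lookup (w i) zero ≡ ⊕ ℓ i) (ℓ-pos : ∀ i → 1 ℕ.≤ ℓ i)
    (ℓ-zero : ℓ zero ≡ suc d) (ℓ-suc : ∀ i → ℓ (suc i) ≡ 1)
    {S : Vec Bool (suc M)} (B : Basis (λ i → castVec (w i)) S) (0∈S : lookup S zero ≡ true)
    (p₊ p₋ : Fin (suc d) → ℚ)
    (gap₊ : ∀ i → lookup S i ≡ true → Gap p₊ (Basis.φ B i)) (gap₋ : ∀ i → lookup S i ≡ true → Gap p₋ (Basis.φ B i))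
    (opposite : ∀ i → dot (Basis.φ B (suc i)) p₋ ≡ - dot (Basis.φ B (suc i)) p₊)
    (positive₊ : 0ℚ < dot (Basis.φ B zero) p₊) (positive₋ : 0ℚ < dot (Basis.φ B zero) p₋) where

    module S₊ = Simplex w ℓ height ℓ-pos p₊ B gap₊
    module S₋ = Simplex w ℓ height ℓ-pos p₋ B gap₋
    open Basis B

    mirror : Vec ℤ (suc d) → Vec ℤ (suc d)
    mirror x = Vec.zipWith ℤ._-_ (vertexSum S w) x

    coordinate-mirror : ∀ i x → S₊.coordinate i (mirror x) ≡ indicator (lookup S i) - S₊.coordinate i x
    coordinate-mirror i x = trans (dot-congʳ (φ i) (castVec-sub (vertexSum S w) x)) (trans (dot-subʳ (φ i) (castVec (vertexSum S w)) (castVec x)) (cong (_- S₊.coordinate i x) (coordinate-vertexSum w B i)))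

    -- The apex contributes `d + 1` and the other `d` generators of the cell contribute 1 each.
    height-vertexSum : lookup (vertexSum S w) zero ≡ ⊕ (suc d ℕ.+ d)
    height-vertexSum = cast-injective (begin
      castVec (vertexSum S w) zero ≡⟨ castVec-vertexSum S w zero ⟩
      indicator (lookup S zero) * castVec (w zero) zero + Σℚ M (λ i → indicator (lookup S (suc i)) * castVec (w (suc i)) zero)
        ≡⟨ cong₂ _+_ (cong₂ (λ b z → indicator b * ℤ→ℚ z) 0∈S (trans (height zero) (cong ⊕_ ℓ-zero))) (Σ-cong M (λ i → trans (cong (λ z → indicator (lookup S (suc i)) * ℤ→ℚ z) (trans (height (suc i)) (cong ⊕_ (ℓ-suc i)))) (*-identityʳ (indicator (lookup S (suc i)))))) ⟩
      1ℚ * ℤ→ℚ (⊕ suc d) + rest ≡⟨ cong (_+ rest) (*-identityˡ (ℤ→ℚ (⊕ suc d))) ⟩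
      ℤ→ℚ (⊕ suc d) + rest ≡⟨ cong (ℤ→ℚ (⊕ suc d) +_) rest≡d ⟩
      ℤ→ℚ (⊕ suc d) + ℤ→ℚ (⊕ d) ≡⟨ cast-+ (⊕ suc d) (⊕ d) ⟨
      ℤ→ℚ (⊕ (suc d ℕ.+ d)) ∎)
      where
      open ≡-Reasoning
      rest = Σℚ M (λ i → indicator (lookup S (suc i)))
      all : 1ℚ + rest ≡ 1ℚ + ℤ→ℚ (⊕ d)
      all = begin
        1ℚ + rest ≡⟨ cong (λ b → indicator b + rest) 0∈S ⟨
        Σℚ (suc M) (λ i → indicator (lookup S i)) ≡⟨ Σ-indicator S ⟩
        ℤ→ℚ (⊕ ∣ S ∣) ≡⟨ cong (λ n → ℤ→ℚ (⊕ n)) (basis-card B) ⟩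
        ℤ→ℚ (⊕ suc d) ≡⟨ cast-+ (⊕ 1) (⊕ d) ⟩
        1ℚ + ℤ→ℚ (⊕ d) ∎
      lem : ∀ a → a ≡ 1ℚ + a - 1ℚ
      lem = solve-∀ ℚ-ring
      rest≡d : rest ≡ ℤ→ℚ (⊕ d)
      rest≡d = trans (lem rest) (trans (cong (_- 1ℚ) all) (sym (lem (ℤ→ℚ (⊕ d)))))

    mirror-region : ∀ {k k'} → d ℕ.< k → k' ℕ.+ k ≡ suc d ℕ.+ d → ∀ x → S₋.Region (List.allFin (suc M)) k x → S₊.Region (List.allFin (suc M)) k' (mirror x)
    mirror-region {k} {k'} d<k e x (hx , pos , box) = hy , pos₊ , λ i i∈S _ → box₊ i i∈S
      where
      a : Fin (suc M) → ℚ
      a i = S₊.coordinate i x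
      hy : lookup (mirror x) zero ≡ ⊕ k'
      hy = begin
        lookup (mirror x) zero ≡⟨ Vec.lookup-zipWith ℤ._-_ zero (vertexSum S w) x ⟩
        lookup (vertexSum S w) zero ℤ.- lookup x zero ≡⟨ cong₂ ℤ._-_ (trans height-vertexSum (cong ⊕_ (sym e))) hx ⟩
        ⊕ (k' ℕ.+ k) ℤ.- ⊕ k ≡⟨ ℤ.+-assoc (⊕ k') (⊕ k) (ℤ.- ⊕ k) ⟩
        ⊕ k' ℤ.+ (⊕ k ℤ.- ⊕ k) ≡⟨ cong (ℤ._+_ (⊕ k')) (ℤ.+-inverseʳ (⊕ k)) ⟩
        ⊕ k' ℤ.+ ⊕ 0 ≡⟨ ℤ.+-identityʳ (⊕ k') ⟩
        ⊕ k' ∎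
        where open ≡-Reasoning
      u-mirror : ∀ i → lookup S i ≡ true → S₊.u i (mirror x) ≡ 1ℚ - a i + dot (φ i) p₊
      u-mirror i i∈S = cong (_+ dot (φ i) p₊) (trans (coordinate-mirror i x) (cong (λ b → indicator b - a i) i∈S))
      u-suc : ∀ i → lookup S (suc i) ≡ true → S₊.u (suc i) (mirror x) ≡ 1ℚ - S₋.u (suc i) x
      u-suc i i∈S = trans (u-mirror (suc i) i∈S) (trans (lem (a (suc i)) (dot (φ (suc i)) p₊)) (cong (λ t → 1ℚ - (a (suc i) + t)) (sym (opposite i))))
        where lem : ∀ a v → 1ℚ - a + v ≡ 1ℚ - (a + - v)
              lem = solve-∀ ℚ-ring
      pos₊ : ∀ i → lookup S i ≡ true → 0ℚ < S₊.u i (mirror x)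
      -- At the apex the two shifts add up instead of cancelling, which only helps positivity.
      pos₊ zero i∈S = subst (0ℚ <_) (sym (trans (u-mirror zero i∈S) (lem (a zero) (dot (φ zero) p₊) (dot (φ zero) p₋))))
          (0≤+< (0≤+ (≤⇒0≤- (box zero i∈S (∈-allFin zero))) (<⇒≤ positive₊)) positive₋)
        where lem : ∀ a v v' → 1ℚ - a + v ≡ 1ℚ - (a + v') + v + v'
              lem = solve-∀ ℚ-ring
      -- The reflected upper bound `u ≤ 1` is only a weak inequality; `gap₊` excludes equality at a
      -- lattice point.
      pos₊ (suc i) i∈S with <-cmp 0ℚ (S₊.u (suc i) (mirror x))
      ... | tri< q _ _ = q
      ... | tri≈ _ q _ = contradiction (sym q) (proj₁ (gap₊ (suc i) i∈S (mirror x)))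
      ... | tri> _ _ q = contradiction (<-≤-trans q (subst (0ℚ ≤_) (sym (u-suc i i∈S)) (≤⇒0≤- (box (suc i) i∈S (∈-allFin (suc i)))))) (<-irrefl refl)
      -- The place where `d < k` is used: with apex coordinate 0, the reflected point would contain
      -- the whole apex and have height at least `d + 1`, so the heights would add up to more than
      -- `2 d + 1`.
      a₀≢0 : a zero ≢ 0ℚ
      a₀≢0 z = contradiction (cast-cancel-≤ {⊕ suc d} {⊕ k'} tall) λ { (ℤ.+≤+ d<k') → ℕ.<-irrefl (sym e) (ℕ.+-mono-≤-< d<k' d<k) }
        where
        tall : ℤ→ℚ (⊕ suc d) ≤ ℤ→ℚ (⊕ k')
        tall = ≤-trans (≤-reflexive (trans (sym (*-identityˡ (ℤ→ℚ (⊕ suc d)))) (cong₂ (λ s n → s * ℤ→ℚ (⊕ n)) (sym one) (sym ℓ-zero))))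
          (≤-trans (Σ-term (suc M) {λ i → S₊.coordinate i (mirror x) * ℤ→ℚ (⊕ ℓ i)} (λ i → 0≤* (S₊.coordinate-nonneg (mirror x) pos₊ i) (≤-trans (<⇒≤ 0<1) (S₊.1≤castℓ i))) zero)
            (≤-reflexive (trans (S₊.height-sum (mirror x)) (cong ℤ→ℚ hy))))
          where
          one : S₊.coordinate zero (mirror x) ≡ 1ℚ
          one = trans (coordinate-mirror zero x) (cong₂ (λ b t → indicator b - t) 0∈S z)
      a₀>0 : 0ℚ < a zero
      a₀>0 with <-cmp 0ℚ (a zero)
      ... | tri< q _ _ = q
      ... | tri≈ _ q _ = contradiction (sym q) a₀≢0
      ... | tri> _ _ q = contradiction (<-≤-trans q (S₋.coordinate-nonneg x pos zero)) (<-irrefl refl)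
      box₊ : ∀ i → lookup S i ≡ true → S₊.u i (mirror x) ≤ 1ℚ
      -- The slack is the apex coordinate minus its shift; the last clause of `Separated` keeps it
      -- positive because the coordinate is.
      box₊ zero i∈S = 0≤-⇒≤ (subst (0ℚ ≤_) (sym (trans (cong (λ t → 1ℚ - t) (u-mirror zero i∈S)) (lem (a zero) (dot (φ zero) p₊)))) (<⇒≤ (proj₂ (proj₂ (proj₂ (gap₊ zero i∈S x)) a₀>0))))
        where lem : ∀ a v → 1ℚ - (1ℚ - a + v) ≡ a - v
              lem = solve-∀ ℚ-ring
      box₊ (suc i) i∈S = 0≤-⇒≤ (subst (0ℚ ≤_) (sym (trans (cong (λ t → 1ℚ - t) (u-suc i i∈S)) (lem (S₋.u (suc i) x)))) (<⇒≤ (pos (suc i) i∈S)))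
        where lem : ∀ a → 1ℚ - (1ℚ - a) ≡ a
              lem = solve-∀ ℚ-ring

    mirror-injective : ∀ x y → mirror x ≡ mirror y → x ≡ y
    mirror-injective x y e = vec-ext λ j → ℤ.neg-injective (begin
      ℤ.- lookup x j ≡⟨ back (lookup (vertexSum S w) j) (lookup x j) ⟨
      ℤ.- lookup (vertexSum S w) j ℤ.+ (lookup (vertexSum S w) j ℤ.- lookup x j) ≡⟨ cong (ℤ._+_ (ℤ.- lookup (vertexSum S w) j)) (trans (sym (Vec.lookup-zipWith ℤ._-_ j (vertexSum S w) x)) (trans (cong (λ v → lookup v j) e) (Vec.lookup-zipWith ℤ._-_ j (vertexSum S w) y))) ⟩
      ℤ.- lookup (vertexSum S w) j ℤ.+ (lookup (vertexSum S w) j ℤ.- lookup y j) ≡⟨ back (lookup (vertexSum S w) j) (lookup y j) ⟩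
      ℤ.- lookup y j ∎)
      where
      open ≡-Reasoning
      back : ∀ s z → ℤ.- s ℤ.+ (s ℤ.- z) ≡ ℤ.- z
      back s z = trans (sym (ℤ.+-assoc (ℤ.- s) s (ℤ.- z))) (trans (cong (ℤ._+ (ℤ.- z)) (ℤ.+-inverseˡ s)) (ℤ.+-identityˡ (ℤ.- z)))

-- The h*-vector of a lattice polytope and Hibi's inequalities.

module HStarVector where

  open import Data.Rational hiding (∣_∣; _/_; pos)
  open import Data.Rational.Properties hiding (_≥?_; _>?_)
  open import Tactic.RingSolver using (solve-∀)
  open import Data.Fin.Subset using (∣_∣)
  open Rationals
  open LinearAlgebra
  open Triangulation
  open Perturbation
  open Cardinality
  open Sequences
  open FStarInequalities using (HStar)
  open LatticeCones

  -- Excluded middle is irrefutable for one proposition, and over a finite list the double negations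
  -- can be collected into one.
  deciders : ∀ {A : Set} (P : A → Set) xs → ¬ ¬ All (λ a → Dec (P a)) xs
  deciders P [] k = k []
  deciders P (x ∷ xs) k = deciders P xs λ ds → k (no (λ p → k (yes p ∷ ds)) ∷ ds)

  subset-decider : ∀ {M} (P : Vec Bool M → Set) → ¬ ¬ (∀ S → Dec (P S))
  subset-decider {M} P k = deciders P (subsets M) λ ds → k (λ S → All.lookup ds (∈-subsets S))

  module _ {M D} {ω : Fin M → Fin D → ℚ} (basis? : ∀ S → Dec (Basis ω S)) where

    functionals-at : ∀ {S} → Dec (Basis ω S) → List (Fin D → ℚ)
    functionals-at (yes B) = List.map (Basis.φ B) (List.allFin M)
    functionals-at (no _) = []

    functionals : List (Fin D → ℚ)
    functionals = List.concatMap (λ S → functionals-at (basis? S)) (subsets M)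

    -- `basis?` may return another record for `S` than `B`, so membership can be claimed only up to
    -- the values of the functional.
    functionals-complete : ∀ {S} (B : Basis ω S) i → ∃ λ ψ → ψ ∈ functionals × (∀ x → dot ψ x ≡ dot (Basis.φ B i) x)
    functionals-complete {S} B i = into (at (basis? S))
      where
      into : (∃ λ ψ → ψ ∈ functionals-at (basis? S) × (∀ x → dot ψ x ≡ dot (Basis.φ B i) x)) → ∃ λ ψ → ψ ∈ functionals × (∀ x → dot ψ x ≡ dot (Basis.φ B i) x)
      into (ψ , p , e) = ψ , ∈-concatMap⁺ (λ S → functionals-at (basis? S)) (lose (∈-subsets S) p) , e
      at : ∀ (d : Dec (Basis ω S)) → ∃ λ ψ → ψ ∈ functionals-at d × (∀ x → dot ψ x ≡ dot (Basis.φ B i) x)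
      at (yes B') = Basis.φ B' i , ∈-map⁺ (Basis.φ B') (∈-allFin i) , λ x → basis-irrelevant B' B x i
      at (no ¬B) = contradiction B ¬B

  perturbed-resp : ∀ {n} {g : Vec ℤ n} {ε q ψ ψ'} → (∀ x → dot ψ x ≡ dot ψ' x) → Perturbed g ε q ψ → Perturbed g ε q ψ'
  perturbed-resp {g = g} {ε} {q} {ψ} {ψ'} e P = record
    { gap₊ = λ nz x → subst₂ Separated (e (castVec x)) (e (λ j → ε * (castVec g j + q j))) (Perturbed.gap₊ P (back nz) x)
    ; gap₋ = λ nz x → subst₂ Separated (e (castVec x)) (e (λ j → ε * (castVec g j - q j))) (Perturbed.gap₋ P (back nz) x)
    ; small₊ = subst (λ t → 0ℚ < 1ℚ + t) (e q) (Perturbed.small₊ P)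
    ; small₋ = subst (λ t → 0ℚ < 1ℚ - t) (e q) (Perturbed.small₋ P) }
    where
    back : Nonzero ψ' → Nonzero ψ
    back (u , ne) = u , λ z → ne (trans (sym (e u)) z)

  dual-nonzero : ∀ {M D} {ω : Fin M → Fin D → ℚ} {S} (B : Basis ω S) i → lookup S i ≡ true → Nonzero (Basis.φ B i)
  dual-nonzero {ω = ω} B i i∈S = ω i , λ z → 1≢0 (trans (sym (trans (Basis.dual B i i i∈S) (δ-refl i))) z)

  card-nonempty : ∀ {d} {S : Point d → Set} {c x} → HasCard S c → S x → 1 ℕ.≤ c
  card-nonempty {x = x} (xs , _ , refl , mem) s = nonempty (Equivalence.from (mem x) s)
    where
    nonempty : ∀ {xs : List (Point _)} → x ∈ xs → 1 ℕ.≤ List.length xs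
    nonempty (here _) = ℕ.s≤s ℕ.z≤n
    nonempty (there _) = ℕ.s≤s ℕ.z≤n

  card-slice : ∀ {d} {S : Point (suc d) → Set} {n : ℤ} {c} → HasCard (λ x → lookup x zero ≡ n × S x) c → HasCard (λ y → S (n Vec.∷ y)) c
  card-slice {d} {S} {n} (xs , u , l , mem) = List.map Vec.tail xs , unique xs u (λ x p → proj₁ (Equivalence.to (mem x) p)) , trans (List.length-map Vec.tail xs) l , λ y → mk⇔ (to y)
      (λ s → ∈-map⁺ Vec.tail (Equivalence.from (mem (n Vec.∷ y)) (refl , s)))
    where
    to : ∀ y → y ∈ List.map Vec.tail xs → S (n Vec.∷ y)
    to y p with ∈-map⁻ Vec.tail p
    ... | (_ Vec.∷ _) , q , refl with Equivalence.to (mem _) q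
    ...   | refl , s = s
    unique : ∀ xs → Unique xs → (∀ x → x ∈ xs → lookup x zero ≡ n) → Unique (List.map Vec.tail xs)
    unique [] _ _ = AllPairs.[]
    unique (x ∷ xs) (x∉ AllPairs.∷ u) h = All.tabulate (λ {y} p e → fresh y p e) AllPairs.∷ unique xs u (λ x p → h x (there p))
      where
      fresh : ∀ y → y ∈ List.map Vec.tail xs → Vec.tail x ≡ y → ⊥
      fresh y p e with ∈-map⁻ Vec.tail p
      ... | x' , q , refl = All.lookup x∉ q (same x x' (trans (h x (here refl)) (sym (h x' (there q)))) e)
        where
        same : ∀ (x x' : Vec ℤ (suc d)) → lookup x zero ≡ lookup x' zero → Vec.tail x ≡ Vec.tail x' → x ≡ x'
        same (_ Vec.∷ _) (_ Vec.∷ _) refl refl = refl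

  homogenise : ∀ {d m} → (Fin m → Point d) → Fin m → Vec ℤ (suc d)
  homogenise vs i = ⊕ 1 Vec.∷ vs i

  extend : ∀ {A : Set} {m} → A → (Fin m → A) → Fin (suc m) → A
  extend a f zero = a
  extend a f (suc i) = f i

  -- The height coordinate says that the weights sum to `n + 1`; dividing by it, or multiplying by
  -- it, passes between conic and convex weights.
  inCone-dilate : ∀ {d m} (vs : Fin m → Point d) n y → InCone (λ i → castVec (homogenise vs i)) (castVec (⊕ suc n Vec.∷ y)) ⇔ InDilate (suc n) vs y
  inCone-dilate {d} {m} vs n y = mk⇔ to from
    where
    N = ℤ→ℚ (⊕ suc n)
    N>0 : 0ℚ < N
    N>0 = cast-mono-< {⊕ 0} {⊕ suc n} (ℤ.+<+ (ℕ.s≤s ℕ.z≤n))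
    v : Fin d → Fin m → ℚ
    v j i = ℤ→ℚ (lookup (vs i) j)
    to : InCone (λ i → castVec (homogenise vs i)) (castVec (⊕ suc n Vec.∷ y)) → InDilate (suc n) vs y
    to (wt , wt≥0 , rep) = scale (inverse-pos N>0)
      where
      scale : (∃ λ r → 0ℚ < r × N * r ≡ 1ℚ) → InDilate (suc n) vs y
      scale (r , r>0 , Nr) = (λ i → r * wt i) , (λ i → 0≤* (<⇒≤ r>0) (wt≥0 i)) , sum-one , point
        where
        open ≡-Reasoning
        sum-one : Σℚ m (λ i → r * wt i) ≡ 1ℚ
        sum-one = begin
          Σℚ m (λ i → r * wt i) ≡⟨ Σ-*ˡ m r wt ⟩
          r * Σℚ m wt ≡⟨ cong (r *_) (trans (Σ-cong m (λ i → sym (*-identityʳ (wt i)))) (rep zero)) ⟩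
          r * N ≡⟨ trans (*-comm r N) Nr ⟩
          1ℚ ∎
        point : ∀ j → ℤ→ℚ (lookup y j) ≡ N * Σℚ m (λ i → r * wt i * v j i)
        point j = sym (begin
          N * Σℚ m (λ i → r * wt i * v j i) ≡⟨ cong (N *_) (trans (Σ-cong m (λ i → *-assoc r (wt i) (v j i))) (Σ-*ˡ m r (λ i → wt i * v j i))) ⟩
          N * (r * Σℚ m (λ i → wt i * v j i)) ≡⟨ *-assoc N r (Σℚ m (λ i → wt i * v j i)) ⟨
          N * r * Σℚ m (λ i → wt i * v j i) ≡⟨ cong₂ _*_ Nr (rep (suc j)) ⟩
          1ℚ * ℤ→ℚ (lookup y j) ≡⟨ *-identityˡ (ℤ→ℚ (lookup y j)) ⟩
          ℤ→ℚ (lookup y j) ∎)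
    from : InDilate (suc n) vs y → InCone (λ i → castVec (homogenise vs i)) (castVec (⊕ suc n Vec.∷ y))
    from (λs , λs≥0 , sum-one , point) = (λ i → N * λs i) , (λ i → 0≤* (<⇒≤ N>0) (λs≥0 i)) , rep
      where
      rep : ∀ j → comb (λ i → castVec (homogenise vs i)) (λ i → N * λs i) j ≡ castVec (⊕ suc n Vec.∷ y) j
      rep zero = trans (Σ-cong m (λ i → *-identityʳ (N * λs i))) (trans (Σ-*ˡ m N λs) (trans (cong (N *_) sum-one) (*-identityʳ N)))
      rep (suc j) = trans (Σ-cong m (λ i → *-assoc N (λs i) (v j i))) (trans (Σ-*ˡ m N (λ i → λs i * v j i)) (sym (point j)))

  -- The height coordinate of a relation gives `c zero = - Σ c (suc k)`. Substituting this into the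
  -- other coordinates leaves a relation among the difference vectors, to which affine independence
  -- applies.
  homogenise-independent : ∀ {d m} (vs : Fin m → Point d) (i₀ : Fin m) (is : Fin d → Fin m) →
    (∀ (c : Fin d → ℚ) → (∀ j → Σℚ d (λ k → c k * ℤ→ℚ (lookup (vs (is k)) j ℤ.- lookup (vs i₀) j)) ≡ 0ℚ) → ∀ k → c k ≡ 0ℚ) →
    ∀ (c : Fin (suc d) → ℚ) → (∀ j → Σℚ (suc d) (λ k → c k * castVec (homogenise vs (extend i₀ is k)) j) ≡ 0ℚ) → ∀ k → c k ≡ 0ℚ
  homogenise-independent {d} vs i₀ is full c rel = zeros
    where
    open ≡-Reasoning
    s = Σℚ d (λ k → c (suc k))
    v : Fin d → Fin d → ℚ
    v j k = ℤ→ℚ (lookup (vs (is k)) j)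
    v₀ : Fin d → ℚ
    v₀ j = ℤ→ℚ (lookup (vs i₀) j)
    heights : c zero + s ≡ 0ℚ
    heights = trans (sym (cong₂ _+_ (*-identityʳ (c zero)) (Σ-cong d (λ k → *-identityʳ (c (suc k)))))) (rel zero)
    differences : ∀ j → Σℚ d (λ k → c (suc k) * ℤ→ℚ (lookup (vs (is k)) j ℤ.- lookup (vs i₀) j)) ≡ 0ℚ
    differences j = begin
      Σℚ d (λ k → c (suc k) * ℤ→ℚ (lookup (vs (is k)) j ℤ.- lookup (vs i₀) j))
        ≡⟨ Σ-cong d (λ k → trans (cong (c (suc k) *_) (cast-sub (lookup (vs (is k)) j) (lookup (vs i₀) j))) (lem₁ (c (suc k)) (v j k) (v₀ j))) ⟩
      Σℚ d (λ k → c (suc k) * v j k + c (suc k) * - v₀ j) ≡⟨ Σ-+ d (λ k → c (suc k) * v j k) (λ k → c (suc k) * - v₀ j) ⟩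
      t + Σℚ d (λ k → c (suc k) * - v₀ j) ≡⟨ cong (t +_) (Σ-*ʳ d (- v₀ j) (λ k → c (suc k))) ⟩
      t + s * - v₀ j ≡⟨ lem₂ t s (v₀ j) (c zero) ⟩
      c zero * v₀ j + t - (c zero + s) * v₀ j ≡⟨ cong₂ (λ a b → a - b * v₀ j) (rel (suc j)) heights ⟩
      0ℚ - 0ℚ * v₀ j ≡⟨ lem₃ (v₀ j) ⟩
      0ℚ ∎
      where
      t = Σℚ d (λ k → c (suc k) * v j k)
      lem₁ : ∀ c a b → c * (a - b) ≡ c * a + c * - b
      lem₁ = solve-∀ ℚ-ring
      lem₂ : ∀ t s v c → t + s * - v ≡ c * v + t - (c + s) * v
      lem₂ = solve-∀ ℚ-ring
      lem₃ : ∀ v → 0ℚ - 0ℚ * v ≡ 0ℚ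
      lem₃ = solve-∀ ℚ-ring
    tail-zero : ∀ k → c (suc k) ≡ 0ℚ
    tail-zero = full (λ k → c (suc k)) differences
    zeros : ∀ k → c k ≡ 0ℚ
    zeros (suc k) = tail-zero k
    zeros zero = trans (sym (+-identityʳ (c zero))) (trans (cong (c zero +_) (sym (Σ-zero d tail-zero))) heights)
  module Polytope {d m} (vs : Fin m → Point d) {S₀ : Vec Bool m}
    (B₀ : Basis (λ i → castVec (homogenise vs i)) S₀) where

    w : Fin m → Vec ℤ (suc d)
    w = homogenise vs

    ω : Fin m → Fin (suc d) → ℚ
    ω i = castVec (w i)

    -- An interior lattice vector of the cone; as the first generator it belongs to every cell.
    g : Vec ℤ (suc d)
    g = vertexSum S₀ w

    w⁺ : Fin (suc m) → Vec ℤ (suc d)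
    w⁺ = extend g w

    ω⁺ : Fin (suc m) → Fin (suc d) → ℚ
    ω⁺ i = castVec (w⁺ i)

    ℓ : Fin m → ℕ
    ℓ _ = 1

    ℓ⁺ : Fin (suc m) → ℕ
    ℓ⁺ = extend (suc d) ℓ

    height : ∀ i → lookup (w i) zero ≡ ⊕ ℓ i
    height i = refl

    height-g : lookup g zero ≡ ⊕ suc d
    height-g = cast-injective (trans (castVec-vertexSum S₀ w zero) (trans (Σ-cong m (λ i → *-identityʳ (indicator (lookup S₀ i))))
      (trans (Σ-indicator S₀) (cong (λ n → ℤ→ℚ (⊕ n)) (basis-card B₀)))))

    height⁺ : ∀ i → lookup (w⁺ i) zero ≡ ⊕ ℓ⁺ i
    height⁺ zero = height-g
    height⁺ (suc i) = refl

    ℓ-pos : ∀ i → 1 ℕ.≤ ℓ i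
    ℓ-pos i = ℕ.≤-refl

    ℓ⁺-pos : ∀ i → 1 ℕ.≤ ℓ⁺ i
    ℓ⁺-pos zero = ℕ.s≤s ℕ.z≤n
    ℓ⁺-pos (suc i) = ℕ.≤-refl

    cone⊆cone⁺ : ∀ x → InCone ω x → InCone ω⁺ x
    cone⊆cone⁺ x (wt , wt≥0 , rep) = extend 0ℚ wt , nn , λ j → trans (cong (_+ comb ω wt j) (*-zeroˡ (castVec g j))) (trans (+-identityˡ (comb ω wt j)) (rep j))
      where
      nn : ∀ i → 0ℚ ≤ extend 0ℚ wt i
      nn zero = ≤-refl
      nn (suc i) = wt≥0 i

    indicator-nonneg : ∀ b → 0ℚ ≤ indicator b
    indicator-nonneg true = <⇒≤ 0<1
    indicator-nonneg false = ≤-refl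

    -- `g` is a sum of old generators, so its weight can be spread over the members of `S₀`.
    cone⁺⊆cone : ∀ x → InCone ω⁺ x → InCone ω x
    cone⁺⊆cone x (wt , wt≥0 , rep) = (λ i → wt zero * indicator (lookup S₀ i) + wt (suc i)) , (λ i → 0≤+ (0≤* (wt≥0 zero) (indicator-nonneg (lookup S₀ i))) (wt≥0 (suc i))) , λ j →
      trans (comb-add ω (λ i → wt zero * indicator (lookup S₀ i)) (λ i → wt (suc i)) j)
        (trans (cong (_+ comb ω (λ i → wt (suc i)) j) (trans (comb-* ω (wt zero) (λ i → indicator (lookup S₀ i)) j) (cong (wt zero *_) (sym (castVec-vertexSum S₀ w j))))) (rep j))

    module Counting
      (basis? : ∀ S → Dec (Basis ω S)) (optimal? : ∀ S → Dec (LexOptimal ω S))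
      (basis⁺? : ∀ S → Dec (Basis ω⁺ S)) (optimal⁺? : ∀ S → Dec (LexOptimal ω⁺ S))
      {S₁ : Vec Bool (suc m)} (B₁ : Basis ω⁺ S₁)
      (ε : ℚ) (q : Fin (suc d) → ℚ) (ε>0 : 0ℚ < ε)
      (perturbed-δ : Perturbed g ε q (δ zero))
      (perturbed : ∀ {S} (B : Basis ω S) i → Perturbed g ε q (Basis.φ B i))
      (perturbed⁺ : ∀ {S} (B : Basis ω⁺ S) i → Perturbed g ε q (Basis.φ B i)) where

      p₊ p₋ : Fin (suc d) → ℚ
      p₊ j = ε * (castVec g j + q j)
      p₋ j = ε * (castVec g j - q j)

      dot-p₊ : ∀ ψ → dot ψ p₊ ≡ ε * (dot ψ (castVec g) + dot ψ q)
      dot-p₊ ψ = trans (dot-*ʳ ε ψ (λ j → castVec g j + q j)) (cong (ε *_) (dot-addʳ ψ (castVec g) q))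

      dot-p₋ : ∀ ψ → dot ψ p₋ ≡ ε * (dot ψ (castVec g) - dot ψ q)
      dot-p₋ ψ = trans (dot-*ʳ ε ψ (λ j → castVec g j - q j)) (cong (ε *_) (dot-subʳ ψ (castVec g) q))

      p-inCone : ∀ p → (∀ i → 0ℚ ≤ dot (Basis.φ B₀ i) p) → InCone ω p
      p-inCone p nn = (λ i → dot (Basis.φ B₀ i) p) , nn , Basis.recon B₀ p

      -- On `S₀` all coordinates of `g` are 1, and those of `q` are smaller than 1 in absolute
      -- value.
      p₊∈cone : InCone ω p₊
      p₊∈cone = p-inCone p₊ nn
        where
        nn : ∀ i → 0ℚ ≤ dot (Basis.φ B₀ i) p₊
        nn i with lookup S₀ i in e
        ... | false = ≤-reflexive (sym (Basis.off-dot B₀ i e p₊))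
        ... | true = subst (0ℚ ≤_) (sym (trans (dot-p₊ (Basis.φ B₀ i)) (cong (λ t → ε * (t + dot (Basis.φ B₀ i) q)) (trans (coordinate-vertexSum w B₀ i) (cong indicator e)))))
                       (0≤* (<⇒≤ ε>0) (<⇒≤ (Perturbed.small₊ (perturbed B₀ i))))

      p₋∈cone : InCone ω p₋
      p₋∈cone = p-inCone p₋ nn
        where
        nn : ∀ i → 0ℚ ≤ dot (Basis.φ B₀ i) p₋
        nn i with lookup S₀ i in e
        ... | false = ≤-reflexive (sym (Basis.off-dot B₀ i e p₋))
        ... | true = subst (0ℚ ≤_) (sym (trans (dot-p₋ (Basis.φ B₀ i)) (cong (λ t → ε * (t - dot (Basis.φ B₀ i) q)) (trans (coordinate-vertexSum w B₀ i) (cong indicator e)))))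
                       (0≤* (<⇒≤ ε>0) (<⇒≤ (Perturbed.small₋ (perturbed B₀ i))))

      -- The height functional `δ zero` was included in the perturbation, so the height of `q`
      -- exceeds -1, while `g` has height `d + 1`.
      p₊-height : 0ℚ < p₊ zero
      p₊-height = 0<* ε>0 (subst (0ℚ <_) (trans (lem (ℤ→ℚ (⊕ d)) (q zero)) (cong (_+ q zero) (sym (trans (cong ℤ→ℚ height-g) (cast-+ (⊕ 1) (⊕ d))))))
          (0<+≤ (subst (λ t → 0ℚ < 1ℚ + t) (Σ-δˡ (suc d) q zero) (Perturbed.small₊ perturbed-δ)) (cast-mono-≤ {⊕ 0} {⊕ d} (ℤ.+≤+ ℕ.z≤n))))
        where lem : ∀ d q → 1ℚ + q + d ≡ 1ℚ + d + q
              lem = solve-∀ ℚ-ring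

      gap₊ : ∀ {S} (B : Basis ω S) i → lookup S i ≡ true → Gap p₊ (Basis.φ B i)
      gap₊ B i e = Perturbed.gap₊ (perturbed B i) (dual-nonzero B i e)

      gap⁺₊ : ∀ {S} (B : Basis ω⁺ S) i → lookup S i ≡ true → Gap p₊ (Basis.φ B i)
      gap⁺₊ B i e = Perturbed.gap₊ (perturbed⁺ B i) (dual-nonzero B i e)

      gap⁺₋ : ∀ {S} (B : Basis ω⁺ S) i → lookup S i ≡ true → Gap p₋ (Basis.φ B i)
      gap⁺₋ B i e = Perturbed.gap₋ (perturbed⁺ B i) (dual-nonzero B i e)

      module F = Fan w ℓ height ℓ-pos basis? optimal? B₀ p₊ p₊∈cone gap₊
      module G₊ = Fan w⁺ ℓ⁺ height⁺ ℓ⁺-pos basis⁺? optimal⁺? B₁ p₊ (cone⊆cone⁺ p₊ p₊∈cone) gap⁺₊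
      module G₋ = Fan w⁺ ℓ⁺ height⁺ ℓ⁺-pos basis⁺? optimal⁺? B₁ p₋ (cone⊆cone⁺ p₋ p₋∈cone) gap⁺₋

      ehr : ℕ → ℤ
      ehr n = ⊕ F.total [] n

      cone-iff : ∀ n x → (lookup x zero ≡ ⊕ n × InCone ω⁺ (castVec x)) ⇔ (lookup x zero ≡ ⊕ n × InCone ω (castVec x))
      cone-iff n x = mk⇔ (λ { (h , c) → h , cone⁺⊆cone (castVec x) c }) (λ { (h , c) → h , cone⊆cone⁺ (castVec x) c })

      ehr₊ : ∀ n → ⊕ G₊.total [] n ≡ ehr n
      ehr₊ n = cong ⊕_ (card-unique (G₊.total-card n) (F.total-card n) (cone-iff n))

      ehr₋ : ∀ n → ⊕ G₋.total [] n ≡ ehr n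
      ehr₋ n = cong ⊕_ (card-unique (G₋.total-card n) (F.total-card n) (cone-iff n))

      h : ℕ → ℤ
      h n = ⊕ F.total (List.allFin m) n

      ∇ehr≡h : ∀ n → ∇^ (suc d) ehr n ≡ h n
      ∇ehr≡h n = sym (F.total-∇^ (λ _ → refl) n)

      h-vanishes : ∀ n → d ℕ.< n → h n ≡ ⊕ 0
      h-vanishes n d<n = cong ⊕_ (F.boxes-low (λ _ → refl) p₊-height n d<n)

      -- The series `h(t) / (1 - t)`, hence the partial sums of `h`; multiplied by `1 - t^(d + 1)`
      -- it becomes the box series of the pulled fan.
      s : ℕ → ℤ
      s = ∇^ d ehr

      ∇s≡h : ∀ n → ∇ 1 s n ≡ h n
      ∇s≡h n = trans (sym (∇^-outer d ehr n)) (∇ehr≡h n)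

      op : (ℕ → ℤ) → ℕ → ℤ
      op t = ∇ (suc d) (∇^ d t)

      op-zero : ∀ n → op (λ _ → ⊕ 0) n ≡ ⊕ 0
      op-zero n = trans (∇-cong (suc d) (∇^-zero d) n) (∇-zero (suc d) n)

      op-add : ∀ a b n → op (λ n → a n ℤ.+ b n) n ≡ op a n ℤ.+ op b n
      op-add a b n = trans (∇-cong (suc d) (∇^-add d a b) n) (∇-add (suc d) (∇^ d a) (∇^ d b) n)

      -- Every cell contains the apex of height `d + 1`, and a basis has `d + 1` members, so exactly
      -- `d` unit heights remain.
      op-cell : ∀ {S} → Basis ω⁺ S → LexOptimal ω⁺ S → ∀ t n → reduce (lookup S) ℓ⁺ (List.allFin (suc m)) t n ≡ op t n
      op-cell {S} B opt t n = trans (cong (λ is → reduce (lookup S) ℓ⁺ is t n) (allFin-suc m)) (apex S (optimal-first B opt) (basis-card B))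
        where
        apex : ∀ S → lookup S zero ≡ true → ∣ S ∣ ≡ suc d → reduce (lookup S) ℓ⁺ (zero ∷ List.map suc (List.allFin m)) t n ≡ op t n
        apex (true Vec.∷ S) refl card = ∇-cong (suc d) (λ n → trans (reduce-one (lookup (true Vec.∷ S)) ℓ⁺ (List.map suc (List.allFin m)) ones t n)
            (cong (λ k → ∇^ k t n) (trans (trues-suc (lookup (true Vec.∷ S)) (List.allFin m)) (trans (trues-allFin S) (ℕ.suc-injective card))))) n
          where
          ones : All (λ i → ℓ⁺ i ≡ 1) (List.map suc (List.allFin m))
          ones = All.tabulate (λ p → one (∈-map⁻ suc p))
            where
            one : ∀ {i} → (∃ λ i' → i' ∈ List.allFin m × i ≡ suc i') → ℓ⁺ i ≡ 1
            one (_ , _ , refl) = refl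

      boxes₊ : ∀ n → ⊕ G₊.total (List.allFin (suc m)) n ≡ ∇ (suc d) s n
      boxes₊ n = trans (G₊.total-reduce op op-zero op-add op-cell n) (∇-cong (suc d) (∇^-cong d ehr₊) n)

      boxes₋ : ∀ n → ⊕ G₋.total (List.allFin (suc m)) n ≡ ∇ (suc d) s n
      boxes₋ n = trans (G₋.total-reduce op op-zero op-add op-cell n) (∇-cong (suc d) (∇^-cong d ehr₋) n)

      -- Both fans have the same generators and hence the same cells; they differ only in which
      -- faces a half-open cell keeps. The comparison can therefore be made for each `S` separately.
      boxes-reflect : ∀ {k k'} → d ℕ.< k → k' ℕ.+ k ≡ suc d ℕ.+ d → G₋.total (List.allFin (suc m)) k ℕ.≤ G₊.total (List.allFin (suc m)) k'
      boxes-reflect {k} {k'} d<k e = sum (subsets (suc m))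
        where
        cell : ∀ S → G₋.cell-count (List.allFin (suc m)) k S ℕ.≤ G₊.cell-count (List.allFin (suc m)) k' S
        cell S = card-inject (G₋.cell-card (List.allFin (suc m)) k S) (G₊.cell-card (List.allFin (suc m)) k' S) reflect into injective
          where
          reflect : Vec ℤ (suc d) → Vec ℤ (suc d)
          reflect x = Vec.zipWith ℤ._-_ (vertexSum S w⁺) x
          module At (B : Basis ω⁺ S) (opt : LexOptimal ω⁺ S) where
            0∈S : lookup S zero ≡ true
            0∈S = optimal-first B opt
            g-coordinate : ∀ i → dot (Basis.φ B i) (castVec g) ≡ δ i zero
            g-coordinate i = Basis.dual B i zero 0∈S
            opposite : ∀ i → dot (Basis.φ B (suc i)) p₋ ≡ - dot (Basis.φ B (suc i)) p₊
            opposite i = trans (dot-p₋ (Basis.φ B (suc i))) (trans (cong (λ t → ε * (t - b)) (g-coordinate (suc i))) (trans (lem ε b)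
                (cong -_ (sym (trans (dot-p₊ (Basis.φ B (suc i))) (cong (λ t → ε * (t + b)) (g-coordinate (suc i))))))))
              where
              b = dot (Basis.φ B (suc i)) q
              lem : ∀ ε b → ε * (0ℚ - b) ≡ - (ε * (0ℚ + b))
              lem = solve-∀ ℚ-ring
            positive₊ : 0ℚ < dot (Basis.φ B zero) p₊
            positive₊ = subst (0ℚ <_) (sym (trans (dot-p₊ (Basis.φ B zero)) (cong (λ t → ε * (t + dot (Basis.φ B zero) q)) (g-coordinate zero)))) (0<* ε>0 (Perturbed.small₊ (perturbed⁺ B zero)))
            positive₋ : 0ℚ < dot (Basis.φ B zero) p₋
            positive₋ = subst (0ℚ <_) (sym (trans (dot-p₋ (Basis.φ B zero)) (cong (λ t → ε * (t - dot (Basis.φ B zero) q)) (g-coordinate zero)))) (0<* ε>0 (Perturbed.small₋ (perturbed⁺ B zero)))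
            open Mirror w⁺ ℓ⁺ height⁺ ℓ⁺-pos refl (λ _ → refl) B 0∈S p₊ p₋ (gap⁺₊ B) (gap⁺₋ B) opposite positive₊ positive₋ public
          into : ∀ x → G₋.InCell (List.allFin (suc m)) k S x → G₊.InCell (List.allFin (suc m)) k' S (reflect x)
          into x (B , opt , r) = B , opt , At.mirror-region B opt d<k e x r
          injective : ∀ x y → G₋.InCell (List.allFin (suc m)) k S x → G₋.InCell (List.allFin (suc m)) k S y → reflect x ≡ reflect y → x ≡ y
          injective x y (B , opt , _) _ = At.mirror-injective B opt x y
        sum : ∀ Ss → sumOver Ss (G₋.cell-count (List.allFin (suc m)) k) ℕ.≤ sumOver Ss (G₊.cell-count (List.allFin (suc m)) k')
        sum [] = ℕ.z≤n
        sum (S ∷ Ss) = ℕ.+-mono-≤ (cell S) (sum Ss)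

      s-cumulative : ∀ n → s n ≡ ∑ (suc n) h
      s-cumulative n = trans (cumulative s n) (∑-cong (suc n) (λ k _ → ∇s≡h k))

      hstar : HStar d h
      hstar = record
        { nonneg = λ j → ℤ.+≤+ ℕ.z≤n
        -- The origin is a lattice point of the cone at height 0, so `ehr 0 ≥ 1`, and `∇ 1` does not
        -- change the value at index 0.
        ; constant-pos = ℤ.≤-trans (ℤ.+≤+ (card-nonempty {x = origin} (F.total-card 0) (Vec.lookup-replicate (Fin.zero {d}) (⊕ 0) , (λ _ → 0ℚ) , (λ _ → ≤-refl) , zero-rep))) (ℤ.≤-reflexive initial)
        ; hibi = λ i i≤d → subst₂ ℤ._≤_ (cong₂ ℤ._-_ (s-cumulative d) (s-cumulative (d ℕ.∸ i))) (s-cumulative i)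
            (tail-sum-bound s d i i≤d (λ j d<j → trans (∇s≡h j) (h-vanishes j d<j)) (compare i i≤d)) }
        where
        origin : Vec ℤ (suc d)
        origin = Vec.replicate (suc d) (⊕ 0)
        zero-rep : ∀ j → comb ω (λ _ → 0ℚ) j ≡ castVec origin j
        zero-rep j = trans (Σ-zero m (λ i → *-zeroˡ (ω i j))) (cong ℤ→ℚ (sym (Vec.lookup-replicate j (⊕ 0))))
        initial-∇^ : ∀ k t → ∇^ k t 0 ≡ t 0
        initial-∇^ zero t = refl
        initial-∇^ (suc k) t = trans (initial-∇^ k (∇ 1 t)) (ℤ.+-identityʳ (t 0))
        initial : ehr 0 ≡ h 0
        initial = trans (sym (initial-∇^ (suc d) ehr)) (∇ehr≡h 0)
        compare : ∀ i → i ℕ.≤ d → ∇ (suc d) s (suc d ℕ.+ (d ℕ.∸ i)) ℤ.≤ ∇ (suc d) s i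
        compare i i≤d = subst₂ ℤ._≤_ (boxes₋ (suc d ℕ.+ (d ℕ.∸ i))) (boxes₊ i) (ℤ.+≤+ (boxes-reflect (ℕ.s≤s (ℕ.m≤m+n d (d ℕ.∸ i))) sum))
          where
          sum : i ℕ.+ (suc d ℕ.+ (d ℕ.∸ i)) ≡ suc d ℕ.+ d
          sum = trans (ℕ.+-comm i (suc d ℕ.+ (d ℕ.∸ i))) (trans (ℕ.+-assoc (suc d) (d ℕ.∸ i) i) (cong (suc d ℕ.+_) (ℕ.m∸n+n≡m i≤d)))

      ehr-card : ∀ n → HasCard (InDilate (suc n) vs) (F.total [] (suc n))
      ehr-card n = card-resp (inCone-dilate vs n) (card-slice (F.total-card (suc n)))

      fstar-expansion : ∀ f → IsFStar vs f → ∀ k → k ℕ.≤ d → f k ≡ ∑ (suc d) (λ j → h j ℤ.* binomial (suc d ℕ.∸ j) (d ℕ.∸ k))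
      fstar-expansion f isF = fstar-from-hstar d ehr h f (λ j → h-vanishes j) ∇ehr≡h (λ n → trans (isF n (F.total [] (suc n)) (ehr-card n)) (Σℤ≡∑ (suc d) (λ k → f k ℤ.* binomial n k)))

  HStarOf : ∀ {d m} → (Fin m → Point d) → Set
  HStarOf {d} vs = ∃ λ h → HStar d h × (∀ f → IsFStar vs f → ∀ k → k ℕ.≤ d → f k ≡ ∑ (suc d) (λ j → h j ℤ.* binomial (suc d ℕ.∸ j) (d ℕ.∸ k)))

  -- The cells are decided only up to double negation, which is harmless because integer inequalities are stable.
  hstar-exists : ∀ {d m} (vs : Fin m → Point d) → FullDim vs → ¬ ¬ HStarOf vs
  hstar-exists {d} {m} vs (i₀ , is , full) = build (independent⇒basis (λ i → castVec (w i)) (extend i₀ is) indep)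
    where
    w = homogenise vs
    indep : ∀ (c : Fin (suc d) → ℚ) → (∀ j → Σℚ (suc d) (λ k → c k * castVec (w (extend i₀ is k)) j) ≡ 0ℚ) → ∀ k → c k ≡ 0ℚ
    indep = homogenise-independent vs i₀ is full
    build : (∃ λ S → Basis (λ i → castVec (w i)) S) → ¬ ¬ HStarOf vs
    build (S₀ , B₀) no-h = subset-decider (Basis P.ω) λ basis? → subset-decider (LexOptimal P.ω) λ optimal? →
        subset-decider (Basis P.ω⁺) λ basis⁺? → subset-decider (LexOptimal P.ω⁺) λ optimal⁺? →
        -- One perturbation has to serve the original fan, the pulled fan and the height functional,
        -- so their functionals are joined in one list.
        no-h (finish basis? optimal? basis⁺? optimal⁺? (perturbation (δ zero ∷ functionals basis? List.++ functionals basis⁺?) P.g))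
      where
      module P = Polytope vs B₀
      B₁ : ∃ λ S → Basis P.ω⁺ S
      B₁ = independent⇒basis P.ω⁺ (λ k → suc (extend i₀ is k)) indep
      finish : ∀ basis? (optimal? : ∀ S → Dec (LexOptimal P.ω S)) basis⁺? (optimal⁺? : ∀ S → Dec (LexOptimal P.ω⁺ S)) →
        (∃ λ ε → ∃ λ q → 0ℚ < ε × All (Perturbed P.g ε q) (δ zero ∷ functionals basis? List.++ functionals basis⁺?)) → HStarOf vs
      finish basis? optimal? basis⁺? optimal⁺? (ε , q , ε>0 , all) = C.h , C.hstar , C.fstar-expansion
        where
        perturbed : ∀ {S} (B : Basis P.ω S) i → Perturbed P.g ε q (Basis.φ B i)
        perturbed B i = from (functionals-complete basis? B i)
          where
          from : (∃ λ ψ → ψ ∈ functionals basis? × (∀ x → dot ψ x ≡ dot (Basis.φ B i) x)) → Perturbed P.g ε q (Basis.φ B i)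
          from (ψ , p , e) = perturbed-resp e (All.lookup all (there (∈-++⁺ˡ p)))
        perturbed⁺ : ∀ {S} (B : Basis P.ω⁺ S) i → Perturbed P.g ε q (Basis.φ B i)
        perturbed⁺ B i = from (functionals-complete basis⁺? B i)
          where
          from : (∃ λ ψ → ψ ∈ functionals basis⁺? × (∀ x → dot ψ x ≡ dot (Basis.φ B i) x)) → Perturbed P.g ε q (Basis.φ B i)
          from (ψ , p , e) = perturbed-resp e (All.lookup all (there (∈-++⁺ʳ (functionals basis?) p)))
        module C = P.Counting basis? optimal? basis⁺? optimal⁺? (proj₂ B₁) ε q ε>0 (All.lookup all (here refl)) perturbed perturbed⁺

  ℤ<-stable : ∀ {a b : ℤ} → ¬ ¬ (a ℤ.< b) → a ℤ.< b
  ℤ<-stable {a} {b} = decidable-stable (a ℤ.<? b)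

  ℤ≤-stable : ∀ {a b : ℤ} → ¬ ¬ (a ℤ.≤ b) → a ℤ.≤ b
  ℤ≤-stable {a} {b} = decidable-stable (a ℤ.≤? b)

open import Data.Nat as ℕ using (ℕ; suc; _+_; _*_; _∸_; _/_)
open import Data.Integer as ℤ using (ℤ)
open import Data.Fin using (Fin)
open import Data.Product using (_×_)

theorem1p3 : (d m : ℕ) → 2 ℕ.≤ d → (vs : Fin m → Point d) → FullDim vs →
    (f : ℕ → ℤ) → IsFStar vs f →
    ((∀ k → k + 2 ℕ.≤ d / 2 → f k ℤ.< f (suc k)) × f (d / 2 ∸ 1) ℤ.≤ f (d / 2))
    × (∀ k → (3 * d) / 4 ℕ.≤ k → k ℕ.< d → f (suc k) ℤ.< f k)
    × (∀ k → 2 * k + 3 ℕ.≤ d → f k ℤ.≤ f (d ∸ 1 ∸ k))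
theorem1p3 d m 2≤d vs full f isFStar =
    ((λ k p → ℤ<-stable (since λ c → proj₁ (proj₁ c) k p)) , ℤ≤-stable (since λ c → proj₂ (proj₁ c)))
  , (λ k p q → ℤ<-stable (since λ c → proj₁ (proj₂ c) k p q))
  , (λ k p → ℤ≤-stable (since λ c → proj₂ (proj₂ c) k p))
  where
  open HStarVector using (hstar-exists; ℤ<-stable; ℤ≤-stable)
  Conclusions : Set
  Conclusions =
    ((∀ k → k + 2 ℕ.≤ d / 2 → f k ℤ.< f (suc k)) × f (d / 2 ∸ 1) ℤ.≤ f (d / 2))
    × (∀ k → (3 * d) / 4 ℕ.≤ k → k ℕ.< d → f (suc k) ℤ.< f k)
    × (∀ k → 2 * k + 3 ℕ.≤ d → f k ℤ.≤ f (d ∸ 1 ∸ k))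
  since : ∀ {P : Set} → (Conclusions → P) → ¬ ¬ P
  since use ¬P = hstar-exists vs full λ (h , hstar , expansion) →
    ¬P (use (FStarInequalities.Inequalities.conclusions d h f hstar (expansion f isFStar) 2≤d))
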